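{- Let $n\ge2$, $k\ge0$. Then \[ \frac{x_n^{2k}}{\int_{S^{n-1}}x_n^{2k}\,d\sigma}=\sum_{l=0}^{k}\frac{k!\,\Gamma\!\left(\frac{2k+n}{2}\right)}{(k-l)!\,\Gamma\!\left(\frac{2k+2l+n}{2}\right)}\,N(n,2l)\,r^{2k-2l}L_{n,2l}. \]
   Context: $\sigma$: rotation-invariant probability measure on $S^{n-1}$; $r^2=x_1^2+\dots+x_n^2$. $H_{n,d}$ is the space of harmonic real forms of degree $d$ in $n$ variables, $N(n,d)=\dim H_{n,d}=\frac{(2d+n-2)(d+n-3)!}{d!(n-2)!}$. $L_{n,d}$ is the unique $L\in H_{n,d}$ with $L(Ax)=L(x)$ for all $A\in SO(n)$ with $Ae_n=e_n$ and $L(e_n)=1$.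
   Formalization: For n=2 the stabiliser of e_n in SO(2) is trivial, so L_{2,d} is not unique as defined (d≥1); there invariance under the reflection x_1 ↦ -x_1 is also required. N(2,0), where the formula reads 0·(-1)!, is taken to be the dimension 1. -}

module Defs where

open import Algebra.Bundles.Raw using (RawSemiring)
import Algebra.Definitions
import Algebra.Definitions.RawSemiring
open import Data.Bool.Base using (if_then_else_)
open import Data.Fin.Base using (Fin; zero; suc; toℕ; fromℕ; punchIn)
import Data.Fin.Properties as Fin
open import Data.Integer.Base using (+_)
open import Data.List.Base as List using (List)
open import Data.Nat.Base as ℕ using (ℕ; zero; suc; _!)
import Data.Nat.Properties as ℕ
open import Data.Product.Base using (Σ; Σ-syntax; _,_; proj₁; proj₂; _×_)
open import Data.Rational.Base as ℚ using (ℚ; 0ℚ; 1ℚ; ½)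
import Data.Rational.Properties as ℚ
open import Data.Rational.Solver using (module +-*-Solver)
open import Data.Sum.Base using (inj₁; inj₂; [_,_]′)
open import Data.Vec.Base as Vec using (Vec; []; _∷_)
open import Data.Vec.Functional using (Vector)
open import Level using (0ℓ)
open import Relation.Binary.PropositionalEquality.Core using (_≡_; _≢_; refl; sym; trans; cong; cong₂; subst)
open import Relation.Nullary.Decidable.Core using (does)

private

  *-mono-≤ : ∀ {a b c d : ℚ} → 0ℚ ℚ.≤ a → a ℚ.≤ b → 0ℚ ℚ.≤ c → c ℚ.≤ d → a ℚ.* c ℚ.≤ b ℚ.* d
  *-mono-≤ {a} {b} {c} {d} 0≤a a≤b 0≤c c≤d = ℚ.≤-trans
    (ℚ.*-monoʳ-≤-nonNeg c {{ℚ.nonNegative 0≤c}} a≤b)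
    (ℚ.*-monoˡ-≤-nonNeg b {{ℚ.nonNegative (ℚ.≤-trans 0≤a a≤b)}} c≤d)

  0≤square : ∀ q → 0ℚ ℚ.≤ q ℚ.* q
  0≤square q with ℚ.≤-total 0ℚ q
  ... | inj₁ 0≤q = subst (ℚ._≤ q ℚ.* q) (ℚ.*-zeroʳ q) (ℚ.*-monoˡ-≤-nonNeg q {{ℚ.nonNegative 0≤q}} 0≤q)
  ... | inj₂ q≤0 = subst (ℚ._≤ q ℚ.* q) (ℚ.*-zeroʳ q) (ℚ.*-monoˡ-≤-nonPos q {{ℚ.nonPositive q≤0}} q≤0)

  half-pos : ∀ {ε} → 0ℚ ℚ.< ε → 0ℚ ℚ.< ½ ℚ.* ε
  half-pos {ε} 0<ε = ℚ.positive⁻¹ (½ ℚ.* ε) {{ℚ.pos*pos⇒pos ½ ε {{ℚ.positive 0<ε}}}}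

  half+half : ∀ ε → ½ ℚ.* ε ℚ.+ ½ ℚ.* ε ≡ ε
  half+half = solve 1 (λ e → con ½ :* e :+ con ½ :* e := e) refl
    where open +-*-Solver

  shrink : ∀ B ε → 0ℚ ℚ.< B → 0ℚ ℚ.< ε → Σ[ δ ∈ ℚ ] 0ℚ ℚ.< δ × B ℚ.* δ ≡ ε
  shrink B ε 0<B 0<ε = B⁻¹ ℚ.* ε , ℚ.positive⁻¹ _ {{ℚ.pos*pos⇒pos B⁻¹ {{ℚ.1/pos⇒pos B}} ε}} , eq
    where
    instance
      _ = ℚ.positive 0<B
      _ = ℚ.positive 0<ε
      _ = ℚ.pos⇒nonZero B
    B⁻¹ = ℚ.1/ B
    eq : B ℚ.* (B⁻¹ ℚ.* ε) ≡ ε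
    eq = trans (sym (ℚ.*-assoc B B⁻¹ ε)) (trans (cong (ℚ._* ε) (ℚ.*-inverseʳ B)) (ℚ.*-identityˡ ε))

  product-difference : ∀ a b c d →
    ℚ.∣ a ℚ.* b ℚ.- c ℚ.* d ∣ ℚ.≤ ℚ.∣ a ∣ ℚ.* ℚ.∣ b ℚ.- d ∣ ℚ.+ ℚ.∣ a ℚ.- c ∣ ℚ.* ℚ.∣ d ∣
  product-difference a b c d = begin
    ℚ.∣ a ℚ.* b ℚ.- c ℚ.* d ∣
      ≡⟨ cong ℚ.∣_∣ (solve 4 (λ a b c d → a :* b :- c :* d := a :* (b :- d) :+ (a :- c) :* d) refl a b c d) ⟩
    ℚ.∣ a ℚ.* (b ℚ.- d) ℚ.+ (a ℚ.- c) ℚ.* d ∣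
      ≤⟨ ℚ.∣p+q∣≤∣p∣+∣q∣ (a ℚ.* (b ℚ.- d)) ((a ℚ.- c) ℚ.* d) ⟩
    ℚ.∣ a ℚ.* (b ℚ.- d) ∣ ℚ.+ ℚ.∣ (a ℚ.- c) ℚ.* d ∣
      ≡⟨ cong (ℚ._+ _) (ℚ.∣p*q∣≡∣p∣*∣q∣ a (b ℚ.- d)) ⟩
    ℚ.∣ a ∣ ℚ.* ℚ.∣ b ℚ.- d ∣ ℚ.+ ℚ.∣ (a ℚ.- c) ℚ.* d ∣
      ≡⟨ cong (ℚ.∣ a ∣ ℚ.* ℚ.∣ b ℚ.- d ∣ ℚ.+_) (ℚ.∣p*q∣≡∣p∣*∣q∣ (a ℚ.- c) d) ⟩
    ℚ.∣ a ∣ ℚ.* ℚ.∣ b ℚ.- d ∣ ℚ.+ ℚ.∣ a ℚ.- c ∣ ℚ.* ℚ.∣ d ∣ ∎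
    where
    open +-*-Solver
    open ℚ.≤-Reasoning

Cauchy : (ℕ → ℚ) → Set
Cauchy u = ∀ ε → 0ℚ ℚ.< ε →
  Σ[ N ∈ ℕ ] (∀ m n → N ℕ.≤ m → N ℕ.≤ n → ℚ.∣ u m ℚ.- u n ∣ ℚ.≤ ε)

record ℝ : Set where
  constructor mkℝ
  field
    seq    : ℕ → ℚ
    cauchy : Cauchy seq

open ℝ public

infix 4 _≈_ _≤_

record _≈_ (x y : ℝ) : Set where
  constructor mk≈
  field
    eventually-close : ∀ ε → 0ℚ ℚ.< ε →
      Σ[ N ∈ ℕ ] (∀ n → N ℕ.≤ n → ℚ.∣ seq x n ℚ.- seq y n ∣ ℚ.≤ ε)

record _≤_ (x y : ℝ) : Set where
  constructor mk≤
  field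
    eventually-below : ∀ ε → 0ℚ ℚ.< ε →
      Σ[ N ∈ ℕ ] (∀ n → N ℕ.≤ n → seq x n ℚ.≤ seq y n ℚ.+ ε)

open _≈_ public
open _≤_ public

abstract
  private

    const-cauchy : ∀ q → Cauchy (λ _ → q)
    const-cauchy q ε 0<ε = 0 , λ _ _ _ _ → subst (λ z → ℚ.∣ z ∣ ℚ.≤ ε) (sym (ℚ.+-inverseʳ q)) (ℚ.<⇒≤ 0<ε)

    +-cauchy : ∀ {u v} → Cauchy u → Cauchy v → Cauchy (λ n → u n ℚ.+ v n)
    +-cauchy {u} {v} cu cv ε 0<ε = let M , p = cu _ (half-pos 0<ε) ; N , q = cv _ (half-pos 0<ε) in M ℕ.⊔ N , λ m n hm hn → begin
      ℚ.∣ (u m ℚ.+ v m) ℚ.- (u n ℚ.+ v n) ∣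
        ≡⟨ cong ℚ.∣_∣ (solve 4 (λ a b c d → (a :+ b) :- (c :+ d) := (a :- c) :+ (b :- d)) refl (u m) (v m) (u n) (v n)) ⟩
      ℚ.∣ (u m ℚ.- u n) ℚ.+ (v m ℚ.- v n) ∣
        ≤⟨ ℚ.∣p+q∣≤∣p∣+∣q∣ (u m ℚ.- u n) (v m ℚ.- v n) ⟩
      ℚ.∣ u m ℚ.- u n ∣ ℚ.+ ℚ.∣ v m ℚ.- v n ∣
        ≤⟨ ℚ.+-mono-≤ (p m n (ℕ.m⊔n≤o⇒m≤o M N hm) (ℕ.m⊔n≤o⇒m≤o M N hn))
                      (q m n (ℕ.m⊔n≤o⇒n≤o M N hm) (ℕ.m⊔n≤o⇒n≤o M N hn)) ⟩
      ½ ℚ.* ε ℚ.+ ½ ℚ.* ε ≡⟨ half+half ε ⟩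
      ε ∎
      where
      open +-*-Solver
      open ℚ.≤-Reasoning

    neg-cauchy : ∀ {u} → Cauchy u → Cauchy (λ n → ℚ.- u n)
    neg-cauchy {u} cu ε 0<ε = let N , p = cu ε 0<ε in N , λ m n hm hn → subst (ℚ._≤ ε) (eq m n) (p m n hm hn)
      where
      eq : ∀ m n → ℚ.∣ u m ℚ.- u n ∣ ≡ ℚ.∣ (ℚ.- u m) ℚ.- (ℚ.- u n) ∣
      eq m n = trans (sym (ℚ.∣-p∣≡∣p∣ (u m ℚ.- u n))) (cong ℚ.∣_∣ (ℚ.neg-distrib-+ (u m) (ℚ.- u n)))

    abs-difference : ∀ a b → ℚ.∣ ℚ.∣ a ∣ ℚ.- ℚ.∣ b ∣ ∣ ℚ.≤ ℚ.∣ a ℚ.- b ∣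
    abs-difference a b =
      [ (λ eq → subst (ℚ._≤ ℚ.∣ a ℚ.- b ∣) (sym eq) (one-sided a b))
      , (λ eq → subst (ℚ._≤ ℚ.∣ a ℚ.- b ∣) (sym eq) other-side)
      ]′ (ℚ.∣p∣≡p∨∣p∣≡-p (ℚ.∣ a ∣ ℚ.- ℚ.∣ b ∣))
      where
      open +-*-Solver
      open ℚ.≤-Reasoning
      one-sided : ∀ a b → ℚ.∣ a ∣ ℚ.- ℚ.∣ b ∣ ℚ.≤ ℚ.∣ a ℚ.- b ∣
      one-sided a b = begin
        ℚ.∣ a ∣ ℚ.- ℚ.∣ b ∣
          ≡⟨ cong (λ z → ℚ.∣ z ∣ ℚ.- ℚ.∣ b ∣) (solve 2 (λ x y → x := (x :- y) :+ y) refl a b) ⟩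
        ℚ.∣ (a ℚ.- b) ℚ.+ b ∣ ℚ.- ℚ.∣ b ∣
          ≤⟨ ℚ.+-monoˡ-≤ (ℚ.- ℚ.∣ b ∣) (ℚ.∣p+q∣≤∣p∣+∣q∣ (a ℚ.- b) b) ⟩
        (ℚ.∣ a ℚ.- b ∣ ℚ.+ ℚ.∣ b ∣) ℚ.- ℚ.∣ b ∣
          ≡⟨ solve 2 (λ x y → (x :+ y) :- y := x) refl ℚ.∣ a ℚ.- b ∣ ℚ.∣ b ∣ ⟩
        ℚ.∣ a ℚ.- b ∣ ∎
      other-side : ℚ.- (ℚ.∣ a ∣ ℚ.- ℚ.∣ b ∣) ℚ.≤ ℚ.∣ a ℚ.- b ∣
      other-side = begin
        ℚ.- (ℚ.∣ a ∣ ℚ.- ℚ.∣ b ∣)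
          ≡⟨ solve 2 (λ x y → :- (x :- y) := y :- x) refl ℚ.∣ a ∣ ℚ.∣ b ∣ ⟩
        ℚ.∣ b ∣ ℚ.- ℚ.∣ a ∣
          ≤⟨ one-sided b a ⟩
        ℚ.∣ b ℚ.- a ∣
          ≡⟨ ℚ.∣-p∣≡∣p∣ (b ℚ.- a) ⟨
        ℚ.∣ ℚ.- (b ℚ.- a) ∣
          ≡⟨ cong ℚ.∣_∣ (solve 2 (λ x y → :- (y :- x) := x :- y) refl a b) ⟩
        ℚ.∣ a ℚ.- b ∣ ∎

    abs-cauchy : ∀ {u} → Cauchy u → Cauchy (λ n → ℚ.∣ u n ∣)
    abs-cauchy {u} cu ε 0<ε = let N , p = cu ε 0<ε in N , λ m n hm hn → ℚ.≤-trans (abs-difference (u m) (u n)) (p m n hm hn)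

    bounded : ∀ {u} → Cauchy u →
      Σ[ B ∈ ℚ ] 0ℚ ℚ.< B × (Σ[ N ∈ ℕ ] (∀ n → N ℕ.≤ n → ℚ.∣ u n ∣ ℚ.≤ B))
    bounded {u} cu = let N , p = cu 1ℚ (ℚ.positive⁻¹ 1ℚ) in
                  1ℚ ℚ.+ ℚ.∣ u N ∣
                , ℚ.+-mono-<-≤ (ℚ.positive⁻¹ 1ℚ) (ℚ.0≤∣p∣ (u N))
                , N
                , λ n hn → begin
      ℚ.∣ u n ∣                          ≡⟨ cong ℚ.∣_∣ (solve 2 (λ x y → x := (x :- y) :+ y) refl (u n) (u N)) ⟩
      ℚ.∣ (u n ℚ.- u N) ℚ.+ u N ∣        ≤⟨ ℚ.∣p+q∣≤∣p∣+∣q∣ (u n ℚ.- u N) (u N) ⟩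
      ℚ.∣ u n ℚ.- u N ∣ ℚ.+ ℚ.∣ u N ∣    ≤⟨ ℚ.+-monoˡ-≤ ℚ.∣ u N ∣ (p n N hn ℕ.≤-refl) ⟩
      1ℚ ℚ.+ ℚ.∣ u N ∣                   ∎
      where
      open +-*-Solver
      open ℚ.≤-Reasoning

    *-cauchy : ∀ {u v} → Cauchy u → Cauchy v → Cauchy (λ n → u n ℚ.* v n)
    *-cauchy {u} {v} cu cv ε 0<ε =
      let A , 0<A , K , bu = bounded cu
          B , 0<B , L , bv = bounded cv
          α , 0<α , Aα = shrink A _ 0<A (half-pos 0<ε)
          β , 0<β , Bβ = shrink B _ 0<B (half-pos 0<ε)
          M , p = cv α 0<α
          N , q = cu β 0<β
      in (K ℕ.⊔ L) ℕ.⊔ (M ℕ.⊔ N) , λ m n hm hn →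
      let hm₁ = ℕ.m⊔n≤o⇒m≤o (K ℕ.⊔ L) (M ℕ.⊔ N) hm
          hm₂ = ℕ.m⊔n≤o⇒n≤o (K ℕ.⊔ L) (M ℕ.⊔ N) hm
          hn₁ = ℕ.m⊔n≤o⇒m≤o (K ℕ.⊔ L) (M ℕ.⊔ N) hn
          hn₂ = ℕ.m⊔n≤o⇒n≤o (K ℕ.⊔ L) (M ℕ.⊔ N) hn
      in begin
      ℚ.∣ u m ℚ.* v m ℚ.- u n ℚ.* v n ∣
        ≤⟨ product-difference (u m) (v m) (u n) (v n) ⟩
      ℚ.∣ u m ∣ ℚ.* ℚ.∣ v m ℚ.- v n ∣ ℚ.+ ℚ.∣ u m ℚ.- u n ∣ ℚ.* ℚ.∣ v n ∣
        ≤⟨ ℚ.+-mono-≤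
             (*-mono-≤ (ℚ.0≤∣p∣ (u m)) (bu m (ℕ.m⊔n≤o⇒m≤o K L hm₁))
                       (ℚ.0≤∣p∣ (v m ℚ.- v n)) (p m n (ℕ.m⊔n≤o⇒m≤o M N hm₂) (ℕ.m⊔n≤o⇒m≤o M N hn₂)))
             (*-mono-≤ (ℚ.0≤∣p∣ (u m ℚ.- u n)) (q m n (ℕ.m⊔n≤o⇒n≤o M N hm₂) (ℕ.m⊔n≤o⇒n≤o M N hn₂))
                       (ℚ.0≤∣p∣ (v n)) (bv n (ℕ.m⊔n≤o⇒n≤o K L hn₁))) ⟩
      A ℚ.* α ℚ.+ β ℚ.* B
        ≡⟨ cong (A ℚ.* α ℚ.+_) (ℚ.*-comm β B) ⟩
      A ℚ.* α ℚ.+ B ℚ.* β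
        ≡⟨ cong₂ ℚ._+_ Aα Bβ ⟩
      ½ ℚ.* ε ℚ.+ ½ ℚ.* ε
        ≡⟨ half+half ε ⟩
      ε ∎
      where open ℚ.≤-Reasoning

infixl 7 _*_
infixl 6 _+_ _-_
infix  8 -_

fromℚ : ℚ → ℝ
fromℚ q = mkℝ (λ _ → q) (const-cauchy q)

fromℕ′ : ℕ → ℝ
fromℕ′ n = fromℚ (+ n ℚ./ 1)

0ℝ 1ℝ : ℝ
0ℝ = fromℚ 0ℚ
1ℝ = fromℚ 1ℚ

_+_ _*_ : ℝ → ℝ → ℝ
x + y = mkℝ (λ n → seq x n ℚ.+ seq y n) (+-cauchy {seq x} {seq y} (cauchy x) (cauchy y))
x * y = mkℝ (λ n → seq x n ℚ.* seq y n) (*-cauchy {seq x} {seq y} (cauchy x) (cauchy y))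

-_ ∣_∣ : ℝ → ℝ
- x   = mkℝ (λ n → ℚ.- seq x n) (neg-cauchy {seq x} (cauchy x))
∣ x ∣ = mkℝ (λ n → ℚ.∣ seq x n ∣) (abs-cauchy {seq x} (cauchy x))

_-_ : ℝ → ℝ → ℝ
x - y = x + (- y)

ℝ-rawSemiring : RawSemiring 0ℓ 0ℓ
ℝ-rawSemiring = record { Carrier = ℝ ; _≈_ = _≈_ ; _+_ = _+_ ; _*_ = _*_ ; 0# = 0ℝ ; 1# = 1ℝ }

open Algebra.Definitions.RawSemiring ℝ-rawSemiring public using (_^_) renaming (sum to ∑; product to ∏)

Invertible : ℝ → Set
Invertible = Algebra.Definitions.Invertible _≈_ 1ℝ _*_

infixl 7 _/_[_]

_/_[_] : ℝ → (y : ℝ) → Invertible y → ℝ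
x / y [ y⁻¹ , _ ] = x * y⁻¹

_⟶_ : (ℕ → ℝ) → ℝ → Set
u ⟶ x = ∀ ε → 0ℚ ℚ.< ε → Σ[ N ∈ ℕ ] (∀ n → N ℕ.≤ n → ∣ u n - x ∣ ≤ fromℚ ε)

-- p (p + 2) ⋯ (p + 2 N) with p = suc q
stepProduct : ℕ → ℕ → ℕ
stepProduct q zero    = suc q
stepProduct q (suc N) = stepProduct q N ℕ.* (suc q ℕ.+ 2 ℕ.* suc N)

stepProduct≢0 : ∀ q N → ℕ.NonZero (stepProduct q N)
stepProduct≢0 q zero    = _
stepProduct≢0 q (suc N) = ℕ.m*n≢0 (stepProduct q N) (suc q ℕ.+ 2 ℕ.* suc N) {{stepProduct≢0 q N}}

-- The term N! Nˢ / (s (s + 1) ⋯ (s + N)) of Gauss's limit for Γ(s), where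
-- s = p / 2 with p = suc q, and N = M² so that Nˢ = Mᵖ is rational.
-- Numerator and denominator are multiplied by 2ᴺ⁺¹.
gaussTerm : ℕ → ℕ → ℚ
gaussTerm q M = (+ (2 ℕ.^ suc N ℕ.* N ! ℕ.* M ℕ.^ suc q) ℚ./ stepProduct q N) {{stepProduct≢0 q N}}
  where
  N : ℕ
  N = M ℕ.* M

-- Γ½ p is the value Γ(p / 2) for every p ≥ 1.
IsGammaAtHalves : (ℕ → ℝ) → Set
IsGammaAtHalves Γ½ = ∀ q → (λ M → fromℚ (gaussTerm q M)) ⟶ Γ½ (suc q)

Space : ℕ → Set
Space n = Vector ℝ n

Matrix : ℕ → Set
Matrix n = Fin n → Fin n → ℝ

e : ∀ {n} → Fin n → Space n
e i j = if does (i Fin.≟ j) then 1ℝ else 0ℝ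

r² : ∀ {n} → Space n → ℝ
r² x = ∑ (λ i → x i * x i)

infixr 7 _·_

_·_ : ∀ {n} → Matrix n → Space n → Space n
(A · x) i = ∑ (λ j → A i j * x j)

det : ∀ {n} → Matrix n → ℝ
det {zero}  A = 1ℝ
det {suc n} A = ∑ (λ j → (- 1ℝ) ^ toℕ j * A zero j * det (λ i k → A (suc i) (punchIn j k)))

Orthogonal : ∀ {n} → Matrix n → Set
Orthogonal A = ∀ i j → ∑ (λ k → A k i * A k j) ≈ e i j

SpecialOrthogonal : ∀ {n} → Matrix n → Set
SpecialOrthogonal A = Orthogonal A × det A ≈ 1ℝ

exponents : (n d : ℕ) → List (Vec ℕ n)
exponents zero    zero    = [] List.∷ List.[]
exponents zero    (suc _) = List.[]
exponents (suc n) d       =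
  List.concatMap (λ i → List.map (i ∷_) (exponents n (d ℕ.∸ i))) (List.upTo (suc d))

record Form (n d : ℕ) : Set where
  field
    coeff       : Vec ℕ n → ℝ
    homogeneous : ∀ α → Vec.sum α ≢ d → coeff α ≈ 0ℝ

open Form public

monomial : ∀ {n} → Vec ℕ n → Space n → ℝ
monomial α x = ∏ (λ i → x i ^ Vec.lookup α i)

⟦_⟧ : ∀ {n d} → Form n d → Space n → ℝ
⟦_⟧ {n} {d} f x = List.foldr (λ α s → coeff f α * monomial α x + s) 0ℝ (exponents n d)

-- The coefficient of xᵅ in ∑ᵢ ∂²f / ∂xᵢ².
laplacianCoeff : ∀ {n d} → Form n d → Vec ℕ n → ℝ
laplacianCoeff f α = ∑ (λ i →
  fromℕ′ ((Vec.lookup α i ℕ.+ 2) ℕ.* (Vec.lookup α i ℕ.+ 1)) * coeff f (Vec.updateAt α i (ℕ._+ 2)))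

Harmonic : ∀ {n d} → Form n d → Set
Harmonic f = ∀ α → laplacianCoeff f α ≈ 0ℝ

-- dim H_{n,d} = (2d + n - 2) (d + n - 3)! / (d! (n - 2)!) for n ≥ 2.  At
-- n = 2, d = 0 the formula reads 0 · (-1)! and the dimension is 1.
dimH : ℕ → ℕ → ℚ
dimH 2 0 = 1ℚ
dimH n d =
  (+ ((2 ℕ.* d ℕ.+ n ℕ.∸ 2) ℕ.* (d ℕ.+ n ℕ.∸ 3) !) ℚ./ (d ! ℕ.* (n ℕ.∸ 2) !)) {{d ℕ.!* n ℕ.∸ 2 !≢0}}

-- In the plane the only rotation fixing e₂ is the identity, which does not
-- single out an element of H_{2,d}; there the reflection x₁ ↦ -x₁ is admitted
-- too, so that L_{2,d}(sin θ, cos θ) = cos dθ.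
FixesPole : ∀ {m} → Matrix (suc m) → Set
FixesPole {m} A =
  Orthogonal A × (3 ℕ.≤ suc m → det A ≈ 1ℝ) × (∀ i → (A · e (fromℕ m)) i ≈ e (fromℕ m) i)

record IsZonalHarmonic {m d : ℕ} (L : Form (suc m) d) : Set where
  field
    harmonic   : Harmonic L
    invariant  : ∀ A → FixesPole A → ∀ x → ⟦ L ⟧ (A · x) ≈ ⟦ L ⟧ x
    normalised : ⟦ L ⟧ (e (fromℕ m)) ≈ 1ℝ

Sphere : ℕ → Set
Sphere n = Σ[ x ∈ Space n ] r² x ≈ 1ℝ

UniformlyContinuous : ∀ {n} → (Sphere n → ℝ) → Set
UniformlyContinuous f = ∀ ε → 0ℚ ℚ.< ε → Σ[ δ ∈ ℚ ] 0ℚ ℚ.< δ ×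
  (∀ x y → (∀ i → ∣ proj₁ x i - proj₁ y i ∣ ≤ fromℚ δ) → ∣ f x - f y ∣ ≤ fromℚ ε)

record C (n : ℕ) : Set where
  constructor mkC
  field
    fun        : Sphere n → ℝ
    continuous : UniformlyContinuous fun

open C public

-- As usual in constructive analysis, a measure on a compact space is given by
-- its integral, a positive linear functional on the continuous functions.
-- Sums, multiples and pullbacks of functions are described by their values.
record RotationInvariantProbability (n : ℕ) : Set where
  field
    ∫           : C n → ℝ
    additive    : ∀ f g h → (∀ x → fun h x ≈ fun f x + fun g x) → ∫ h ≈ ∫ f + ∫ g
    scalable    : ∀ c f h → (∀ x → fun h x ≈ c * fun f x) → ∫ h ≈ c * ∫ f
    positive    : ∀ f → (∀ x → 0ℝ ≤ fun f x) → 0ℝ ≤ ∫ f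
    total       : ∀ f → (∀ x → fun f x ≈ 1ℝ) → ∫ f ≈ 1ℝ
    invariant   : ∀ A → SpecialOrthogonal A → ∀ f g →
                  (∀ x y → (∀ i → proj₁ y i ≈ (A · proj₁ x) i) → fun g x ≈ fun f y) → ∫ g ≈ ∫ f

open RotationInvariantProbability public using (∫)

private

  Bound : ℚ
  Bound = + 3 ℚ./ 1

  0≤Bound : 0ℚ ℚ.≤ Bound
  0≤Bound = ℚ.nonNegative⁻¹ Bound

  ∣q∣≤1+q² : ∀ q → ℚ.∣ q ∣ ℚ.≤ 1ℚ ℚ.+ q ℚ.* q
  ∣q∣≤1+q² q with ℚ.≤-total ℚ.∣ q ∣ 1ℚ
  ... | inj₁ le = begin
    ℚ.∣ q ∣         ≤⟨ le ⟩
    1ℚ              ≡⟨ ℚ.+-identityʳ 1ℚ ⟨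
    1ℚ ℚ.+ 0ℚ       ≤⟨ ℚ.+-monoʳ-≤ 1ℚ (0≤square q) ⟩
    1ℚ ℚ.+ q ℚ.* q  ∎
    where open ℚ.≤-Reasoning
  ... | inj₂ ge = begin
    ℚ.∣ q ∣                ≡⟨ ℚ.*-identityˡ ℚ.∣ q ∣ ⟨
    1ℚ ℚ.* ℚ.∣ q ∣         ≤⟨ ℚ.*-monoʳ-≤-nonNeg ℚ.∣ q ∣ {{ℚ.∣-∣-nonNeg q}} ge ⟩
    ℚ.∣ q ∣ ℚ.* ℚ.∣ q ∣    ≡⟨ ℚ.∣p*q∣≡∣p∣*∣q∣ q q ⟨
    ℚ.∣ q ℚ.* q ∣          ≡⟨ ℚ.0≤p⇒∣p∣≡p (0≤square q) ⟩
    q ℚ.* q                ≡⟨ ℚ.+-identityˡ (q ℚ.* q) ⟨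
    0ℚ ℚ.+ q ℚ.* q         ≤⟨ ℚ.+-monoˡ-≤ (q ℚ.* q) (ℚ.nonNegative⁻¹ 1ℚ) ⟩
    1ℚ ℚ.+ q ℚ.* q         ∎
    where open ℚ.≤-Reasoning

  0≤r² : ∀ {n} (x : Space n) k → 0ℚ ℚ.≤ seq (r² x) k
  0≤r² {zero}  x k = ℚ.≤-refl
  0≤r² {suc n} x k = ℚ.+-mono-≤ (0≤square (seq (x zero) k)) (0≤r² (λ i → x (suc i)) k)

  square≤r² : ∀ {n} (x : Space n) i k → seq (x i) k ℚ.* seq (x i) k ℚ.≤ seq (r² x) k
  square≤r² x zero k = subst (ℚ._≤ seq (r² x) k) (ℚ.+-identityʳ _)
    (ℚ.+-monoʳ-≤ (seq (x zero) k ℚ.* seq (x zero) k) (0≤r² (λ i → x (suc i)) k))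
  square≤r² x (suc i) k = subst (ℚ._≤ seq (r² x) k) (ℚ.+-identityˡ _)
    (ℚ.+-mono-≤ (0≤square (seq (x zero) k)) (square≤r² (λ i → x (suc i)) i k))

  coordinate-bounded : ∀ {n} (x : Sphere n) i →
    Σ[ N ∈ ℕ ] (∀ k → N ℕ.≤ k → ℚ.∣ seq (proj₁ x i) k ∣ ℚ.≤ Bound)
  coordinate-bounded (x , r²≈1) i = let N , p = eventually-close r²≈1 1ℚ (ℚ.positive⁻¹ 1ℚ) in N , λ k hk → begin
    ℚ.∣ seq (x i) k ∣                                  ≤⟨ ∣q∣≤1+q² (seq (x i) k) ⟩
    1ℚ ℚ.+ seq (x i) k ℚ.* seq (x i) k                 ≤⟨ ℚ.+-monoʳ-≤ 1ℚ (square≤r² x i k) ⟩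
    1ℚ ℚ.+ seq (r² x) k                                ≡⟨ cong (1ℚ ℚ.+_) (ℚ.0≤p⇒∣p∣≡p (0≤r² x k)) ⟨
    1ℚ ℚ.+ ℚ.∣ seq (r² x) k ∣
      ≡⟨ cong (λ z → 1ℚ ℚ.+ ℚ.∣ z ∣) (solve 1 (λ z → z := (z :- con 1ℚ) :+ con 1ℚ) refl (seq (r² x) k)) ⟩
    1ℚ ℚ.+ ℚ.∣ (seq (r² x) k ℚ.- 1ℚ) ℚ.+ 1ℚ ∣
      ≤⟨ ℚ.+-monoʳ-≤ 1ℚ (ℚ.∣p+q∣≤∣p∣+∣q∣ (seq (r² x) k ℚ.- 1ℚ) 1ℚ) ⟩
    1ℚ ℚ.+ (ℚ.∣ seq (r² x) k ℚ.- 1ℚ ∣ ℚ.+ 1ℚ)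
      ≤⟨ ℚ.+-monoʳ-≤ 1ℚ (ℚ.+-monoˡ-≤ 1ℚ (p k hk)) ⟩
    Bound ∎
    where
    open +-*-Solver
    open ℚ.≤-Reasoning

  power-bounded : ∀ j → Σ[ P ∈ ℚ ] 0ℚ ℚ.< P ×
    (∀ x k → ℚ.∣ seq x k ∣ ℚ.≤ Bound → ℚ.∣ seq (x ^ j) k ∣ ℚ.≤ P)
  power-bounded zero = 1ℚ , ℚ.positive⁻¹ 1ℚ , λ _ _ _ → ℚ.≤-refl
  power-bounded (suc j) = let P , 0<P , p = power-bounded j in
    Bound ℚ.* P , ℚ.positive⁻¹ _ {{ℚ.pos*pos⇒pos Bound P {{ℚ.positive 0<P}}}} , λ x k h →
    subst (ℚ._≤ Bound ℚ.* P) (sym (ℚ.∣p*q∣≡∣p∣*∣q∣ (seq x k) (seq (x ^ j) k)))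
      (*-mono-≤ (ℚ.0≤∣p∣ (seq x k)) h (ℚ.0≤∣p∣ (seq (x ^ j) k)) (p x k h))

  power-lipschitz : ∀ j → Σ[ K ∈ ℚ ] 0ℚ ℚ.< K ×
    (∀ x y k → ℚ.∣ seq x k ∣ ℚ.≤ Bound → ℚ.∣ seq y k ∣ ℚ.≤ Bound →
     ℚ.∣ seq (x ^ j) k ℚ.- seq (y ^ j) k ∣ ℚ.≤ K ℚ.* ℚ.∣ seq x k ℚ.- seq y k ∣)
  power-lipschitz zero = 1ℚ , ℚ.positive⁻¹ 1ℚ , λ x y k _ _ →
    subst (0ℚ ℚ.≤_) (sym (ℚ.*-identityˡ _)) (ℚ.0≤∣p∣ (seq x k ℚ.- seq y k))
  power-lipschitz (suc j) = let K , 0<K , lip = power-lipschitz j ; P , 0<P , bd = power-bounded j in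
    Bound ℚ.* K ℚ.+ P
    , ℚ.positive⁻¹ _ {{ℚ.pos+pos⇒pos (Bound ℚ.* K) {{ℚ.pos*pos⇒pos Bound K {{ℚ.positive 0<K}}}} P {{ℚ.positive 0<P}}}}
    , λ x y k hx hy → let D = ℚ.∣ seq x k ℚ.- seq y k ∣ in begin
      ℚ.∣ seq x k ℚ.* seq (x ^ j) k ℚ.- seq y k ℚ.* seq (y ^ j) k ∣
        ≤⟨ product-difference (seq x k) (seq (x ^ j) k) (seq y k) (seq (y ^ j) k) ⟩
      ℚ.∣ seq x k ∣ ℚ.* ℚ.∣ seq (x ^ j) k ℚ.- seq (y ^ j) k ∣ ℚ.+ D ℚ.* ℚ.∣ seq (y ^ j) k ∣
        ≤⟨ ℚ.+-mono-≤
             (*-mono-≤ (ℚ.0≤∣p∣ (seq x k)) hx (ℚ.0≤∣p∣ (seq (x ^ j) k ℚ.- seq (y ^ j) k)) (lip x y k hx hy))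
             (*-mono-≤ (ℚ.0≤∣p∣ (seq x k ℚ.- seq y k)) ℚ.≤-refl (ℚ.0≤∣p∣ (seq (y ^ j) k)) (bd y k hy)) ⟩
      Bound ℚ.* (K ℚ.* D) ℚ.+ D ℚ.* P
        ≡⟨ solve 4 (λ b a d p → b :* (a :* d) :+ d :* p := (b :* a :+ p) :* d) refl Bound K D P ⟩
      (Bound ℚ.* K ℚ.+ P) ℚ.* D ∎
    where
    open +-*-Solver
    open ℚ.≤-Reasoning

  coordinatePower-continuous : ∀ {n} (i : Fin n) j → UniformlyContinuous (λ x → proj₁ x i ^ j)
  coordinatePower-continuous i j ε 0<ε =
    let K , 0<K , lip = power-lipschitz j
        δ , 0<δ , Kδ = shrink K _ 0<K (half-pos 0<ε)
    in δ , 0<δ , λ x y h → mk≤ λ η 0<η →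
    let L , bx = coordinate-bounded x i
        M , by = coordinate-bounded y i
        N , near = eventually-below (h i) δ 0<δ
    in L ℕ.⊔ (M ℕ.⊔ N) , λ k hk →
      let hMN = ℕ.m⊔n≤o⇒n≤o L (M ℕ.⊔ N) hk in begin
      ℚ.∣ seq (proj₁ x i ^ j) k ℚ.- seq (proj₁ y i ^ j) k ∣
        ≤⟨ lip (proj₁ x i) (proj₁ y i) k (bx k (ℕ.m⊔n≤o⇒m≤o L (M ℕ.⊔ N) hk)) (by k (ℕ.m⊔n≤o⇒m≤o M N hMN)) ⟩
      K ℚ.* ℚ.∣ seq (proj₁ x i) k ℚ.- seq (proj₁ y i) k ∣
        ≤⟨ ℚ.*-monoˡ-≤-nonNeg K {{ℚ.pos⇒nonNeg K {{ℚ.positive 0<K}}}} (near k (ℕ.m⊔n≤o⇒n≤o M N hMN)) ⟩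
      K ℚ.* (δ ℚ.+ δ)        ≡⟨ ℚ.*-distribˡ-+ K δ δ ⟩
      K ℚ.* δ ℚ.+ K ℚ.* δ    ≡⟨ cong (λ z → z ℚ.+ z) Kδ ⟩
      ½ ℚ.* ε ℚ.+ ½ ℚ.* ε    ≡⟨ half+half ε ⟩
      ε                      ≡⟨ ℚ.+-identityʳ ε ⟨
      ε ℚ.+ 0ℚ               ≤⟨ ℚ.+-monoʳ-≤ ε (ℚ.<⇒≤ 0<η) ⟩
      ε ℚ.+ η                ∎
    where open ℚ.≤-Reasoning

coordinatePower : ∀ {n} → Fin n → ℕ → C n
coordinatePower i j = mkC (λ x → proj₁ x i ^ j) (coordinatePower-continuous i j)

{-# OPTIONS --safe #-}

-- Let u be the last coordinate, v the sum of the squares of the others and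
-- w = u² + v = r².  Comparing the coefficients of t in the invariance under the
-- rational rotations ((1 - t²) / (1 + t²) , 2 t / (1 + t²)) of a coordinate plane
-- replaces invariance by infinitesimal invariance.
--
-- For a zonal harmonic this makes the coefficient of each power of u a
-- rotation-invariant form in the other variables.  On such forms v Δ acts by a
-- scalar, so harmonicity determines them one after the other:
-- L_{n,d} = Z_d(u , v) with an explicit polynomial Z_d.  For the measure it gives
-- (2k + 1) ∫ u²ᵏ x_i² = ∫ u²ᵏ⁺², hence (n + 2k) ∫ u²ᵏ⁺² = (2k + 1) ∫ u²ᵏ.
--
-- With μ_e = (e + n - 2 choose e) one has N(n,e) = μ_e + μ_{e-1}, and the
-- three-term recurrence of the Z_e reads
-- u N(n,e) Z_e = μ_e Z_{e+1} + μ_{e-1} w Z_{e-1}.  By induction on d,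
-- uᵈ = ∑_{e + 2j = d} d! / (2ʲ j! n (n + 2) ⋯ (n + 2(e + j) - 2)) wʲ N(n,e) Z_e.
-- The even case, divided by ∫ u²ᵏ, is the theorem, because
-- 2 Γ(p/2 + 1) = p Γ(p/2) by Gauss's limit.
module Submission where

open import Algebra.Bundles using (CommutativeRing; Semiring)
import Algebra.Definitions.RawSemiring
import Algebra.Properties.CommutativeSemiring.Exp
import Algebra.Properties.Ring
import Algebra.Properties.Semiring.Exp
import Algebra.Properties.Semiring.Sum
import Algebra.Solver.Ring
open import Algebra.Solver.Ring.AlmostCommutativeRing using (_-Raw-AlmostCommutative⟶_; fromCommutativeRing)
open import Algebra.Structures using (IsCommutativeRing)
open import Data.Bool.Base using (if_then_else_)
open import Data.Empty using (⊥; ⊥-elim)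
open import Data.Fin.Base as Fin using (Fin; zero; suc; toℕ; fromℕ; inject₁)
import Data.Fin.Properties as Fin
open import Data.Integer.Base as ℤ using (+_)
import Data.Integer.Properties as ℤ
open import Data.List.Base as List using (List; []; _∷_)
open import Data.List.Relation.Unary.All using (All; []; _∷_)
open import Data.Maybe.Base using (Maybe; just; nothing)
open import Data.Nat.Base as ℕ using (ℕ; zero; suc; _!)
import Data.Nat.Properties as ℕ
import Data.Nat.Solver
open import Data.Product.Base using (Σ-syntax; _,_; proj₁; proj₂; _×_)
open import Data.Rational.Base as ℚ using (ℚ; 0ℚ; 1ℚ; ½; toℚᵘ)
import Data.Rational.Properties as ℚ
import Data.Rational.Solver
import Data.Rational.Unnormalised.Base as ℚᵘ
import Data.Rational.Unnormalised.Properties as ℚᵘ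
open import Data.Sum.Base using (_⊎_; inj₁; inj₂)
open import Data.Unit.Base using (⊤; tt)
open import Data.Vec.Base as Vec using (Vec; []; _∷_)
open import Function.Base using (_∘_; id)
open import Level using (0ℓ)
open import Relation.Binary.PropositionalEquality as ≡ using (_≡_; _≢_)
import Relation.Binary.Reasoning.Setoid
open import Relation.Nullary using (Dec; yes; no; does)

module ℕS = Data.Nat.Solver.+-*-Solver

toℚᵘ-/ : ∀ a b → toℚᵘ (a ℚ./ suc b) ℚᵘ.≃ ℚᵘ.mkℚᵘ a b
toℚᵘ-/ a b = ℚ.toℚᵘ-fromℚᵘ (ℚᵘ.mkℚᵘ a b)

/1-+ : ∀ m n → + (m ℕ.+ n) ℚ./ 1 ≡ + m ℚ./ 1 ℚ.+ + n ℚ./ 1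
/1-+ m n = ℚ.toℚᵘ-injective (ℚᵘ.≃-trans (toℚᵘ-/ (+ (m ℕ.+ n)) 0)
  (ℚᵘ.≃-trans (ℚᵘ.*≡* (≡.cong (ℤ._* + 1) eq))
  (ℚᵘ.≃-sym (ℚᵘ.≃-trans (ℚ.toℚᵘ-homo-+ (+ m ℚ./ 1) (+ n ℚ./ 1))
    (ℚᵘ.+-cong (toℚᵘ-/ (+ m) 0) (toℚᵘ-/ (+ n) 0))))))
  where
  eq : + (m ℕ.+ n) ≡ + m ℤ.* + 1 ℤ.+ + n ℤ.* + 1
  eq = ≡.sym (≡.cong₂ ℤ._+_ (ℤ.*-identityʳ (+ m)) (ℤ.*-identityʳ (+ n)))

/1-* : ∀ m n → + (m ℕ.* n) ℚ./ 1 ≡ (+ m ℚ./ 1) ℚ.* (+ n ℚ./ 1)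
/1-* m n = ℚ.toℚᵘ-injective (ℚᵘ.≃-trans (toℚᵘ-/ (+ (m ℕ.* n)) 0)
  (ℚᵘ.≃-trans (ℚᵘ.*≡* (≡.cong (ℤ._* + 1) (ℤ.pos-* m n)))
  (ℚᵘ.≃-sym (ℚᵘ.≃-trans (ℚ.toℚᵘ-homo-* (+ m ℚ./ 1) (+ n ℚ./ 1))
    (ℚᵘ.*-cong (toℚᵘ-/ (+ m) 0) (toℚᵘ-/ (+ n) 0))))))

/-*-cancel : ∀ a b .{{_ : ℕ.NonZero b}} → (+ a ℚ./ b) ℚ.* (+ b ℚ./ 1) ≡ + a ℚ./ 1
/-*-cancel a (suc b) = ℚ.toℚᵘ-injective (ℚᵘ.≃-trans
  (ℚᵘ.≃-trans (ℚ.toℚᵘ-homo-* (+ a ℚ./ suc b) (+ suc b ℚ./ 1))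
    (ℚᵘ.*-cong (toℚᵘ-/ (+ a) b) (toℚᵘ-/ (+ suc b) 0)))
  (ℚᵘ.≃-trans (ℚᵘ.*≡* eq) (ℚᵘ.≃-sym (toℚᵘ-/ (+ a) 0))))
  where
  eq : (+ a ℤ.* + suc b) ℤ.* + 1 ≡ + a ℤ.* + (suc b ℕ.* 1)
  eq = ≡.trans (ℤ.*-identityʳ _) (≡.cong (λ z → + a ℤ.* + z) (≡.sym (ℕ.*-identityʳ (suc b))))

module ℚAlgebra (R : CommutativeRing 0ℓ 0ℓ)
                (ι : ℚ.+-*-rawRing -Raw-AlmostCommutative⟶ fromCommutativeRing R) where

  open CommutativeRing R hiding (zero)
  open Relation.Binary.Reasoning.Setoid setoid
  open _-Raw-AlmostCommutative⟶_ ι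

  coefficient≟ : ∀ p q → Maybe (⟦ p ⟧ ≈ ⟦ q ⟧)
  coefficient≟ p q with p ℚ.≟ q
  ... | yes p≡q = just (reflexive (≡.cong ⟦_⟧ p≡q))
  ... | no  _   = nothing

  module Solver = Algebra.Solver.Ring ℚ.+-*-rawRing (fromCommutativeRing R) ι coefficient≟
  open Solver using (solve; _:=_; _:+_; _:*_; _:-_; :-_; con; Polynomial)

  [_] : ℕ → Carrier
  [ n ] = ⟦ + n ℚ./ 1 ⟧

  num : ∀ {k} → ℕ → Polynomial k
  num n = con (+ n ℚ./ 1)

  ⅟ : (n : ℕ) .{{_ : ℕ.NonZero n}} → Carrier
  ⅟ n = ⟦ + 1 ℚ./ n ⟧

  []-+ : ∀ m n → [ m ℕ.+ n ] ≈ [ m ] + [ n ]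
  []-+ m n = trans (reflexive (≡.cong ⟦_⟧ (/1-+ m n))) (+-homo _ _)

  []-* : ∀ m n → [ m ℕ.* n ] ≈ [ m ] * [ n ]
  []-* m n = trans (reflexive (≡.cong ⟦_⟧ (/1-* m n))) (*-homo _ _)

  []-cong : ∀ {m n} → m ≡ n → [ m ] ≈ [ n ]
  []-cong m≡n = reflexive (≡.cong [_] m≡n)

  ⅟-inverse : ∀ n .{{_ : ℕ.NonZero n}} → ⅟ n * [ n ] ≈ 1#
  ⅟-inverse n = trans (sym (*-homo _ _)) (trans (reflexive (≡.cong ⟦_⟧ (/-*-cancel 1 n))) 1-homo)

  []-cancel : ∀ n .{{_ : ℕ.NonZero n}} {x y} → [ n ] * x ≈ [ n ] * y → x ≈ y
  []-cancel n {x} {y} eq = begin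
    x  ≈⟨ lemma x ⟩
    ⅟ n * ([ n ] * x)  ≈⟨ *-congˡ eq ⟩
    ⅟ n * ([ n ] * y)  ≈⟨ lemma y ⟨
    y  ∎
    where
    lemma : ∀ z → z ≈ ⅟ n * ([ n ] * z)
    lemma z = trans (sym (*-identityˡ z)) (trans (*-congʳ (sym (⅟-inverse n))) (*-assoc _ _ _))

  -- parts d F is the sum of F i j over the pairs with i + 2 j = d.
  parts : ℕ → (ℕ → ℕ → Carrier) → Carrier
  parts zero          F = F 0 0
  parts (suc zero)    F = F 1 0
  parts (suc (suc d)) F = F (2 ℕ.+ d) 0 + parts d (λ i j → F i (suc j))

  +-2*-suc : ∀ i j → i ℕ.+ 2 ℕ.* suc j ≡ 2 ℕ.+ (i ℕ.+ 2 ℕ.* j)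
  +-2*-suc = ℕS.solve 2 (λ i j → i ℕS.:+ ℕS.con 2 ℕS.:* (ℕS.con 1 ℕS.:+ j) ℕS.:= ℕS.con 2 ℕS.:+ (i ℕS.:+ ℕS.con 2 ℕS.:* j)) ≡.refl

  parts-cong : ∀ d {F G} → (∀ i j → i ℕ.+ 2 ℕ.* j ≡ d → F i j ≈ G i j) → parts d F ≈ parts d G
  parts-cong zero          F≈G = F≈G 0 0 ≡.refl
  parts-cong (suc zero)    F≈G = F≈G 1 0 ≡.refl
  parts-cong (suc (suc d)) F≈G = +-cong (F≈G (2 ℕ.+ d) 0 (ℕ.+-identityʳ _))
    (parts-cong d λ i j eq → F≈G i (suc j) (≡.trans (+-2*-suc i j) (≡.cong (2 ℕ.+_) eq)))

  parts-+ : ∀ d F G → parts d (λ i j → F i j + G i j) ≈ parts d F + parts d G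
  parts-+ zero          F G = refl
  parts-+ (suc zero)    F G = refl
  parts-+ (suc (suc d)) F G = trans (+-congˡ (parts-+ d _ _))
    (solve 4 (λ a b c d → a :+ b :+ (c :+ d) := a :+ c :+ (b :+ d)) refl _ _ _ _)

  parts-* : ∀ d c F → c * parts d F ≈ parts d (λ i j → c * F i j)
  parts-* zero          c F = refl
  parts-* (suc zero)    c F = refl
  parts-* (suc (suc d)) c F = trans (distribˡ c _ _) (+-congˡ (parts-* d c _))

  parts-raise : ∀ d F → (∀ j → 2 ℕ.* j ≡ suc d → F 0 j ≈ 0#) → parts d (λ i j → F (suc i) j) ≈ parts (suc d) F
  parts-raise zero          F F₀ = refl
  parts-raise (suc zero)    F F₀ = sym (trans (+-congˡ (F₀ 1 ≡.refl)) (+-identityʳ _))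
  parts-raise (suc (suc d)) F F₀ = +-congˡ (parts-raise d (λ i j → F i (suc j))
    λ j eq → F₀ (suc j) (≡.trans (+-2*-suc 0 j) (≡.cong (2 ℕ.+_) eq)))

  parts-lower : ∀ d F G → (∀ i → F i 0 ≈ 0#) → (∀ j → G 0 j ≈ 0#) → (∀ i j → G (suc i) j ≈ F i (suc j)) →
    parts d G ≈ parts (suc d) F
  parts-lower zero    F G F₀ G₀ eq = trans (G₀ 0) (sym (F₀ 1))
  parts-lower (suc d) F G F₀ G₀ eq = begin
    parts (suc d) G  ≈⟨ parts-raise d G (λ j _ → G₀ j) ⟨
    parts d (λ i j → G (suc i) j)  ≈⟨ parts-cong d (λ i j _ → eq i j) ⟩
    parts d (λ i j → F i (suc j))  ≈⟨ +-identityˡ _ ⟨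
    0# + parts d (λ i j → F i (suc j))  ≈⟨ +-congʳ (F₀ (2 ℕ.+ d)) ⟨
    F (2 ℕ.+ d) 0 + parts d (λ i j → F i (suc j)) ∎

  falling : ℕ → ℕ → ℕ
  falling d       zero    = 1
  falling zero    (suc j) = 0
  falling (suc d) (suc j) = suc d ℕ.* falling d j

  falling-vanishes : ∀ {d j} → d ℕ.< j → falling d j ≡ 0
  falling-vanishes {zero}  {suc j} _           = ≡.refl
  falling-vanishes {suc d} {suc j} (ℕ.s≤s d<j) = ≡.trans (≡.cong (suc d ℕ.*_) (falling-vanishes d<j)) (ℕ.*-zeroʳ (suc d))

  []-falling-suc : ∀ d j → [ falling d (suc j) ] ≈ ([ d ] - [ j ]) * [ falling d j ]
  []-falling-suc zero zero = trans 0-homo (sym (trans (*-congʳ (-‿inverseʳ _)) (zeroˡ _)))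
  []-falling-suc zero (suc j) = trans 0-homo (sym (trans (*-congˡ 0-homo) (zeroʳ _)))
  []-falling-suc (suc d) zero = begin
    [ suc d ℕ.* 1 ]  ≈⟨ []-* (suc d) 1 ⟩
    [ suc d ] * [ 1 ]  ≈⟨ solve 1 (λ d → d :* num 1 := (d :- num 0) :* num 1) refl [ suc d ] ⟩
    ([ suc d ] - [ 0 ]) * [ 1 ]  ∎
  []-falling-suc (suc d) (suc j) = begin
    [ suc d ℕ.* falling d (suc j) ]  ≈⟨ []-* (suc d) (falling d (suc j)) ⟩
    [ suc d ] * [ falling d (suc j) ]  ≈⟨ *-congˡ ([]-falling-suc d j) ⟩
    [ suc d ] * (([ d ] - [ j ]) * [ falling d j ])
      ≈⟨ solve 4 (λ s d j x → s :* ((d :- j) :* x) := ((num 1 :+ d) :- (num 1 :+ j)) :* (s :* x)) refl _ _ _ _ ⟩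
    (([ 1 ] + [ d ]) - ([ 1 ] + [ j ])) * ([ suc d ] * [ falling d j ])
      ≈⟨ *-cong (+-cong ([]-+ 1 d) (-‿cong ([]-+ 1 j))) ([]-* (suc d) (falling d j)) ⟨
    ([ suc d ] - [ suc j ]) * [ suc d ℕ.* falling d j ]  ∎

-- The expansion of powers in zonal polynomials

module ZonalExpansion (R : CommutativeRing 0ℓ 0ℓ)
                      (ι : ℚ.+-*-rawRing -Raw-AlmostCommutative⟶ fromCommutativeRing R) (m : ℕ) where

  open CommutativeRing R hiding (zero)
  open Algebra.Properties.Semiring.Exp semiring using (_^_)
  open Relation.Binary.Reasoning.Setoid setoid
  open _-Raw-AlmostCommutative⟶_ ι using (0-homo; 1-homo)
  open ℚAlgebra R ι
  open Solver using (solve; _:=_; _:+_; _:*_; _:-_; :-_)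

  weight : ℕ → Carrier
  weight zero    = 1#
  weight (suc s) = - (weight s * ⅟ (suc (suc (2 ℕ.* s)) ℕ.* suc (2 ℕ.* s ℕ.+ m)))

  -- Coefficient of uᵈ⁻²ˢ vˢ in the zonal harmonic of degree d, where u is the
  -- last coordinate and v the sum of the squares of the others.
  zonal : ℕ → ℕ → Carrier
  zonal d s = weight s * [ falling d (2 ℕ.* s) ]

  weight-suc : ∀ s → ([ 2 ] * [ s ] + [ 2 ]) * ([ 2 ] * [ s ] + [ m ] + [ 1 ]) * weight (suc s) ≈ - weight s
  weight-suc s = begin
    ([ 2 ] * [ s ] + [ 2 ]) * ([ 2 ] * [ s ] + [ m ] + [ 1 ]) * - (weight s * ⅟ N)
      ≈⟨ *-congʳ cast ⟨
    [ N ] * - (weight s * ⅟ N)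
      ≈⟨ solve 3 (λ n w i → n :* (:- (w :* i)) := :- (i :* n :* w)) refl [ N ] (weight s) (⅟ N) ⟩
    - (⅟ N * [ N ] * weight s)
      ≈⟨ -‿cong (trans (*-congʳ (⅟-inverse N)) (*-identityˡ _)) ⟩
    - weight s ∎
    where
    N = suc (suc (2 ℕ.* s)) ℕ.* suc (2 ℕ.* s ℕ.+ m)
    cast : [ N ] ≈ ([ 2 ] * [ s ] + [ 2 ]) * ([ 2 ] * [ s ] + [ m ] + [ 1 ])
    cast = begin
      [ N ]  ≈⟨ []-* (suc (suc (2 ℕ.* s))) (suc (2 ℕ.* s ℕ.+ m)) ⟩
      [ 2 ℕ.+ 2 ℕ.* s ] * [ 1 ℕ.+ (2 ℕ.* s ℕ.+ m) ]
        ≈⟨ *-cong ([]-+ 2 (2 ℕ.* s)) (trans ([]-+ 1 (2 ℕ.* s ℕ.+ m)) (+-congˡ ([]-+ (2 ℕ.* s) m))) ⟩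
      ([ 2 ] + [ 2 ℕ.* s ]) * ([ 1 ] + ([ 2 ℕ.* s ] + [ m ]))
        ≈⟨ *-cong (+-congˡ ([]-* 2 s)) (+-congˡ (+-congʳ ([]-* 2 s))) ⟩
      ([ 2 ] + [ 2 ] * [ s ]) * ([ 1 ] + ([ 2 ] * [ s ] + [ m ]))
        ≈⟨ *-cong (+-comm _ _) (+-comm _ _) ⟩
      ([ 2 ] * [ s ] + [ 2 ]) * ([ 2 ] * [ s ] + [ m ] + [ 1 ]) ∎

  []-falling-2+ : ∀ d j → [ falling d (2 ℕ.+ j) ] ≈ ([ d ] - [ j ] - [ 1 ]) * (([ d ] - [ j ]) * [ falling d j ])
  []-falling-2+ d j = begin
    [ falling d (2 ℕ.+ j) ]  ≈⟨ []-falling-suc d (suc j) ⟩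
    ([ d ] - [ suc j ]) * [ falling d (suc j) ]  ≈⟨ *-cong (+-congˡ (-‿cong ([]-+ 1 j))) ([]-falling-suc d j) ⟩
    ([ d ] - ([ 1 ] + [ j ])) * (([ d ] - [ j ]) * [ falling d j ])
      ≈⟨ *-congʳ (solve 2 (λ d j → d :- (num 1 :+ j) := d :- j :- num 1) refl [ d ] [ j ]) ⟩
    ([ d ] - [ j ] - [ 1 ]) * (([ d ] - [ j ]) * [ falling d j ]) ∎

  2*suc : ∀ s → 2 ℕ.* suc s ≡ 2 ℕ.+ 2 ℕ.* s
  2*suc = +-2*-suc 0

  zonal-suc : ∀ d s → ([ 2 ] * [ s ] + [ 2 ]) * ([ 2 ] * [ s ] + [ m ] + [ 1 ]) * zonal d (suc s)
    ≈ - (([ d ] - [ 2 ℕ.* s ]) * ([ d ] - [ 2 ℕ.* s ] - [ 1 ]) * zonal d s)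
  zonal-suc d s = begin
    D * (weight (suc s) * [ falling d (2 ℕ.* suc s) ])
      ≈⟨ *-congˡ (*-congˡ (trans ([]-cong (≡.cong (falling d) (2*suc s))) ([]-falling-2+ d (2 ℕ.* s)))) ⟩
    D * (weight (suc s) * ((a - [ 1 ]) * (a * [ falling d (2 ℕ.* s) ])))
      ≈⟨ solve 4 (λ D w a f → D :* (w :* ((a :- num 1) :* (a :* f))) := D :* w :* (a :* (a :- num 1) :* f)) refl
           D (weight (suc s)) a [ falling d (2 ℕ.* s) ] ⟩
    D * weight (suc s) * (a * (a - [ 1 ]) * [ falling d (2 ℕ.* s) ])
      ≈⟨ *-congʳ (weight-suc s) ⟩
    - weight s * (a * (a - [ 1 ]) * [ falling d (2 ℕ.* s) ])
      ≈⟨ solve 3 (λ w a f → (:- w) :* (a :* (a :- num 1) :* f) := :- (a :* (a :- num 1) :* (w :* f))) refl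
           (weight s) a [ falling d (2 ℕ.* s) ] ⟩
    - (a * (a - [ 1 ]) * (weight s * [ falling d (2 ℕ.* s) ])) ∎
    where
    D = ([ 2 ] * [ s ] + [ 2 ]) * ([ 2 ] * [ s ] + [ m ] + [ 1 ])
    a = [ d ] - [ 2 ℕ.* s ]

  zonal-vanishes : ∀ {d s} → d ℕ.< 2 ℕ.* s → zonal d s ≈ 0#
  zonal-vanishes {d} {s} d<2s = trans (*-congˡ (trans ([]-cong (falling-vanishes d<2s)) 0-homo)) (zeroʳ _)

  lowered : ℕ → ℕ → Carrier
  lowered d zero    = 0#
  lowered d (suc s) = zonal d s

  zonal-recurrence : ∀ e s →
    ([ suc e ] + [ m ]) * zonal (2 ℕ.+ e) s + [ suc e ] * (zonal e s + lowered e s) ≈ ([ 2 ] * [ suc e ] + [ m ]) * zonal (suc e) s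
  zonal-recurrence e zero = trans (+-congˡ (*-congˡ (+-identityʳ _)))
    (solve 3 (λ e m z → (e :+ m) :* z :+ e :* z := (num 2 :* e :+ m) :* z) refl [ suc e ] [ m ] (1# * [ 1 ]))
  zonal-recurrence e (suc s) = begin
    ([ suc e ] + [ m ]) * zonal (2 ℕ.+ e) (suc s) + [ suc e ] * (zonal e (suc s) + zonal e s)
      ≈⟨ +-cong (*-cong (+-congʳ ([]-+ 1 e)) top) (*-cong ([]-+ 1 e) (+-cong middle bottom)) ⟩
    ([ 1 ] + [ e ] + [ m ]) * (W * (([ 2 ] + [ e ]) * (([ 1 ] + [ e ]) * X)))
      + ([ 1 ] + [ e ]) * (W * ((a - [ 1 ]) * (a * X)) + - (D * W) * X)
      ≈⟨ solve 5 (λ e s m w x →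
           (num 1 :+ e :+ m) :* (w :* ((num 2 :+ e) :* ((num 1 :+ e) :* x)))
             :+ (num 1 :+ e) :* (w :* ((e :- num 2 :* s :- num 1) :* ((e :- num 2 :* s) :* x))
                :+ (:- ((num 2 :* s :+ num 2) :* (num 2 :* s :+ m :+ num 1) :* w)) :* x)
           := (num 2 :* (num 1 :+ e) :+ m) :* (w :* ((num 1 :+ e) :* ((e :- num 2 :* s) :* x))))
           refl [ e ] [ s ] [ m ] W X ⟩
    ([ 2 ] * ([ 1 ] + [ e ]) + [ m ]) * (W * (([ 1 ] + [ e ]) * (a * X)))
      ≈⟨ *-cong (+-congʳ (*-congˡ ([]-+ 1 e))) one ⟨
    ([ 2 ] * [ suc e ] + [ m ]) * zonal (suc e) (suc s) ∎
    where
    D = ([ 2 ] * [ s ] + [ 2 ]) * ([ 2 ] * [ s ] + [ m ] + [ 1 ])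
    W = weight (suc s)
    X = [ falling e (2 ℕ.* s) ]
    a = [ e ] - [ 2 ] * [ s ]
    a≈ : [ e ] - [ 2 ℕ.* s ] ≈ a
    a≈ = +-congˡ (-‿cong ([]-* 2 s))
    index : ∀ d → [ falling d (2 ℕ.* suc s) ] ≈ [ falling d (2 ℕ.+ 2 ℕ.* s) ]
    index d = []-cong (≡.cong (falling d) (2*suc s))
    top : zonal (2 ℕ.+ e) (suc s) ≈ W * (([ 2 ] + [ e ]) * (([ 1 ] + [ e ]) * X))
    top = *-congˡ (trans (index (2 ℕ.+ e)) (trans ([]-* (2 ℕ.+ e) (suc e ℕ.* falling e (2 ℕ.* s)))
      (*-cong ([]-+ 2 e) (trans ([]-* (suc e) (falling e (2 ℕ.* s))) (*-congʳ ([]-+ 1 e))))))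
    one : zonal (suc e) (suc s) ≈ W * (([ 1 ] + [ e ]) * (a * X))
    one = *-congˡ (trans (index (suc e)) (trans ([]-* (suc e) (falling e (suc (2 ℕ.* s))))
      (*-cong ([]-+ 1 e) (trans ([]-falling-suc e (2 ℕ.* s)) (*-congʳ a≈)))))
    middle : zonal e (suc s) ≈ W * ((a - [ 1 ]) * (a * X))
    middle = *-congˡ (trans (index e) (trans ([]-falling-2+ e (2 ℕ.* s)) (*-cong (+-congʳ a≈) (*-congʳ a≈))))
    bottom : zonal e s ≈ - (D * W) * X
    bottom = *-congʳ (trans (solve 1 (λ w → w := :- (:- w)) refl (weight s)) (-‿cong (sym (weight-suc s))))

  module _ (u v : Carrier) where

    Z : ℕ → Carrier
    Z d = parts d (λ k s → zonal d s * (u ^ k * v ^ s))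

    u*parts : ∀ d (c : ℕ → Carrier) → (∀ s → 2 ℕ.* s ≡ suc d → c s ≈ 0#) →
      u * parts d (λ k s → c s * (u ^ k * v ^ s)) ≈ parts (suc d) (λ k s → c s * (u ^ k * v ^ s))
    u*parts d c c₀ = begin
      u * parts d (λ k s → c s * (u ^ k * v ^ s))  ≈⟨ parts-* d u _ ⟩
      parts d (λ k s → u * (c s * (u ^ k * v ^ s)))
        ≈⟨ parts-cong d (λ k s _ → solve 4 (λ u c x y → u :* (c :* (x :* y)) := c :* (u :* x :* y)) refl u (c s) (u ^ k) (v ^ s)) ⟩
      parts d (λ k s → c s * (u ^ suc k * v ^ s))
        ≈⟨ parts-raise d (λ k s → c s * (u ^ k * v ^ s)) (λ s eq → trans (*-congʳ (c₀ s eq)) (zeroˡ _)) ⟩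
      parts (suc d) (λ k s → c s * (u ^ k * v ^ s))  ∎

    v*Z : ∀ d → v * Z d ≈ parts (2 ℕ.+ d) (λ k s → lowered d s * (u ^ k * v ^ s))
    v*Z d = begin
      v * Z d  ≈⟨ parts-* d v _ ⟩
      parts d (λ k s → v * (zonal d s * (u ^ k * v ^ s)))
        ≈⟨ parts-cong d (λ k s _ → solve 4 (λ v c x y → v :* (c :* (x :* y)) := c :* (x :* (v :* y))) refl v (zonal d s) (u ^ k) (v ^ s)) ⟩
      parts d (λ k s → zonal d s * (u ^ k * v ^ suc s))  ≈⟨ +-identityˡ _ ⟨
      0# + parts d (λ k s → zonal d s * (u ^ k * v ^ suc s))  ≈⟨ +-congʳ (zeroˡ _) ⟨
      parts (2 ℕ.+ d) (λ k s → lowered d s * (u ^ k * v ^ s))  ∎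

    three-term : ∀ e →
      ([ suc e ] + [ m ]) * Z (2 ℕ.+ e) + [ suc e ] * ((u * u + v) * Z e) ≈ ([ 2 ] * [ suc e ] + [ m ]) * (u * Z (suc e))
    three-term e = begin
      p * Z (2 ℕ.+ e) + q * ((u * u + v) * Z e)
        ≈⟨ +-congˡ (*-congˡ (solve 3 (λ u v z → (u :* u :+ v) :* z := u :* (u :* z) :+ v :* z) refl u v (Z e))) ⟩
      p * Z (2 ℕ.+ e) + q * (u * (u * Z e) + v * Z e)
        ≈⟨ +-congˡ (*-congˡ (+-cong (trans (*-congˡ (u*parts e (zonal e) (λ s eq → zonal-vanishes {e} {s} (ℕ.≤-reflexive (≡.sym eq)))))
                                           (u*parts (suc e) (zonal e) (λ s eq → zonal-vanishes {e} {s} (ℕ.≤-trans (ℕ.n≤1+n _) (ℕ.≤-reflexive (≡.sym eq))))))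
                                    (v*Z e))) ⟩
      p * Z (2 ℕ.+ e) + q * (parts (2 ℕ.+ e) (F (zonal e)) + parts (2 ℕ.+ e) (F (lowered e)))
        ≈⟨ +-cong (parts-* (2 ℕ.+ e) p (F (zonal (2 ℕ.+ e))))
             (trans (*-congˡ (sym (parts-+ (2 ℕ.+ e) (F (zonal e)) (F (lowered e))))) (parts-* (2 ℕ.+ e) q (λ k s → F (zonal e) k s + F (lowered e) k s))) ⟩
      parts (2 ℕ.+ e) (λ k s → p * F (zonal (2 ℕ.+ e)) k s) + parts (2 ℕ.+ e) (λ k s → q * (F (zonal e) k s + F (lowered e) k s))
        ≈⟨ parts-+ (2 ℕ.+ e) (λ k s → p * F (zonal (2 ℕ.+ e)) k s) (λ k s → q * (F (zonal e) k s + F (lowered e) k s)) ⟨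
      parts (2 ℕ.+ e) (λ k s → p * F (zonal (2 ℕ.+ e)) k s + q * (F (zonal e) k s + F (lowered e) k s))
        ≈⟨ parts-cong (2 ℕ.+ e) (λ k s _ → trans
             (solve 6 (λ p q a b c x → p :* (a :* x) :+ q :* (b :* x :+ c :* x) := (p :* a :+ q :* (b :+ c)) :* x) refl
                p q (zonal (2 ℕ.+ e) s) (zonal e s) (lowered e s) (u ^ k * v ^ s))
             (trans (*-congʳ (zonal-recurrence e s)) (*-assoc _ _ _))) ⟩
      parts (2 ℕ.+ e) (λ k s → r * F (zonal (suc e)) k s)
        ≈⟨ parts-* (2 ℕ.+ e) r (F (zonal (suc e))) ⟨
      r * parts (2 ℕ.+ e) (F (zonal (suc e)))
        ≈⟨ *-congˡ (u*parts (suc e) (zonal (suc e)) (λ s eq → zonal-vanishes {suc e} {s} (ℕ.≤-reflexive (≡.sym eq)))) ⟨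
      r * (u * Z (suc e)) ∎
      where
      p = [ suc e ] + [ m ]
      q = [ suc e ]
      r = [ 2 ] * [ suc e ] + [ m ]
      F : (ℕ → Carrier) → ℕ → ℕ → Carrier
      F c k s = c s * (u ^ k * v ^ s)

  μ : ℕ → Carrier
  μ zero    = 1#
  μ (suc e) = ⅟ (suc e) * ([ suc e ℕ.+ m ] * μ e)

  dim : ℕ → Carrier
  dim zero    = μ 0
  dim (suc e) = μ (suc e) + μ e

  μ-suc : ∀ e → [ suc e ] * μ (suc e) ≈ ([ suc e ] + [ m ]) * μ e
  μ-suc e = begin
    [ suc e ] * (⅟ (suc e) * ([ suc e ℕ.+ m ] * μ e))
      ≈⟨ solve 3 (λ a i x → a :* (i :* x) := i :* a :* x) refl [ suc e ] (⅟ (suc e)) ([ suc e ℕ.+ m ] * μ e) ⟩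
    ⅟ (suc e) * [ suc e ] * ([ suc e ℕ.+ m ] * μ e)  ≈⟨ *-congʳ (⅟-inverse (suc e)) ⟩
    1# * ([ suc e ℕ.+ m ] * μ e)  ≈⟨ *-identityˡ _ ⟩
    [ suc e ℕ.+ m ] * μ e  ≈⟨ *-congʳ ([]-+ (suc e) m) ⟩
    ([ suc e ] + [ m ]) * μ e  ∎

  dim-suc : ∀ e → [ suc e ] * dim (suc e) ≈ ([ 2 ] * [ suc e ] + [ m ]) * μ e
  dim-suc e = begin
    [ suc e ] * (μ (suc e) + μ e)  ≈⟨ distribˡ _ _ _ ⟩
    [ suc e ] * μ (suc e) + [ suc e ] * μ e  ≈⟨ +-congʳ (μ-suc e) ⟩
    ([ suc e ] + [ m ]) * μ e + [ suc e ] * μ e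
      ≈⟨ solve 3 (λ e m x → (e :+ m) :* x :+ e :* x := (num 2 :* e :+ m) :* x) refl [ suc e ] [ m ] (μ e) ⟩
    ([ 2 ] * [ suc e ] + [ m ]) * μ e  ∎

  -- χ j = 1 / (2ʲ j!) and π i = 1 / (n (n + 2) ⋯ (n + 2 i - 2)), where n = 2 + m.
  χ π : ℕ → Carrier
  χ zero    = 1#
  χ (suc j) = ⅟ (2 ℕ.* suc j) * χ j
  π zero    = 1#
  π (suc i) = ⅟ (2 ℕ.+ m ℕ.+ 2 ℕ.* i) * π i

  unfold-⅟ : ∀ n .{{_ : ℕ.NonZero n}} x → [ n ] * (⅟ n * x) ≈ x
  unfold-⅟ n x = trans (solve 3 (λ a i x → a :* (i :* x) := i :* a :* x) refl [ n ] (⅟ n) x)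
    (trans (*-congʳ (⅟-inverse n)) (*-identityˡ x))

  χ-suc : ∀ j → [ 2 ] * [ suc j ] * χ (suc j) ≈ χ j
  χ-suc j = trans (*-congʳ (sym ([]-* 2 (suc j)))) (unfold-⅟ (2 ℕ.* suc j) (χ j))

  π-suc : ∀ i → ([ 2 ] + [ m ] + [ 2 ] * [ i ]) * π (suc i) ≈ π i
  π-suc i = trans (*-congʳ (sym (trans ([]-+ (2 ℕ.+ m) (2 ℕ.* i)) (+-cong ([]-+ 2 m) ([]-* 2 i)))))
    (unfold-⅟ (2 ℕ.+ m ℕ.+ 2 ℕ.* i) (π i))

  β : ℕ → ℕ → Carrier
  β e j = [ (e ℕ.+ 2 ℕ.* j) ! ] * (χ j * π (e ℕ.+ j))

  []-! : ∀ d → [ suc d ! ] ≈ [ suc d ] * [ d ! ]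
  []-! d = []-* (suc d) (d !)

  β-zero : ∀ j → β 1 j ≈ β 0 (suc j)
  β-zero j = begin
    [ (1 ℕ.+ 2 ℕ.* j) ! ] * (χ j * π (suc j))
      ≈⟨ *-congˡ (*-congʳ (χ-suc j)) ⟨
    [ (1 ℕ.+ 2 ℕ.* j) ! ] * ([ 2 ] * [ suc j ] * χ (suc j) * π (suc j))
      ≈⟨ solve 4 (λ f a x p → f :* (a :* x :* p) := a :* f :* (x :* p)) refl [ (1 ℕ.+ 2 ℕ.* j) ! ] ([ 2 ] * [ suc j ]) (χ (suc j)) (π (suc j)) ⟩
    [ 2 ] * [ suc j ] * [ (1 ℕ.+ 2 ℕ.* j) ! ] * (χ (suc j) * π (suc j))
      ≈⟨ *-congʳ (*-congʳ (trans (sym ([]-* 2 (suc j))) ([]-cong (2*suc j)))) ⟩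
    [ 2 ℕ.+ 2 ℕ.* j ] * [ (1 ℕ.+ 2 ℕ.* j) ! ] * (χ (suc j) * π (suc j))
      ≈⟨ *-congʳ ([]-! (1 ℕ.+ 2 ℕ.* j)) ⟨
    [ (2 ℕ.+ 2 ℕ.* j) ! ] * (χ (suc j) * π (suc j))
      ≈⟨ *-congʳ ([]-cong (≡.cong _! (2*suc j))) ⟨
    [ (2 ℕ.* suc j) ! ] * (χ (suc j) * π (suc j)) ∎

  β-pole : ∀ e → β e 0 * μ e ≈ β (suc e) 0 * dim (suc e)
  β-pole e = begin
    [ (e ℕ.+ 0) ! ] * (1# * π (e ℕ.+ 0)) * μ e
      ≈⟨ *-congʳ (*-cong ([]-cong (≡.cong _! (ℕ.+-identityʳ e))) (*-congˡ (reflexive (≡.cong π (ℕ.+-identityʳ e))))) ⟩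
    [ e ! ] * (1# * π e) * μ e
      ≈⟨ *-congʳ (*-congˡ (*-congˡ (π-suc e))) ⟨
    [ e ! ] * (1# * (([ 2 ] + [ m ] + [ 2 ] * [ e ]) * π (suc e))) * μ e
      ≈⟨ solve 6 (λ f o m e p x → f :* (o :* ((num 2 :+ m :+ num 2 :* e) :* p)) :* x
                   := f :* (o :* p) :* ((num 2 :* (num 1 :+ e) :+ m) :* x)) refl [ e ! ] 1# [ m ] [ e ] (π (suc e)) (μ e) ⟩
    [ e ! ] * (1# * π (suc e)) * (([ 2 ] * ([ 1 ] + [ e ]) + [ m ]) * μ e)
      ≈⟨ *-congˡ (trans (*-congʳ (+-congʳ (*-congˡ (sym ([]-+ 1 e))))) (sym (dim-suc e))) ⟩
    [ e ! ] * (1# * π (suc e)) * ([ suc e ] * dim (suc e))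
      ≈⟨ solve 4 (λ f q a x → f :* q :* (a :* x) := a :* f :* q :* x) refl [ e ! ] (1# * π (suc e)) [ suc e ] (dim (suc e)) ⟩
    [ suc e ] * [ e ! ] * (1# * π (suc e)) * dim (suc e)
      ≈⟨ *-congʳ (*-congʳ ([]-! e)) ⟨
    [ suc e ! ] * (1# * π (suc e)) * dim (suc e)
      ≈⟨ *-congʳ (*-cong ([]-cong (≡.cong (λ z → suc z !) (ℕ.+-identityʳ e))) (*-congˡ (reflexive (≡.cong (λ z → π (suc z)) (ℕ.+-identityʳ e))))) ⟨
    [ (suc e ℕ.+ 0) ! ] * (1# * π (suc e ℕ.+ 0)) * dim (suc e) ∎

  β-step : ∀ e j → β e (suc j) * μ e + β (2 ℕ.+ e) j * μ (suc e) ≈ β (suc e) (suc j) * dim (suc e)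
  β-step e j = []-cancel (suc e) (begin
    [ suc e ] * (β e (suc j) * μ e + β (2 ℕ.+ e) j * μ (suc e))
      ≈⟨ *-congˡ (+-cong (*-congʳ left) (*-congʳ right)) ⟩
    [ suc e ] * (F * (X * ((([ 2 ] + [ m ] + [ 2 ] * ([ suc e ] + [ j ])) * P))) * μ e
                 + F * ([ 2 ] * ([ 1 ] + [ j ]) * X * P) * μ (suc e))
      ≈⟨ solve 8 (λ e m j f x p y z →
             e :* (f :* (x :* (((num 2 :+ m :+ num 2 :* (e :+ j)) :* p))) :* y :+ f :* (num 2 :* (num 1 :+ j) :* x :* p) :* z)
             := f :* (x :* p) :* (e :* (num 2 :+ m :+ num 2 :* (e :+ j)) :* y :+ num 2 :* (num 1 :+ j) :* (e :* z)))
           refl [ suc e ] [ m ] [ j ] F X P (μ e) (μ (suc e)) ⟩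
    F * (X * P) * ([ suc e ] * ([ 2 ] + [ m ] + [ 2 ] * ([ suc e ] + [ j ])) * μ e + [ 2 ] * ([ 1 ] + [ j ]) * ([ suc e ] * μ (suc e)))
      ≈⟨ *-congˡ (+-congˡ (*-congˡ (μ-suc e))) ⟩
    F * (X * P) * ([ suc e ] * ([ 2 ] + [ m ] + [ 2 ] * ([ suc e ] + [ j ])) * μ e + [ 2 ] * ([ 1 ] + [ j ]) * (([ suc e ] + [ m ]) * μ e))
      ≈⟨ solve 7 (λ e m j f x p y →
             f :* (x :* p) :* (e :* (num 2 :+ m :+ num 2 :* (e :+ j)) :* y :+ num 2 :* (num 1 :+ j) :* ((e :+ m) :* y))
             := (e :+ num 2 :+ num 2 :* j) :* f :* (x :* p) :* ((num 2 :* e :+ m) :* y))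
           refl [ suc e ] [ m ] [ j ] F X P (μ e) ⟩
    ([ suc e ] + [ 2 ] + [ 2 ] * [ j ]) * F * (X * P) * (([ 2 ] * [ suc e ] + [ m ]) * μ e)
      ≈⟨ *-cong (*-congʳ top) (sym (dim-suc e)) ⟩
    [ (suc e ℕ.+ 2 ℕ.* suc j) ! ] * (X * P) * ([ suc e ] * dim (suc e))
      ≈⟨ solve 3 (λ b a d → b :* (a :* d) := a :* (b :* d)) refl _ _ _ ⟩
    [ suc e ] * (β (suc e) (suc j) * dim (suc e)) ∎)
    where
    N = e ℕ.+ 2 ℕ.* suc j
    F = [ N ! ]
    X = χ (suc j)
    P = π (suc e ℕ.+ suc j)
    index : suc e ℕ.+ suc j ≡ suc (suc e ℕ.+ j)
    index = ℕ.+-suc (suc e) j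
    P′ : ([ 2 ] + [ m ] + [ 2 ] * ([ suc e ] + [ j ])) * P ≈ π (suc e ℕ.+ j)
    P′ = trans (*-cong (+-congˡ (*-congˡ (sym ([]-+ (suc e) j)))) (reflexive (≡.cong π index))) (π-suc (suc e ℕ.+ j))
    left : β e (suc j) ≈ F * (X * (([ 2 ] + [ m ] + [ 2 ] * ([ suc e ] + [ j ])) * P))
    left = *-congˡ (*-congˡ (trans (reflexive (≡.cong π (ℕ.+-suc e j))) (sym P′)))
    right : β (2 ℕ.+ e) j ≈ F * ([ 2 ] * ([ 1 ] + [ j ]) * X * P)
    right = *-cong ([]-cong (≡.cong _! (≡.sym (+-2*-suc e j))))
      (*-cong (trans (sym (χ-suc j)) (*-congʳ (*-congˡ ([]-+ 1 j)))) (reflexive (≡.cong π (≡.sym index))))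
    top : ([ suc e ] + [ 2 ] + [ 2 ] * [ j ]) * F ≈ [ (suc e ℕ.+ 2 ℕ.* suc j) ! ]
    top = begin
      ([ suc e ] + [ 2 ] + [ 2 ] * [ j ]) * F
        ≈⟨ *-congʳ (solve 2 (λ e j → e :+ num 2 :+ num 2 :* j := num 2 :+ (e :+ num 2 :* j)) refl [ suc e ] [ j ]) ⟩
      ([ 2 ] + ([ suc e ] + [ 2 ] * [ j ])) * F
        ≈⟨ *-congʳ (trans ([]-+ 2 (suc e ℕ.+ 2 ℕ.* j)) (+-congˡ (trans ([]-+ (suc e) (2 ℕ.* j)) (+-congˡ ([]-* 2 j))))) ⟨
      [ 2 ℕ.+ (suc e ℕ.+ 2 ℕ.* j) ] * F
        ≈⟨ *-congʳ ([]-cong (+-2*-suc (suc e) j)) ⟨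
      [ suc N ] * F
        ≈⟨ []-! N ⟨
      [ suc N ! ] ∎

  module _ (u v : Carrier) where

    private
      w : Carrier
      w = u * u + v

      Zᵤᵥ : ℕ → Carrier
      Zᵤᵥ = Z u v

    lower : ℕ → Carrier
    lower zero    = 0#
    lower (suc e) = μ e * (w * Zᵤᵥ e)

    Z₁ : Zᵤᵥ 1 ≈ u * Zᵤᵥ 0
    Z₁ = solve 3 (λ u o p → o :* p :* (u :* o :* o) := u :* (o :* p :* (o :* o))) refl u 1# [ 1 ]

    u*dim*Z : ∀ e → u * (dim e * Zᵤᵥ e) ≈ μ e * Zᵤᵥ (suc e) + lower e
    u*dim*Z zero = begin
      u * (1# * Zᵤᵥ 0)  ≈⟨ *-congˡ (*-identityˡ _) ⟩
      u * Zᵤᵥ 0  ≈⟨ Z₁ ⟨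
      Zᵤᵥ 1  ≈⟨ *-identityˡ _ ⟨
      1# * Zᵤᵥ 1  ≈⟨ +-identityʳ _ ⟨
      1# * Zᵤᵥ 1 + 0#  ∎
    u*dim*Z (suc e) = []-cancel (suc e) (begin
      [ suc e ] * (u * (dim (suc e) * Zᵤᵥ (suc e)))
        ≈⟨ solve 4 (λ a u d z → a :* (u :* (d :* z)) := a :* d :* (u :* z)) refl [ suc e ] u (dim (suc e)) (Zᵤᵥ (suc e)) ⟩
      [ suc e ] * dim (suc e) * (u * Zᵤᵥ (suc e))
        ≈⟨ *-congʳ (dim-suc e) ⟩
      ([ 2 ] * [ suc e ] + [ m ]) * μ e * (u * Zᵤᵥ (suc e))
        ≈⟨ solve 3 (λ a x z → a :* x :* z := x :* (a :* z)) refl ([ 2 ] * [ suc e ] + [ m ]) (μ e) (u * Zᵤᵥ (suc e)) ⟩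
      μ e * (([ 2 ] * [ suc e ] + [ m ]) * (u * Zᵤᵥ (suc e)))
        ≈⟨ *-congˡ (three-term u v e) ⟨
      μ e * (([ suc e ] + [ m ]) * Zᵤᵥ (2 ℕ.+ e) + [ suc e ] * (w * Zᵤᵥ e))
        ≈⟨ solve 5 (λ x a y b z → x :* (a :* y :+ b :* z) := a :* x :* y :+ b :* (x :* z)) refl
             (μ e) ([ suc e ] + [ m ]) (Zᵤᵥ (2 ℕ.+ e)) [ suc e ] (w * Zᵤᵥ e) ⟩
      ([ suc e ] + [ m ]) * μ e * Zᵤᵥ (2 ℕ.+ e) + [ suc e ] * (μ e * (w * Zᵤᵥ e))
        ≈⟨ +-congʳ (*-congʳ (μ-suc e)) ⟨
      [ suc e ] * μ (suc e) * Zᵤᵥ (2 ℕ.+ e) + [ suc e ] * (μ e * (w * Zᵤᵥ e))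
        ≈⟨ solve 4 (λ a x y z → a :* x :* y :+ a :* z := a :* (x :* y :+ z)) refl
             [ suc e ] (μ (suc e)) (Zᵤᵥ (2 ℕ.+ e)) (μ e * (w * Zᵤᵥ e)) ⟩
      [ suc e ] * (μ (suc e) * Zᵤᵥ (2 ℕ.+ e) + μ e * (w * Zᵤᵥ e)) ∎)

    term raised : ℕ → ℕ → Carrier
    term e j = β e j * (w ^ j * (dim e * Zᵤᵥ e))
    raised zero    j = 0#
    raised (suc e) j = β e j * (w ^ j * (μ e * Zᵤᵥ (suc e)))

    sunk : ℕ → ℕ → Carrier
    sunk e zero    = 0#
    sunk e (suc j) = β (suc e) j * (w ^ j * (μ e * (w * Zᵤᵥ e)))

    raised+sunk : ∀ d e j → e ℕ.+ 2 ℕ.* j ≡ suc d → raised e j + sunk e j ≈ term e j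
    raised+sunk d zero    (suc j) _ = begin
      0# + β 1 j * (w ^ j * (1# * (w * Zᵤᵥ 0)))
        ≈⟨ +-identityˡ _ ⟩
      β 1 j * (w ^ j * (1# * (w * Zᵤᵥ 0)))
        ≈⟨ *-cong (β-zero j) (solve 4 (λ x o w z → x :* (o :* (w :* z)) := w :* x :* (o :* z)) refl (w ^ j) 1# w (Zᵤᵥ 0)) ⟩
      β 0 (suc j) * (w * w ^ j * (1# * Zᵤᵥ 0)) ∎
    raised+sunk d (suc e) zero _ = begin
      β e 0 * (1# * (μ e * Zᵤᵥ (suc e))) + 0#
        ≈⟨ +-identityʳ _ ⟩
      β e 0 * (1# * (μ e * Zᵤᵥ (suc e)))
        ≈⟨ solve 4 (λ b o x z → b :* (o :* (x :* z)) := b :* x :* (o :* z)) refl (β e 0) 1# (μ e) (Zᵤᵥ (suc e)) ⟩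
      β e 0 * μ e * (1# * Zᵤᵥ (suc e))
        ≈⟨ *-congʳ (β-pole e) ⟩
      β (suc e) 0 * dim (suc e) * (1# * Zᵤᵥ (suc e))
        ≈⟨ solve 4 (λ b o x z → b :* x :* (o :* z) := b :* (o :* (x :* z))) refl (β (suc e) 0) 1# (dim (suc e)) (Zᵤᵥ (suc e)) ⟩
      β (suc e) 0 * (1# * (dim (suc e) * Zᵤᵥ (suc e))) ∎
    raised+sunk d (suc e) (suc j) _ = begin
      β e (suc j) * (w * w ^ j * (μ e * Zᵤᵥ (suc e))) + β (2 ℕ.+ e) j * (w ^ j * (μ (suc e) * (w * Zᵤᵥ (suc e))))
        ≈⟨ solve 7 (λ a b w x y z t → a :* (w :* x :* (y :* z)) :+ b :* (x :* (t :* (w :* z)))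
                     := (a :* y :+ b :* t) :* (w :* x :* z)) refl
             (β e (suc j)) (β (2 ℕ.+ e) j) w (w ^ j) (μ e) (Zᵤᵥ (suc e)) (μ (suc e)) ⟩
      (β e (suc j) * μ e + β (2 ℕ.+ e) j * μ (suc e)) * (w * w ^ j * Zᵤᵥ (suc e))
        ≈⟨ *-congʳ (β-step e j) ⟩
      β (suc e) (suc j) * dim (suc e) * (w * w ^ j * Zᵤᵥ (suc e))
        ≈⟨ solve 4 (λ b x y z → b :* x :* (y :* z) := b :* (y :* (x :* z))) refl
             (β (suc e) (suc j)) (dim (suc e)) (w * w ^ j) (Zᵤᵥ (suc e)) ⟩
      β (suc e) (suc j) * (w * w ^ j * (dim (suc e) * Zᵤᵥ (suc e))) ∎

    power-expansion : ∀ d → u ^ d ≈ parts d term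
    power-expansion zero = sym (trans
      (solve 2 (λ o p → p :* (o :* o) :* (o :* (o :* (o :* p :* (o :* o)))) := p :* p :* (o :* o :* o :* o :* o :* o :* o)) refl 1# [ 1 ])
      (trans (*-cong (*-cong 1-homo 1-homo) ones) (trans (*-identityʳ _) (*-identityˡ _))))
      where
      ones : 1# * 1# * 1# * 1# * 1# * 1# * 1# ≈ 1#
      ones = trans (*-identityʳ _) (trans (*-identityʳ _) (trans (*-identityʳ _) (trans (*-identityʳ _) (trans (*-identityʳ _) (*-identityʳ _)))))
    power-expansion (suc d) = begin
      u * u ^ d  ≈⟨ *-congˡ (power-expansion d) ⟩
      u * parts d term  ≈⟨ parts-* d u term ⟩
      parts d (λ e j → u * term e j)  ≈⟨ parts-cong d (λ e j _ → trans
          (solve 4 (λ u b x y → u :* (b :* (x :* y)) := b :* (x :* (u :* y))) refl u (β e j) (w ^ j) (dim e * Zᵤᵥ e))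
          (trans (*-congˡ (trans (*-congˡ (u*dim*Z e)) (distribˡ _ _ _))) (distribˡ _ _ _))) ⟩
      parts d (λ e j → raised (suc e) j + down e j)
        ≈⟨ parts-+ d (λ e j → raised (suc e) j) down ⟩
      parts d (λ e j → raised (suc e) j) + parts d down
        ≈⟨ +-cong (parts-raise d raised (λ _ _ → refl))
                  (parts-lower d sunk down (λ _ → refl) (λ j → trans (*-congˡ (zeroʳ _)) (zeroʳ _)) (λ _ _ → refl)) ⟩
      parts (suc d) raised + parts (suc d) sunk
        ≈⟨ parts-+ (suc d) raised sunk ⟨
      parts (suc d) (λ e j → raised e j + sunk e j)
        ≈⟨ parts-cong (suc d) (raised+sunk d) ⟩
      parts (suc d) term  ∎
      where
      down : ℕ → ℕ → Carrier
      down e j = β e j * (w ^ j * lower e)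

-- Polynomials as coefficient lists

module ListPolynomial (R : CommutativeRing 0ℓ 0ℓ)
                      (ι : ℚ.+-*-rawRing -Raw-AlmostCommutative⟶ fromCommutativeRing R) where

  open CommutativeRing R hiding (zero)
  open Algebra.Properties.Semiring.Exp semiring using (_^_)
  open Relation.Binary.Reasoning.Setoid setoid
  open _-Raw-AlmostCommutative⟶_ ι using (0-homo; 1-homo)
  open ℚAlgebra R ι
  open Solver using (solve; _:=_; _:+_; _:*_; _:-_; :-_)

  infixl 6 _⊕_
  infixl 7 _⊗_

  eval : List Carrier → Carrier → Carrier
  eval []      t = 0#
  eval (a ∷ p) t = a + t * eval p t

  coeff : List Carrier → ℕ → Carrier
  coeff []      i       = 0#
  coeff (a ∷ p) zero    = a
  coeff (a ∷ p) (suc i) = coeff p i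

  _⊕_ _⊗_ : List Carrier → List Carrier → List Carrier
  []      ⊕ q       = q
  (a ∷ p) ⊕ []      = a ∷ p
  (a ∷ p) ⊕ (b ∷ q) = a + b ∷ p ⊕ q
  []      ⊗ q       = []
  (a ∷ p) ⊗ q       = List.map (a *_) q ⊕ (0# ∷ p ⊗ q)

  eval-⊕ : ∀ p q t → eval (p ⊕ q) t ≈ eval p t + eval q t
  eval-⊕ []      q       t = sym (+-identityˡ _)
  eval-⊕ (a ∷ p) []      t = sym (+-identityʳ _)
  eval-⊕ (a ∷ p) (b ∷ q) t = trans (+-congˡ (*-congˡ (eval-⊕ p q t)))
    (solve 5 (λ a b t x y → a :+ b :+ t :* (x :+ y) := a :+ t :* x :+ (b :+ t :* y)) refl a b t (eval p t) (eval q t))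

  eval-scale : ∀ c p t → eval (List.map (c *_) p) t ≈ c * eval p t
  eval-scale c []      t = sym (zeroʳ c)
  eval-scale c (a ∷ p) t = trans (+-congˡ (*-congˡ (eval-scale c p t)))
    (solve 4 (λ c a t x → c :* a :+ t :* (c :* x) := c :* (a :+ t :* x)) refl c a t (eval p t))

  eval-⊗ : ∀ p q t → eval (p ⊗ q) t ≈ eval p t * eval q t
  eval-⊗ []      q t = sym (zeroˡ _)
  eval-⊗ (a ∷ p) q t = begin
    eval (List.map (a *_) q ⊕ (0# ∷ p ⊗ q)) t
      ≈⟨ eval-⊕ (List.map (a *_) q) (0# ∷ p ⊗ q) t ⟩
    eval (List.map (a *_) q) t + (0# + t * eval (p ⊗ q) t)
      ≈⟨ +-cong (eval-scale a q t) (trans (+-identityˡ _) (*-congˡ (eval-⊗ p q t))) ⟩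
    a * eval q t + t * (eval p t * eval q t)
      ≈⟨ solve 4 (λ a t x y → a :* y :+ t :* (x :* y) := (a :+ t :* x) :* y) refl a t (eval p t) (eval q t) ⟩
    (a + t * eval p t) * eval q t ∎

  coeff-⊕ : ∀ p q i → coeff (p ⊕ q) i ≈ coeff p i + coeff q i
  coeff-⊕ []      q       i       = sym (+-identityˡ _)
  coeff-⊕ (a ∷ p) []      i       = sym (+-identityʳ _)
  coeff-⊕ (a ∷ p) (b ∷ q) zero    = refl
  coeff-⊕ (a ∷ p) (b ∷ q) (suc i) = coeff-⊕ p q i

  coeff-scale : ∀ c p i → coeff (List.map (c *_) p) i ≈ c * coeff p i
  coeff-scale c []      i       = sym (zeroʳ c)
  coeff-scale c (a ∷ p) zero    = refl
  coeff-scale c (a ∷ p) (suc i) = coeff-scale c p i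

  coeff₀-⊗ : ∀ p q → coeff (p ⊗ q) 0 ≈ coeff p 0 * coeff q 0
  coeff₀-⊗ []      q = sym (zeroˡ _)
  coeff₀-⊗ (a ∷ p) q = trans (coeff-⊕ (List.map (a *_) q) _ 0) (trans (+-identityʳ _) (coeff-scale a q 0))

  coeff₁-⊗ : ∀ p q → coeff (p ⊗ q) 1 ≈ coeff p 0 * coeff q 1 + coeff p 1 * coeff q 0
  coeff₁-⊗ []      q = sym (trans (+-cong (zeroˡ _) (zeroˡ _)) (+-identityˡ _))
  coeff₁-⊗ (a ∷ p) q = trans (coeff-⊕ (List.map (a *_) q) _ 1) (+-cong (coeff-scale a q 1) (coeff₀-⊗ p q))

  power : List Carrier → ℕ → List Carrier
  power p zero    = 1# ∷ []
  power p (suc N) = p ⊗ power p N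

  eval-power : ∀ p N t → eval (power p N) t ≈ eval p t ^ N
  eval-power p zero    t = trans (+-congˡ (zeroʳ t)) (+-identityʳ 1#)
  eval-power p (suc N) t = trans (eval-⊗ p (power p N) t) (*-congˡ (eval-power p N t))

  coeff₀-power : ∀ p N → coeff (power p N) 0 ≈ coeff p 0 ^ N
  coeff₀-power p zero    = refl
  coeff₀-power p (suc N) = trans (coeff₀-⊗ p (power p N)) (*-congˡ (coeff₀-power p N))

  coeff₁-power : ∀ p N → coeff (power p (suc N)) 1 ≈ [ suc N ] * (coeff p 0 ^ N * coeff p 1)
  coeff₁-power p zero = trans (coeff₁-⊗ p (1# ∷ []))
    (trans (+-cong (zeroʳ _) (*-comm _ 1#)) (trans (+-identityˡ _) (trans (sym (*-identityˡ _)) (*-congʳ (sym 1-homo)))))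
  coeff₁-power p (suc N) = begin
    coeff (p ⊗ power p (suc N)) 1
      ≈⟨ coeff₁-⊗ p (power p (suc N)) ⟩
    coeff p 0 * coeff (power p (suc N)) 1 + coeff p 1 * coeff (power p (suc N)) 0
      ≈⟨ +-cong (*-congˡ (coeff₁-power p N)) (*-congˡ (coeff₀-power p (suc N))) ⟩
    coeff p 0 * ([ suc N ] * (coeff p 0 ^ N * coeff p 1)) + coeff p 1 * (coeff p 0 * coeff p 0 ^ N)
      ≈⟨ solve 4 (λ a n x b → a :* (n :* (x :* b)) :+ b :* (a :* x) := (num 1 :+ n) :* (a :* x :* b)) refl
           (coeff p 0) [ suc N ] (coeff p 0 ^ N) (coeff p 1) ⟩
    ([ 1 ] + [ suc N ]) * (coeff p 0 * coeff p 0 ^ N * coeff p 1)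
      ≈⟨ *-congʳ ([]-+ 1 (suc N)) ⟨
    [ 2 ℕ.+ N ] * (coeff p 0 ^ suc N * coeff p 1) ∎

  Null : List Carrier → Set
  Null = All (_≈ 0#)

  -- (x - t) quotient t p is the difference of a ∷ p at x and at t.
  quotient : Carrier → List Carrier → List Carrier
  quotient t []      = []
  quotient t (b ∷ p) = eval (b ∷ p) t ∷ quotient t p

  eval-quotient : ∀ a p x t → eval (a ∷ p) x ≈ eval (a ∷ p) t + (x - t) * eval (quotient t p) x
  eval-quotient a []      x t = trans (+-congˡ (zeroʳ x)) (sym (trans (+-cong (+-congˡ (zeroʳ t)) (zeroʳ _)) (+-identityʳ _)))
  eval-quotient a (b ∷ p) x t = trans (+-congˡ (*-congˡ (eval-quotient b p x t)))
    (solve 5 (λ a x t y z → a :+ x :* (y :+ (x :- t) :* z) := a :+ t :* y :+ (x :- t) :* (y :+ x :* z)) refl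
       a x t (eval (b ∷ p) t) (eval (quotient t p) x))

  null-quotient : ∀ a p t → Null (quotient t p) → eval (a ∷ p) t ≈ 0# → Null (a ∷ p)
  null-quotient a []      t [] root = trans (sym (trans (+-congˡ (zeroʳ t)) (+-identityʳ a))) root ∷ []
  null-quotient a (b ∷ p) t (z ∷ zs) root =
    trans (sym (trans (+-congˡ (trans (*-congˡ z) (zeroʳ t))) (+-identityʳ a))) root ∷ null-quotient b p t zs z

  length-quotient : ∀ t p → List.length (quotient t p) ≡ List.length p
  length-quotient t []      = ≡.refl
  length-quotient t (b ∷ p) = ≡.cong suc (length-quotient t p)

  null-from : ∀ N p → List.length p ≡ N → ∀ k → (∀ j → k ℕ.≤ j → eval p [ j ] ≈ 0#) → Null p
  null-from zero    []      _  k roots = []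
  null-from (suc N) (a ∷ p) eq k roots = null-quotient a p [ k ]
    (null-from N (quotient [ k ] p) (≡.trans (length-quotient [ k ] p) (ℕ.suc-injective eq)) (suc k) quotient-roots)
    (roots k ℕ.≤-refl)
    where
    quotient-roots : ∀ j → suc k ℕ.≤ j → eval (quotient [ k ] p) [ j ] ≈ 0#
    quotient-roots j k<j with ℕ.m≤n⇒∃[o]m+o≡n k<j
    ... | o , ≡.refl = []-cancel (suc o) (begin
      [ suc o ] * Q  ≈⟨ *-congʳ difference ⟨
      ([ suc k ℕ.+ o ] - [ k ]) * Q  ≈⟨ +-identityˡ _ ⟨
      0# + ([ suc k ℕ.+ o ] - [ k ]) * Q  ≈⟨ +-congʳ (roots k ℕ.≤-refl) ⟨
      eval (a ∷ p) [ k ] + ([ suc k ℕ.+ o ] - [ k ]) * Q  ≈⟨ eval-quotient a p [ suc k ℕ.+ o ] [ k ] ⟨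
      eval (a ∷ p) [ suc k ℕ.+ o ]  ≈⟨ roots (suc k ℕ.+ o) (ℕ.≤-trans (ℕ.n≤1+n k) k<j) ⟩
      0#  ≈⟨ zeroʳ _ ⟨
      [ suc o ] * 0#  ∎)
      where
      Q = eval (quotient [ k ] p) [ suc k ℕ.+ o ]
      difference : [ suc k ℕ.+ o ] - [ k ] ≈ [ suc o ]
      difference = begin
        [ suc k ℕ.+ o ] - [ k ]  ≈⟨ +-congʳ ([]-cong (≡.sym (ℕ.+-suc k o))) ⟩
        [ k ℕ.+ suc o ] - [ k ]  ≈⟨ +-congʳ ([]-+ k (suc o)) ⟩
        [ k ] + [ suc o ] - [ k ]  ≈⟨ solve 2 (λ k o → k :+ o :- k := o) refl [ k ] [ suc o ] ⟩
        [ suc o ]  ∎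

  coeff-null : ∀ {p} → Null p → ∀ i → coeff p i ≈ 0#
  coeff-null []       i       = refl
  coeff-null (z ∷ zs) zero    = z
  coeff-null (z ∷ zs) (suc i) = coeff-null zs i

  coeff-unique : ∀ p q → (∀ t → eval p [ t ] ≈ eval q [ t ]) → ∀ i → coeff p i ≈ coeff q i
  coeff-unique p q eq i = begin
    coeff p i  ≈⟨ solve 2 (λ x y → x := x :+ (:- num 1) :* y :+ y) refl (coeff p i) (coeff q i) ⟩
    coeff p i + - [ 1 ] * coeff q i + coeff q i  ≈⟨ +-congʳ (+-congˡ (coeff-scale (- [ 1 ]) q i)) ⟨
    coeff p i + coeff (List.map (- [ 1 ] *_) q) i + coeff q i  ≈⟨ +-congʳ (coeff-⊕ p (List.map (- [ 1 ] *_) q) i) ⟨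
    coeff (p ⊕ List.map (- [ 1 ] *_) q) i + coeff q i
      ≈⟨ +-congʳ (coeff-null (null-from _ (p ⊕ List.map (- [ 1 ] *_) q) ≡.refl 0 (λ t _ → root t)) i) ⟩
    0# + coeff q i  ≈⟨ +-identityˡ _ ⟩
    coeff q i  ∎
    where
    root : ∀ t → eval (p ⊕ List.map (- [ 1 ] *_) q) [ t ] ≈ 0#
    root t = begin
      eval (p ⊕ List.map (- [ 1 ] *_) q) [ t ]  ≈⟨ eval-⊕ p (List.map (- [ 1 ] *_) q) [ t ] ⟩
      eval p [ t ] + eval (List.map (- [ 1 ] *_) q) [ t ] ≈⟨ +-cong (eq t) (eval-scale (- [ 1 ]) q [ t ]) ⟩
      eval q [ t ] + - [ 1 ] * eval q [ t ]  ≈⟨ solve 1 (λ y → y :+ (:- num 1) :* y := num 0) refl (eval q [ t ]) ⟩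
      [ 0 ]  ≈⟨ 0-homo ⟩
      0#  ∎

  eval-cong : ∀ p {s t} → s ≈ t → eval p s ≈ eval p t
  eval-cong []      s≈t = refl
  eval-cong (a ∷ p) s≈t = +-congˡ (*-cong s≈t (eval-cong p s≈t))

  derivative : List Carrier → List Carrier
  derivative []      = []
  derivative (a ∷ p) = p ⊕ (0# ∷ derivative p)

  coeff-derivative : ∀ p i → coeff (derivative p) i ≈ [ suc i ] * coeff p (suc i)
  coeff-derivative [] i = sym (zeroʳ _)
  coeff-derivative (a ∷ p) zero = trans (coeff-⊕ p (0# ∷ derivative p) 0)
    (trans (+-identityʳ _) (trans (sym (*-identityˡ _)) (*-congʳ (sym 1-homo))))
  coeff-derivative (a ∷ p) (suc i) = begin
    coeff (p ⊕ (0# ∷ derivative p)) (suc i)  ≈⟨ coeff-⊕ p (0# ∷ derivative p) (suc i) ⟩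
    coeff p (suc i) + coeff (derivative p) i  ≈⟨ +-congˡ (coeff-derivative p i) ⟩
    coeff p (suc i) + [ suc i ] * coeff p (suc i)
      ≈⟨ solve 2 (λ x i → x :+ i :* x := (num 1 :+ i) :* x) refl (coeff p (suc i)) [ suc i ] ⟩
    ([ 1 ] + [ suc i ]) * coeff p (suc i)  ≈⟨ *-congʳ ([]-+ 1 (suc i)) ⟨
    [ 2 ℕ.+ i ] * coeff p (suc i)  ∎

  compose : List Carrier → List Carrier → List Carrier
  compose []      u = []
  compose (a ∷ p) u = (a ∷ []) ⊕ u ⊗ compose p u

  eval-singleton : ∀ a t → eval (a ∷ []) t ≈ a
  eval-singleton a t = trans (+-congˡ (zeroʳ t)) (+-identityʳ a)

  eval-compose : ∀ p u t → eval (compose p u) t ≈ eval p (eval u t)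
  eval-compose []      u t = refl
  eval-compose (a ∷ p) u t = trans (eval-⊕ (a ∷ []) (u ⊗ compose p u) t)
    (+-cong (eval-singleton a t) (trans (eval-⊗ u (compose p u) t) (*-congˡ (eval-compose p u t))))

  coeff₀-compose : ∀ p u → coeff (compose p u) 0 ≈ eval p (coeff u 0)
  coeff₀-compose []      u = refl
  coeff₀-compose (a ∷ p) u = trans (coeff-⊕ (a ∷ []) (u ⊗ compose p u) 0)
    (+-congˡ (trans (coeff₀-⊗ u (compose p u)) (*-congˡ (coeff₀-compose p u))))

  coeff₁-compose : ∀ p u → coeff (compose p u) 1 ≈ coeff u 1 * eval (derivative p) (coeff u 0)
  coeff₁-compose []      u = sym (zeroʳ _)
  coeff₁-compose (a ∷ p) u = begin
    coeff ((a ∷ []) ⊕ u ⊗ compose p u) 1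
      ≈⟨ trans (coeff-⊕ (a ∷ []) (u ⊗ compose p u) 1) (+-identityˡ _) ⟩
    coeff (u ⊗ compose p u) 1
      ≈⟨ coeff₁-⊗ u (compose p u) ⟩
    coeff u 0 * coeff (compose p u) 1 + coeff u 1 * coeff (compose p u) 0
      ≈⟨ +-cong (*-congˡ (coeff₁-compose p u)) (*-congˡ (coeff₀-compose p u)) ⟩
    coeff u 0 * (coeff u 1 * D) + coeff u 1 * P
      ≈⟨ solve 4 (λ a b x y → a :* (b :* x) :+ b :* y := b :* (y :+ a :* x)) refl (coeff u 0) (coeff u 1) D P ⟩
    coeff u 1 * (P + coeff u 0 * D)
      ≈⟨ *-congˡ (+-congˡ (+-identityˡ _)) ⟨
    coeff u 1 * (P + (0# + coeff u 0 * D))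
      ≈⟨ *-congˡ (eval-⊕ p (0# ∷ derivative p) (coeff u 0)) ⟨
    coeff u 1 * eval (p ⊕ (0# ∷ derivative p)) (coeff u 0) ∎
    where
    D = eval (derivative p) (coeff u 0)
    P = eval p (coeff u 0)

-- Rotation-invariant polynomials in two variables

module PlaneRotation (R : CommutativeRing 0ℓ 0ℓ)
                     (ι : ℚ.+-*-rawRing -Raw-AlmostCommutative⟶ fromCommutativeRing R) where

  open CommutativeRing R hiding (zero)
  open Relation.Binary.Reasoning.Setoid setoid
  open _-Raw-AlmostCommutative⟶_ ι using (1-homo)
  open ℚAlgebra R ι
  open ListPolynomial R ι
  open Solver using (solve; _:=_; _:+_; _:*_; _:-_; :-_)

  series : ℕ → (ℕ → Carrier) → Carrier → Carrier
  series B H = eval (List.applyUpTo H B)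

  series-cong : ∀ B {H K x y} → (∀ i → i ℕ.< B → H i ≈ K i) → x ≈ y → series B H x ≈ series B K y
  series-cong zero    H≈K x≈y = refl
  series-cong (suc B) H≈K x≈y = +-cong (H≈K 0 (ℕ.s≤s ℕ.z≤n)) (*-cong x≈y (series-cong B (λ i i<B → H≈K (suc i) (ℕ.s≤s i<B)) x≈y))

  series-zero : ∀ B {H} x → (∀ i → H i ≈ 0#) → series B H x ≈ 0#
  series-zero zero    x H≈0 = refl
  series-zero (suc B) x H≈0 = trans (+-cong (H≈0 0) (trans (*-congˡ (series-zero B x (H≈0 ∘ suc))) (zeroʳ x))) (+-identityʳ 0#)

  series-+ : ∀ B H K x → series B (λ i → H i + K i) x ≈ series B H x + series B K x
  series-+ zero    H K x = sym (+-identityʳ 0#)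
  series-+ (suc B) H K x = trans (+-congˡ (*-congˡ (series-+ B _ _ x)))
    (solve 5 (λ h k x y z → h :+ k :+ x :* (y :+ z) := h :+ x :* y :+ (k :+ x :* z)) refl (H 0) (K 0) x _ _)

  series-* : ∀ B c H x → series B (λ i → c * H i) x ≈ c * series B H x
  series-* zero    c H x = sym (zeroʳ c)
  series-* (suc B) c H x = trans (+-congˡ (*-congˡ (series-* B c _ x)))
    (solve 4 (λ c h x y → c :* h :+ x :* (c :* y) := c :* (h :+ x :* y)) refl c (H 0) x _)

  series-grow : ∀ B H x → H B ≈ 0# → series (suc B) H x ≈ series B H x
  series-grow zero    H x H₀ = trans (+-cong H₀ (zeroʳ x)) (+-identityʳ 0#)
  series-grow (suc B) H x H₀ = +-congˡ (*-congˡ (series-grow B (H ∘ suc) x H₀))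

  coeff-series : ∀ B H i → (B ℕ.≤ i → H i ≈ 0#) → coeff (List.applyUpTo H B) i ≈ H i
  coeff-series zero    H i       H₀ = sym (H₀ ℕ.z≤n)
  coeff-series (suc B) H zero    H₀ = refl
  coeff-series (suc B) H (suc i) H₀ = coeff-series B (H ∘ suc) i (λ B≤i → H₀ (ℕ.s≤s B≤i))

  series-unique : ∀ B H K → (∀ i → B ℕ.≤ i → H i ≈ 0#) → (∀ i → B ℕ.≤ i → K i ≈ 0#) →
    (∀ x → series B H x ≈ series B K x) → ∀ i → H i ≈ K i
  series-unique B H K H₀ K₀ eq i = begin
    H i  ≈⟨ coeff-series B H i (H₀ i) ⟨
    coeff (List.applyUpTo H B) i  ≈⟨ coeff-unique (List.applyUpTo H B) (List.applyUpTo K B) (λ t → eq [ t ]) i ⟩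
    coeff (List.applyUpTo K B) i  ≈⟨ coeff-series B K i (K₀ i) ⟩
    K i  ∎

  biseries : ℕ → (ℕ → ℕ → Carrier) → Carrier → Carrier → Carrier
  biseries B H a b = series B (λ p → series B (H p) b) a

  bicompose : (A B : ℕ) → (ℕ → ℕ → Carrier) → List Carrier → List Carrier → List Carrier
  bicompose zero    B H u v = []
  bicompose (suc A) B H u v = compose (List.applyUpTo (H 0) B) v ⊕ u ⊗ bicompose A B (H ∘ suc) u v

  eval-bicompose : ∀ A B H u v t →
    eval (bicompose A B H u v) t ≈ series A (λ p → series B (H p) (eval v t)) (eval u t)
  eval-bicompose zero    B H u v t = refl
  eval-bicompose (suc A) B H u v t = trans (eval-⊕ (compose (List.applyUpTo (H 0) B) v) _ t)
    (+-cong (eval-compose (List.applyUpTo (H 0) B) v t)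
            (trans (eval-⊗ u (bicompose A B (H ∘ suc) u v) t) (*-congˡ (eval-bicompose A B (H ∘ suc) u v t))))

  coeff₀-bicompose : ∀ A B H u v →
    coeff (bicompose A B H u v) 0 ≈ series A (λ p → series B (H p) (coeff v 0)) (coeff u 0)
  coeff₀-bicompose zero    B H u v = refl
  coeff₀-bicompose (suc A) B H u v = trans (coeff-⊕ (compose (List.applyUpTo (H 0) B) v) _ 0)
    (+-cong (coeff₀-compose (List.applyUpTo (H 0) B) v)
            (trans (coeff₀-⊗ u (bicompose A B (H ∘ suc) u v)) (*-congˡ (coeff₀-bicompose A B (H ∘ suc) u v))))

  coeff₁-bicompose : ∀ (A B : ℕ) (H : ℕ → ℕ → Carrier) (u v : List Carrier) → let a = coeff u 0 ; b = coeff v 0 in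
    coeff (bicompose A B H u v) 1
      ≈ coeff v 1 * series A (λ p → eval (derivative (List.applyUpTo (H p) B)) b) a
      + coeff u 1 * eval (derivative (List.applyUpTo (λ p → series B (H p) b) A)) a
  coeff₁-bicompose zero    B H u v = sym (trans (+-cong (zeroʳ _) (zeroʳ _)) (+-identityʳ 0#))
  coeff₁-bicompose (suc A) B H u v = begin
    coeff (compose h v ⊕ u ⊗ rest) 1
      ≈⟨ coeff-⊕ (compose h v) (u ⊗ rest) 1 ⟩
    coeff (compose h v) 1 + coeff (u ⊗ rest) 1
      ≈⟨ +-cong (coeff₁-compose h v) (trans (coeff₁-⊗ u rest)
           (+-cong (*-congˡ (coeff₁-bicompose A B (H ∘ suc) u v)) (*-congˡ (coeff₀-bicompose A B (H ∘ suc) u v)))) ⟩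
    v₁ * D + (a * (v₁ * Ds + u₁ * Es) + u₁ * F)
      ≈⟨ solve 7 (λ v d a ds u es f → v :* d :+ (a :* (v :* ds :+ u :* es) :+ u :* f)
                   := v :* (d :+ a :* ds) :+ u :* (f :+ a :* es)) refl v₁ D a Ds u₁ Es F ⟩
    v₁ * (D + a * Ds) + u₁ * (F + a * Es)
      ≈⟨ +-congˡ (*-congˡ (+-congˡ (+-identityˡ _))) ⟨
    v₁ * (D + a * Ds) + u₁ * (F + (0# + a * Es))
      ≈⟨ +-congˡ (*-congˡ (eval-⊕ fs (0# ∷ derivative fs) a)) ⟨
    v₁ * (D + a * Ds) + u₁ * eval (fs ⊕ (0# ∷ derivative fs)) a ∎
    where
    a = coeff u 0
    b = coeff v 0
    u₁ = coeff u 1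
    v₁ = coeff v 1
    h = List.applyUpTo (H 0) B
    rest = bicompose A B (H ∘ suc) u v
    fs = List.applyUpTo (λ p → series B (H (suc p)) b) A
    D = eval (derivative h) b
    Ds = series A (λ p → eval (derivative (List.applyUpTo (H (suc p)) B)) b) a
    Es = eval (derivative fs) a
    F = eval fs a

  RotationInvariant : (Carrier → Carrier → Carrier) → Set
  RotationInvariant f = ∀ c s → c * c + s * s ≈ 1# → ∀ a b → f (c * a - s * b) (s * a + c * b) ≈ f a b

  -- The rational points of the circle, parametrised by t.
  N : ℕ → ℕ
  N t = suc (t ℕ.* t)

  cosine sine : ℕ → Carrier
  cosine t = ⅟ (N t) * ([ 1 ] - [ t ] * [ t ])
  sine   t = ⅟ (N t) * ([ 2 ] * [ t ])

  [N] : ∀ t → [ N t ] ≈ [ 1 ] + [ t ] * [ t ]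
  [N] t = trans ([]-+ 1 (t ℕ.* t)) (+-congˡ ([]-* t t))

  ⅟N : ∀ t x → ⅟ (N t) * (([ 1 ] + [ t ] * [ t ]) * x) ≈ x
  ⅟N t x = trans (sym (*-assoc _ _ _)) (trans (*-congʳ (trans (*-congˡ (sym ([N] t))) (⅟-inverse (N t)))) (*-identityˡ x))

  cosine²+sine² : ∀ t → cosine t * cosine t + sine t * sine t ≈ 1#
  cosine²+sine² t = begin
    cosine t * cosine t + sine t * sine t
      ≈⟨ solve 3 (λ i c s → i :* c :* (i :* c) :+ i :* s :* (i :* s) := i :* (i :* (c :* c :+ s :* s))) refl
           (⅟ (N t)) ([ 1 ] - [ t ] * [ t ]) ([ 2 ] * [ t ]) ⟩
    ⅟ (N t) * (⅟ (N t) * (([ 1 ] - [ t ] * [ t ]) * ([ 1 ] - [ t ] * [ t ]) + [ 2 ] * [ t ] * ([ 2 ] * [ t ])))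
      ≈⟨ *-congˡ (*-congˡ (solve 1 (λ t → (num 1 :- t :* t) :* (num 1 :- t :* t) :+ num 2 :* t :* (num 2 :* t) := (num 1 :+ t :* t) :* (num 1 :+ t :* t)) refl [ t ])) ⟩
    ⅟ (N t) * (⅟ (N t) * (([ 1 ] + [ t ] * [ t ]) * ([ 1 ] + [ t ] * [ t ])))
      ≈⟨ solve 2 (λ i m → i :* (i :* (m :* m)) := i :* (m :* (i :* (m :* num 1)))) refl (⅟ (N t)) ([ 1 ] + [ t ] * [ t ]) ⟩
    ⅟ (N t) * (([ 1 ] + [ t ] * [ t ]) * (⅟ (N t) * (([ 1 ] + [ t ] * [ t ]) * [ 1 ])))
      ≈⟨ trans (⅟N t _) (⅟N t _) ⟩
    [ 1 ]
      ≈⟨ 1-homo ⟩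
    1# ∎

  module Infinitesimal (B : ℕ) (H : ℕ → ℕ → Carrier)
                       (boundedˡ : ∀ p q → B ℕ.≤ p → H p q ≈ 0#) (boundedʳ : ∀ p q → B ℕ.≤ q → H p q ≈ 0#)
                       (invariant : RotationInvariant (biseries B H)) where

    private
      column : Carrier → ℕ → Carrier
      column b p = series B (H p) b

      column-bounded : ∀ b p → B ℕ.≤ p → column b p ≈ 0#
      column-bounded b p B≤p = series-zero B b (λ q → boundedˡ p q B≤p)

      columnD : Carrier → ℕ → Carrier
      columnD b p = eval (derivative (List.applyUpTo (H p) B)) b

    -- The coefficient of t when both sides are evaluated at (1 + t²) (a , b).
    generator : ∀ a b → a * series B (columnD b) a ≈ b * eval (derivative (List.applyUpTo (column b) B)) a
    generator a b = []-cancel 2 (begin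
      [ 2 ] * (a * S)
        ≈⟨ solve 4 (λ a b s d → num 2 :* (a :* s) := num 2 :* a :* s :+ (:- (num 2 :* b)) :* d :+ num 2 :* (b :* d)) refl a b S D ⟩
      [ 2 ] * a * S + - ([ 2 ] * b) * D + [ 2 ] * (b * D)
        ≈⟨ +-congʳ (coeff₁-bicompose B B H u v) ⟨
      coeff (bicompose B B H u v) 1 + [ 2 ] * (b * D)
        ≈⟨ +-congʳ (coeff-unique (bicompose B B H u v) (bicompose B B H (a ∷ 0# ∷ a ∷ []) (b ∷ 0# ∷ b ∷ [])) rotate 1) ⟩
      coeff (bicompose B B H (a ∷ 0# ∷ a ∷ []) (b ∷ 0# ∷ b ∷ [])) 1 + [ 2 ] * (b * D)
        ≈⟨ +-congʳ (trans (coeff₁-bicompose B B H (a ∷ 0# ∷ a ∷ []) (b ∷ 0# ∷ b ∷ [])) (trans (+-cong (zeroˡ _) (zeroˡ _)) (+-identityʳ 0#))) ⟩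
      0# + [ 2 ] * (b * D)
        ≈⟨ +-identityˡ _ ⟩
      [ 2 ] * (b * D) ∎)
      where
      S = series B (columnD b) a
      D = eval (derivative (List.applyUpTo (column b) B)) a
      u = a ∷ - ([ 2 ] * b) ∷ - a ∷ []
      v = b ∷ [ 2 ] * a ∷ - b ∷ []
      quadratic : ∀ x y z t → eval (x ∷ y ∷ z ∷ []) t ≈ x + t * (y + t * z)
      quadratic x y z t = +-congˡ (*-congˡ (+-congˡ (*-congˡ (eval-singleton z t))))
      scaled : ∀ x t → eval (x ∷ 0# ∷ x ∷ []) [ t ] ≈ ([ 1 ] + [ t ] * [ t ]) * x
      scaled x t = trans (quadratic x 0# x [ t ]) (trans (+-congˡ (*-congˡ (+-identityˡ _)))
        (solve 2 (λ x t → x :+ t :* (t :* x) := (num 1 :+ t :* t) :* x) refl x [ t ]))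
      rotate : ∀ t → eval (bicompose B B H u v) [ t ] ≈ eval (bicompose B B H (a ∷ 0# ∷ a ∷ []) (b ∷ 0# ∷ b ∷ [])) [ t ]
      rotate t = begin
        eval (bicompose B B H u v) [ t ]
          ≈⟨ eval-bicompose B B H u v [ t ] ⟩
        biseries B H (eval u [ t ]) (eval v [ t ])
          ≈⟨ series-cong B (λ p _ → series-cong B (λ _ _ → refl) v≈) u≈ ⟩
        biseries B H (cosine t * (M * a) - sine t * (M * b)) (sine t * (M * a) + cosine t * (M * b))
          ≈⟨ invariant (cosine t) (sine t) (cosine²+sine² t) (M * a) (M * b) ⟩
        biseries B H (M * a) (M * b)
          ≈⟨ series-cong B (λ p _ → series-cong B (λ _ _ → refl) (scaled b t)) (scaled a t) ⟨
        biseries B H (eval (a ∷ 0# ∷ a ∷ []) [ t ]) (eval (b ∷ 0# ∷ b ∷ []) [ t ])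
          ≈⟨ eval-bicompose B B H (a ∷ 0# ∷ a ∷ []) (b ∷ 0# ∷ b ∷ []) [ t ] ⟨
        eval (bicompose B B H (a ∷ 0# ∷ a ∷ []) (b ∷ 0# ∷ b ∷ [])) [ t ] ∎
        where
        M = [ 1 ] + [ t ] * [ t ]
        u≈ : eval u [ t ] ≈ cosine t * (M * a) - sine t * (M * b)
        u≈ = begin
          eval u [ t ]
            ≈⟨ quadratic a (- ([ 2 ] * b)) (- a) [ t ] ⟩
          a + [ t ] * (- ([ 2 ] * b) + [ t ] * - a)
            ≈⟨ ⅟N t _ ⟨
          ⅟ (N t) * (M * (a + [ t ] * (- ([ 2 ] * b) + [ t ] * - a)))
            ≈⟨ solve 5 (λ i m t a b → i :* (m :* (a :+ t :* ((:- (num 2 :* b)) :+ t :* (:- a))))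
                         := i :* (num 1 :- t :* t) :* (m :* a) :- i :* (num 2 :* t) :* (m :* b))
                 refl (⅟ (N t)) M [ t ] a b ⟩
          cosine t * (M * a) - sine t * (M * b) ∎
        v≈ : eval v [ t ] ≈ sine t * (M * a) + cosine t * (M * b)
        v≈ = begin
          eval v [ t ]
            ≈⟨ quadratic b ([ 2 ] * a) (- b) [ t ] ⟩
          b + [ t ] * ([ 2 ] * a + [ t ] * - b)
            ≈⟨ ⅟N t _ ⟨
          ⅟ (N t) * (M * (b + [ t ] * ([ 2 ] * a + [ t ] * - b)))
            ≈⟨ solve 5 (λ i m t a b → i :* (m :* (b :+ t :* (num 2 :* a :+ t :* (:- b))))
                         := i :* (num 2 :* t) :* (m :* a) :+ i :* (num 1 :- t :* t) :* (m :* b))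
                 refl (⅟ (N t)) M [ t ] a b ⟩
          sine t * (M * a) + cosine t * (M * b) ∎

    private
      column-coeff : ∀ b i → coeff (0# ∷ List.applyUpTo (columnD b) B) i
                           ≈ coeff (List.map (b *_) (derivative (List.applyUpTo (column b) B))) i
      column-coeff b = coeff-unique (0# ∷ List.applyUpTo (columnD b) B) (List.map (b *_) (derivative (List.applyUpTo (column b) B))) λ t → begin
        0# + [ t ] * series B (columnD b) [ t ]  ≈⟨ +-identityˡ _ ⟩
        [ t ] * series B (columnD b) [ t ]  ≈⟨ generator [ t ] b ⟩
        b * eval (derivative (List.applyUpTo (column b) B)) [ t ]  ≈⟨ eval-scale b (derivative (List.applyUpTo (column b) B)) [ t ] ⟨
        eval (List.map (b *_) (derivative (List.applyUpTo (column b) B))) [ t ] ∎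

      column-derivative : ∀ b i → coeff (List.map (b *_) (derivative (List.applyUpTo (column b) B))) i
                                ≈ b * ([ suc i ] * column b (suc i))
      column-derivative b i = trans (coeff-scale b (derivative (List.applyUpTo (column b) B)) i) (*-congˡ (trans
        (coeff-derivative (List.applyUpTo (column b) B) i) (*-congˡ (coeff-series B (column b) (suc i) (column-bounded b (suc i))))))

      columnD-bounded : ∀ b p → B ℕ.≤ p → columnD b p ≈ 0#
      columnD-bounded b p B≤p = eval-null (derivative (List.applyUpTo (H p) B)) b λ i → trans
        (coeff-derivative (List.applyUpTo (H p) B) i)
        (trans (*-congˡ (trans (coeff-series B (H p) (suc i) (λ _ → boundedˡ p (suc i) B≤p)) (boundedˡ p (suc i) B≤p))) (zeroʳ _))
        where
        eval-null : ∀ l x → (∀ i → coeff l i ≈ 0#) → eval l x ≈ 0#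
        eval-null []      x _ = refl
        eval-null (c ∷ l) x z = trans (+-cong (z 0) (trans (*-congˡ (eval-null l x (z ∘ suc))) (zeroʳ x))) (+-identityʳ 0#)

      column-relation : ∀ b p → columnD b p ≈ b * ([ 2 ℕ.+ p ] * column b (2 ℕ.+ p))
      column-relation b p = trans (sym (coeff-series B (columnD b) p (columnD-bounded b p)))
        (trans (column-coeff b (suc p)) (column-derivative b (suc p)))

      row-relation : ∀ p i → coeff (derivative (List.applyUpTo (H p) B)) i
                           ≈ coeff (0# ∷ List.map ([ 2 ℕ.+ p ] *_) (List.applyUpTo (H (2 ℕ.+ p)) B)) i
      row-relation p = coeff-unique (derivative (List.applyUpTo (H p) B)) (0# ∷ List.map ([ 2 ℕ.+ p ] *_) (List.applyUpTo (H (2 ℕ.+ p)) B)) λ t → begin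
        columnD [ t ] p  ≈⟨ column-relation [ t ] p ⟩
        [ t ] * ([ 2 ℕ.+ p ] * column [ t ] (2 ℕ.+ p))  ≈⟨ *-congˡ (eval-scale [ 2 ℕ.+ p ] (List.applyUpTo (H (2 ℕ.+ p)) B) [ t ]) ⟨
        [ t ] * eval (List.map ([ 2 ℕ.+ p ] *_) (List.applyUpTo (H (2 ℕ.+ p)) B)) [ t ]  ≈⟨ +-identityˡ _ ⟨
        0# + [ t ] * eval (List.map ([ 2 ℕ.+ p ] *_) (List.applyUpTo (H (2 ℕ.+ p)) B)) [ t ] ∎

      row-derivative : ∀ p q → coeff (derivative (List.applyUpTo (H p) B)) q ≈ [ suc q ] * H p (suc q)
      row-derivative p q = trans (coeff-derivative (List.applyUpTo (H p) B) q) (*-congˡ (coeff-series B (H p) (suc q) (boundedʳ p (suc q))))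

    exchange : ∀ p q → [ 2 ℕ.+ p ] * H (2 ℕ.+ p) q ≈ [ 2 ℕ.+ q ] * H p (2 ℕ.+ q)
    exchange p q = begin
      [ 2 ℕ.+ p ] * H (2 ℕ.+ p) q
        ≈⟨ *-congˡ (coeff-series B (H (2 ℕ.+ p)) q (boundedʳ (2 ℕ.+ p) q)) ⟨
      [ 2 ℕ.+ p ] * coeff (List.applyUpTo (H (2 ℕ.+ p)) B) q
        ≈⟨ coeff-scale [ 2 ℕ.+ p ] (List.applyUpTo (H (2 ℕ.+ p)) B) q ⟨
      coeff (List.map ([ 2 ℕ.+ p ] *_) (List.applyUpTo (H (2 ℕ.+ p)) B)) q
        ≈⟨ row-relation p (suc q) ⟨
      coeff (derivative (List.applyUpTo (H p) B)) (suc q)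
        ≈⟨ row-derivative p (suc q) ⟩
      [ 2 ℕ.+ q ] * H p (2 ℕ.+ q) ∎

    second-one : ∀ p → H p 1 ≈ 0#
    second-one p = []-cancel 1 (trans (sym (row-derivative p 0)) (trans (row-relation p 0) (sym (zeroʳ _))))

    first-one : ∀ q → H 1 q ≈ 0#
    first-one q = trans (sym (coeff-series B (H 1) q (boundedʳ 1 q)))
      (coeff-unique (0# ∷ List.applyUpTo (H 1) B) [] (λ t → trans (+-identityˡ _) (begin
        [ t ] * column [ t ] 1  ≈⟨ *-congˡ (trans (*-congʳ 1-homo) (*-identityˡ _)) ⟨
        [ t ] * ([ 1 ] * column [ t ] 1)  ≈⟨ column-derivative [ t ] 0 ⟨
        coeff (List.map ([ t ] *_) (derivative (List.applyUpTo (column [ t ]) B))) 0  ≈⟨ column-coeff [ t ] 0 ⟨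
        0# ∎)) (suc q))

open import Defs using (exponents; dimH)

-- Polynomials in several variables, as coefficient functions on a box of exponents

module BoxPolynomial (R : CommutativeRing 0ℓ 0ℓ)
                     (ι : ℚ.+-*-rawRing -Raw-AlmostCommutative⟶ fromCommutativeRing R) where

  open CommutativeRing R hiding (zero)
  open Algebra.Properties.Semiring.Sum semiring using (sum)
  open Relation.Binary.Reasoning.Setoid setoid
  open ℚAlgebra R ι
  open ListPolynomial R ι
  open PlaneRotation R ι
  open Solver using (solve; _:=_; _:+_; _:*_; _:-_; :-_)

  Coefficients : ℕ → Set
  Coefficients n = Vec ℕ n → Carrier

  box : ∀ {n} → ℕ → Coefficients n → (Fin n → Carrier) → Carrier
  box {zero}  B g x = g []
  box {suc n} B g x = series B (λ p → box B (λ β → g (p ∷ β)) (x ∘ suc)) (x zero)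

  Bounded : ∀ {n} → ℕ → Coefficients n → Set
  Bounded B g = ∀ α → B ℕ.≤ Vec.sum α → g α ≈ 0#

  box-cong : ∀ {n} B {g h : Coefficients n} {x y} → (∀ α → g α ≈ h α) → (∀ i → x i ≈ y i) → box B g x ≈ box B h y
  box-cong {zero}  B g≈h x≈y = g≈h []
  box-cong {suc n} B g≈h x≈y = series-cong B (λ p _ → box-cong B (λ β → g≈h (p ∷ β)) (x≈y ∘ suc)) (x≈y zero)

  box-zero : ∀ {n} B {g : Coefficients n} x → (∀ α → g α ≈ 0#) → box B g x ≈ 0#
  box-zero {zero}  B x g≈0 = g≈0 []
  box-zero {suc n} B x g≈0 = series-zero B (x zero) (λ p → box-zero B (x ∘ suc) (λ β → g≈0 (p ∷ β)))

  box-+ : ∀ {n} B (g h : Coefficients n) x → box B (λ α → g α + h α) x ≈ box B g x + box B h x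
  box-+ {zero}  B g h x = refl
  box-+ {suc n} B g h x = trans
    (series-cong B (λ p _ → box-+ B (λ β → g (p ∷ β)) (λ β → h (p ∷ β)) (x ∘ suc)) refl) (series-+ B _ _ (x zero))

  box-* : ∀ {n} B c (g : Coefficients n) x → box B (λ α → c * g α) x ≈ c * box B g x
  box-* {zero}  B c g x = refl
  box-* {suc n} B c g x = trans (series-cong B (λ p _ → box-* B c (λ β → g (p ∷ β)) (x ∘ suc)) refl) (series-* B c _ (x zero))

  box-sum : ∀ {n k} B (g : Fin k → Coefficients n) x → box B (λ α → sum (λ j → g j α)) x ≈ sum (λ j → box B (g j) x)
  box-sum {k = zero}  B g x = box-zero B x (λ _ → refl)
  box-sum {k = suc k} B g x = trans (box-+ B (g zero) _ x) (+-congˡ (box-sum B (g ∘ suc) x))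

  section-bounded : ∀ {n B} {g : Coefficients (suc n)} → Bounded B g → ∀ p → Bounded B (λ β → g (p ∷ β))
  section-bounded g₀ p β B≤ = g₀ (p ∷ β) (ℕ.≤-trans B≤ (ℕ.m≤n+m _ p))

  section-vanishes : ∀ {n B} {g : Coefficients (suc n)} → Bounded B g → ∀ p → B ℕ.≤ p → ∀ β → g (p ∷ β) ≈ 0#
  section-vanishes g₀ p B≤p β = g₀ (p ∷ β) (ℕ.≤-trans B≤p (ℕ.m≤m+n p _))

  infixr 5 _◂_

  _◂_ : ∀ {n} → Carrier → (Fin n → Carrier) → Fin (suc n) → Carrier
  (a ◂ x) zero    = a
  (a ◂ x) (suc i) = x i

  box-unique : ∀ {n} B {g h : Coefficients n} → Bounded B g → Bounded B h →
    (∀ x → box B g x ≈ box B h x) → ∀ α → g α ≈ h α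
  box-unique B g₀ h₀ eq []      = eq λ ()
  box-unique B {g} {h} g₀ h₀ eq (p ∷ β) =
    box-unique B {λ β → g (p ∷ β)} {λ β → h (p ∷ β)} (section-bounded g₀ p) (section-bounded h₀ p) (λ x →
      series-unique B (λ p → box B (λ β → g (p ∷ β)) x) (λ p → box B (λ β → h (p ∷ β)) x)
        (λ p B≤p → box-zero B x (section-vanishes g₀ p B≤p)) (λ p B≤p → box-zero B x (section-vanishes h₀ p B≤p))
        (λ a → eq (a ◂ x)) p) β

  rotate : ∀ {n} → Fin n → Carrier → Carrier → (Fin (suc n) → Carrier) → Fin (suc n) → Carrier
  rotate zero    c s x zero          = c * x zero - s * x (suc zero)
  rotate zero    c s x (suc zero)    = s * x zero + c * x (suc zero)
  rotate zero    c s x (suc (suc j)) = x (suc (suc j))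
  rotate (suc i) c s x zero          = x zero
  rotate (suc i) c s x (suc j)       = rotate i c s (x ∘ suc) j

  Invariant : ∀ {n} → ℕ → Coefficients (suc n) → Set
  Invariant {n} B g = ∀ (i : Fin n) c s → c * c + s * s ≈ 1# → ∀ x → box B g (rotate i c s x) ≈ box B g x

  section-invariant : ∀ {n B} {g : Coefficients (2 ℕ.+ n)} → Bounded B g → Invariant B g → ∀ p → Invariant B (λ β → g (p ∷ β))
  section-invariant {n} {B} {g} g₀ inv p i c s eq x =
    series-unique B (λ p → box B (λ β → g (p ∷ β)) (rotate i c s x)) (λ p → box B (λ β → g (p ∷ β)) x)
      (λ p B≤p → box-zero B (rotate i c s x) (section-vanishes g₀ p B≤p)) (λ p B≤p → box-zero B x (section-vanishes g₀ p B≤p))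
      (λ a → inv (suc i) c s eq (a ◂ x)) p

  module FirstPlane {n B} {g : Coefficients (2 ℕ.+ n)} (g₀ : Bounded B g) (inv : Invariant B g) where

    private
      module At (x : Fin n → Carrier) = Infinitesimal B (λ p q → box B (λ β → g (p ∷ q ∷ β)) x)
        (λ p q B≤p → box-zero B x (λ β → section-vanishes g₀ p B≤p (q ∷ β)))
        (λ p q B≤q → box-zero B x (section-vanishes {g = λ γ → g (p ∷ γ)} (section-bounded g₀ p) q B≤q))
        (λ c s eq a b → inv zero c s eq (a ◂ b ◂ x))

      bounded₂ : ∀ p q → Bounded B (λ β → g (p ∷ q ∷ β))
      bounded₂ p q = section-bounded {g = λ γ → g (p ∷ γ)} (section-bounded g₀ p) q

      scaled-bounded : ∀ c p q → Bounded B (λ β → c * g (p ∷ q ∷ β))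
      scaled-bounded c p q β B≤ = trans (*-congˡ (bounded₂ p q β B≤)) (zeroʳ c)

    exchange : ∀ p q β → [ 2 ℕ.+ p ] * g (2 ℕ.+ p ∷ q ∷ β) ≈ [ 2 ℕ.+ q ] * g (p ∷ 2 ℕ.+ q ∷ β)
    exchange p q = box-unique B (scaled-bounded [ 2 ℕ.+ p ] (2 ℕ.+ p) q) (scaled-bounded [ 2 ℕ.+ q ] p (2 ℕ.+ q)) (λ x → begin
      box B (λ β → [ 2 ℕ.+ p ] * g (2 ℕ.+ p ∷ q ∷ β)) x  ≈⟨ box-* B [ 2 ℕ.+ p ] _ x ⟩
      [ 2 ℕ.+ p ] * box B (λ β → g (2 ℕ.+ p ∷ q ∷ β)) x  ≈⟨ At.exchange x p q ⟩
      [ 2 ℕ.+ q ] * box B (λ β → g (p ∷ 2 ℕ.+ q ∷ β)) x  ≈⟨ box-* B [ 2 ℕ.+ q ] _ x ⟨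
      box B (λ β → [ 2 ℕ.+ q ] * g (p ∷ 2 ℕ.+ q ∷ β)) x  ∎)

    first-one : ∀ q β → g (1 ∷ q ∷ β) ≈ 0#
    first-one q = box-unique B (bounded₂ 1 q) (λ _ _ → refl) (λ x → trans (At.first-one x q) (sym (box-zero B x (λ _ → refl))))

    second-one : ∀ p β → g (p ∷ 1 ∷ β) ≈ 0#
    second-one p = box-unique B (bounded₂ p 1) (λ _ _ → refl) (λ x → trans (At.second-one x p) (sym (box-zero B x (λ _ → refl))))

  Odd : ℕ → Set
  Odd zero          = ⊥
  Odd (suc zero)    = ⊤
  Odd (suc (suc n)) = Odd n

  Odd-+ : ∀ m n → Odd (m ℕ.+ n) → Odd m ⊎ Odd n
  Odd-+ zero          n o = inj₂ o
  Odd-+ (suc zero)    n o = inj₁ tt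
  Odd-+ (suc (suc m)) n o = Odd-+ m n o

  Odd-sum : ∀ {n} (α : Vec ℕ n) → Odd (Vec.sum α) → Σ[ j ∈ Fin n ] Odd (Vec.lookup α j)
  Odd-sum (p ∷ β) o with Odd-+ p (Vec.sum β) o
  ... | inj₁ odd-p = zero , odd-p
  ... | inj₂ odd-β = let j , odd-j = Odd-sum β odd-β in suc j , odd-j

  raise : ∀ {n} → Fin n → Vec ℕ n → Vec ℕ n
  raise j α = Vec.updateAt α j (ℕ._+ 2)

  record Symmetric {n} (g : Coefficients (suc n)) : Set where
    field
      exchange : ∀ j α → [ Vec.lookup α j ℕ.+ 2 ] * g (raise j α) ≈ [ Vec.lookup α zero ℕ.+ 2 ] * g (raise zero α)
      even     : ∀ j α → Odd (Vec.lookup α j) → g α ≈ 0#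

  invariant⇒exchange : ∀ {n B} {g : Coefficients (suc n)} → Bounded B g → Invariant B g → ∀ j α →
    [ Vec.lookup α j ℕ.+ 2 ] * g (raise j α) ≈ [ Vec.lookup α zero ℕ.+ 2 ] * g (raise zero α)
  invariant⇒exchange g₀ inv zero    α           = refl
  invariant⇒exchange {suc n} {g = g} g₀ inv (suc j) (p ∷ q ∷ β) = trans
    (invariant⇒exchange (section-bounded g₀ p) (section-invariant g₀ inv p) j (q ∷ β)) adjacent
    where
    adjacent : [ q ℕ.+ 2 ] * g (p ∷ q ℕ.+ 2 ∷ β) ≈ [ p ℕ.+ 2 ] * g (p ℕ.+ 2 ∷ q ∷ β)
    adjacent rewrite ℕ.+-comm p 2 | ℕ.+-comm q 2 = sym (FirstPlane.exchange g₀ inv p q β)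

  invariant⇒even : ∀ {n B} {g : Coefficients (2 ℕ.+ n)} → Bounded B g → Invariant B g → ∀ j α → Odd (Vec.lookup α j) → g α ≈ 0#
  invariant⇒even {n} {B} {g} g₀ inv zero (p ∷ q ∷ β) = odd-first p q
    where
    odd-first : ∀ p q → Odd p → g (p ∷ q ∷ β) ≈ 0#
    odd-first (suc zero)    q o = FirstPlane.first-one g₀ inv q β
    odd-first (suc (suc p)) q o = []-cancel (2 ℕ.+ p) (trans (FirstPlane.exchange g₀ inv p q β)
      (trans (*-congˡ (odd-first p (2 ℕ.+ q) o)) (trans (zeroʳ _) (sym (zeroʳ _)))))
  invariant⇒even {n} {B} {g} g₀ inv (suc zero) (p ∷ q ∷ β) = odd-second q p
    where
    odd-second : ∀ q p → Odd q → g (p ∷ q ∷ β) ≈ 0#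
    odd-second (suc zero)    p o = FirstPlane.second-one g₀ inv p β
    odd-second (suc (suc q)) p o = []-cancel (2 ℕ.+ q) (trans (sym (FirstPlane.exchange g₀ inv p q β))
      (trans (*-congˡ (odd-second q (2 ℕ.+ p) o)) (trans (zeroʳ _) (sym (zeroʳ _)))))
  invariant⇒even {suc n} g₀ inv (suc (suc j)) (p ∷ β) =
    invariant⇒even (section-bounded g₀ p) (section-invariant g₀ inv p) (suc j) β

  alternate : ℕ → Carrier → Carrier
  alternate zero    h = h
  alternate (suc p) h = - alternate p h

  series-neg : ∀ B H x → series B (λ p → - H p) x ≈ - series B H x
  series-neg B H x = begin
    series B (λ p → - H p) x  ≈⟨ series-cong B (λ p _ → solve 1 (λ h → :- h := (:- num 1) :* h) refl (H p)) refl ⟩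
    series B (λ p → - [ 1 ] * H p) x  ≈⟨ series-* B (- [ 1 ]) H x ⟩
    - [ 1 ] * series B H x  ≈⟨ solve 1 (λ h → (:- num 1) :* h := :- h) refl (series B H x) ⟩
    - series B H x  ∎

  series-reflect : ∀ B H x → series B H (- x) ≈ series B (λ p → alternate p (H p)) x
  series-reflect zero    H x = refl
  series-reflect (suc B) H x = +-congˡ (begin
    - x * series B (H ∘ suc) (- x)  ≈⟨ *-congˡ (series-reflect B (H ∘ suc) x) ⟩
    - x * series B (λ p → alternate p (H (suc p))) x  ≈⟨ solve 2 (λ x y → (:- x) :* y := x :* (:- y)) refl x _ ⟩
    x * - series B (λ p → alternate p (H (suc p))) x  ≈⟨ *-congˡ (series-neg B (λ p → alternate p (H (suc p))) x) ⟨
    x * series B (λ p → - alternate p (H (suc p))) x  ∎)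

  alternate-zero : ∀ p {h} → h ≈ 0# → alternate p h ≈ 0#
  alternate-zero zero    h≈0 = h≈0
  alternate-zero (suc p) h≈0 = trans (-‿cong (alternate-zero p h≈0)) (trans (sym (+-identityˡ _)) (-‿inverseʳ 0#))

  alternate-odd : ∀ p → Odd p → ∀ h → alternate p h ≈ - h
  alternate-odd (suc zero)    o h = refl
  alternate-odd (suc (suc p)) o h = trans (solve 1 (λ x → :- (:- x) := x) refl (alternate p h)) (alternate-odd p o h)

  reflection⇒symmetric : ∀ {B} {g : Coefficients 1} → Bounded B g → (∀ x → box B g (- x ◂ λ ()) ≈ box B g (x ◂ λ ())) → Symmetric g
  reflection⇒symmetric {B} {g} g₀ inv = record { exchange = λ { zero α → refl } ; even = even }
    where
    even : ∀ j α → Odd (Vec.lookup α j) → g α ≈ 0#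
    even zero (p ∷ []) o = []-cancel 2 (begin
      [ 2 ] * h  ≈⟨ solve 1 (λ h → num 2 :* h := h :+ h) refl h ⟩
      h + h  ≈⟨ +-congʳ (trans (sym reflected) (alternate-odd p o h)) ⟩
      - h + h  ≈⟨ -‿inverseˡ h ⟩
      0#  ≈⟨ zeroʳ _ ⟨
      [ 2 ] * 0#  ∎)
      where
      h = g (p ∷ [])
      H : ℕ → Carrier
      H p = g (p ∷ [])
      H₀ : ∀ p → B ℕ.≤ p → H p ≈ 0#
      H₀ p B≤p = section-vanishes g₀ p B≤p []
      reflected : alternate p h ≈ h
      reflected = series-unique B (λ p → alternate p (H p)) H (λ p B≤p → alternate-zero p (H₀ p B≤p)) H₀
        (λ x → trans (sym (series-reflect B H x)) (inv x)) p

-- Rotations in coordinate planes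

module PlaneMatrices (R : CommutativeRing 0ℓ 0ℓ)
                     (ι : ℚ.+-*-rawRing -Raw-AlmostCommutative⟶ fromCommutativeRing R) where

  open CommutativeRing R hiding (zero)
  open Algebra.Properties.Semiring.Exp semiring using (_^_)
  open Algebra.Properties.Semiring.Sum semiring using (sum)
  open Algebra.Properties.Ring ring using (-‿distribˡ-*)
  open ℚAlgebra R ι
  open BoxPolynomial R ι using (rotate)
  open Solver using (solve; _:=_; _:+_; _:*_; _:-_; :-_)

  Square : ℕ → Set
  Square n = Fin n → Fin n → Carrier

  δ : ∀ {n} → Square n
  δ i j = if does (i Fin.≟ j) then 1# else 0#

  determinant : ∀ {n} → Square n → Carrier
  determinant {zero}  A = 1#
  determinant {suc n} A = sum (λ j → (- 1#) ^ toℕ j * A zero j * determinant (λ i k → A (suc i) (Fin.punchIn j k)))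

  OrthogonalColumns : ∀ {n} → Square n → Set
  OrthogonalColumns A = ∀ i j → sum (λ k → A k i * A k j) ≈ δ i j

  sum-zero : ∀ n {t : Fin n → Carrier} → (∀ i → t i ≈ 0#) → sum t ≈ 0#
  sum-zero zero    t≈0 = refl
  sum-zero (suc n) t≈0 = trans (+-cong (t≈0 zero) (sum-zero n (t≈0 ∘ suc))) (+-identityˡ 0#)

  sum-δ : ∀ {n} (i : Fin n) (x : Fin n → Carrier) → sum (λ j → δ i j * x j) ≈ x i
  sum-δ {suc n} zero    x = trans (+-cong (*-identityˡ _) (sum-zero n (λ j → zeroˡ _))) (+-identityʳ _)
  sum-δ {suc n} (suc i) x = trans (+-cong (zeroˡ _) (sum-δ i (x ∘ suc))) (+-identityˡ _)

  block : ∀ {n} → Square n → Square (suc n)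
  block A zero    zero    = 1#
  block A zero    (suc j) = 0#
  block A (suc i) zero    = 0#
  block A (suc i) (suc j) = A i j

  plane : ∀ {n} → Carrier → Carrier → Square (2 ℕ.+ n)
  plane c s zero          zero          = c
  plane c s zero          (suc zero)    = - s
  plane c s zero          (suc (suc j)) = 0#
  plane c s (suc zero)    zero          = s
  plane c s (suc zero)    (suc zero)    = c
  plane c s (suc zero)    (suc (suc j)) = 0#
  plane c s (suc (suc i)) zero          = 0#
  plane c s (suc (suc i)) (suc zero)    = 0#
  plane c s (suc (suc i)) (suc (suc j)) = δ i j

  rotation : ∀ {n} → Fin n → Carrier → Carrier → Square (suc n)
  rotation zero    c s = plane c s
  rotation (suc i) c s = block (rotation i c s)

  rotation-rotates : ∀ {n} (i : Fin n) c s (x : Fin (suc n) → Carrier) j → sum (λ k → rotation i c s j k * x k) ≈ rotate i c s x j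
  rotation-rotates {suc n} zero c s x zero =
    +-congˡ (trans (+-cong (sym (-‿distribˡ-* s (x (suc zero)))) (sum-zero n (λ j → zeroˡ _))) (+-identityʳ _))
  rotation-rotates {suc n} zero c s x (suc zero) = +-congˡ (trans (+-congˡ (sum-zero n (λ j → zeroˡ _))) (+-identityʳ _))
  rotation-rotates {suc n} zero c s x (suc (suc j)) =
    trans (+-cong (zeroˡ _) (trans (+-cong (zeroˡ _) (sum-δ j (λ k → x (suc (suc k))))) (+-identityˡ _))) (+-identityˡ _)
  rotation-rotates {n} (suc i) c s x zero = trans (+-cong (*-identityˡ _) (sum-zero n {λ j → 0# * x (suc j)} (λ j → zeroˡ (x (suc j))))) (+-identityʳ _)
  rotation-rotates (suc i) c s x (suc j) = trans (+-cong (zeroˡ _) (rotation-rotates i c s (x ∘ suc) j)) (+-identityˡ _)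

  0*0+ : ∀ {x} → 0# * 0# + x ≈ x
  0*0+ {x} = trans (+-congʳ (zeroˡ 0#)) (+-identityˡ x)

  block-orthogonal : ∀ {n} {A : Square n} → OrthogonalColumns A → OrthogonalColumns (block A)
  block-orthogonal {n} A⊥ zero    zero    = trans (+-cong (*-identityˡ 1#) (sum-zero n (λ _ → zeroˡ 0#))) (+-identityʳ 1#)
  block-orthogonal {n} A⊥ zero    (suc j) = trans (+-cong (zeroʳ 1#) (sum-zero n (λ _ → zeroˡ _))) (+-identityˡ 0#)
  block-orthogonal {n} A⊥ (suc i) zero    = trans (+-cong (zeroˡ 1#) (sum-zero n (λ _ → zeroʳ _))) (+-identityˡ 0#)
  block-orthogonal A⊥ (suc i) (suc j) = trans 0*0+ (A⊥ i j)

  δ-orthogonal : ∀ {n} → OrthogonalColumns (δ {n})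
  δ-orthogonal {suc n} zero    zero    = trans (+-cong (*-identityˡ 1#) (sum-zero n (λ _ → zeroˡ 0#))) (+-identityʳ 1#)
  δ-orthogonal {suc n} zero    (suc j) = trans (+-cong (zeroʳ 1#) (sum-zero n (λ _ → zeroˡ _))) (+-identityˡ 0#)
  δ-orthogonal {suc n} (suc i) zero    = trans (+-cong (zeroˡ 1#) (sum-zero n (λ _ → zeroʳ _))) (+-identityˡ 0#)
  δ-orthogonal (suc i) (suc j) = trans 0*0+ (δ-orthogonal i j)

  determinant-expand : ∀ {n} (A : Square (suc n)) → (∀ j → A zero (suc j) ≈ 0#) →
    determinant A ≈ A zero zero * determinant (λ i j → A (suc i) (suc j))
  determinant-expand {n} A A₀ = trans (+-cong (*-congʳ (*-identityˡ _))
    (sum-zero n (λ j → trans (*-congʳ (trans (*-congˡ (A₀ j)) (zeroʳ _))) (zeroˡ _)))) (+-identityʳ _)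

  determinant-δ : ∀ n → determinant (δ {n}) ≈ 1#
  determinant-δ zero    = refl
  determinant-δ (suc n) = trans (determinant-expand (δ {suc n}) (λ _ → refl)) (trans (*-identityˡ _) (determinant-δ n))

  module _ {c s : Carrier} (unit : c * c + s * s ≈ 1#) where

    private
      two-terms : ∀ n {a b d} {t : Fin n → Carrier} → a + b ≈ d → (∀ i → t i ≈ 0#) → a + (b + sum t) ≈ d
      two-terms n a+b t≈0 = trans (+-congˡ (trans (+-congˡ (sum-zero n t≈0)) (+-identityʳ _))) a+b

      zeros : ∀ {a b} → a ≈ 0# → b ≈ 0# → a + b ≈ 0#
      zeros a≈0 b≈0 = trans (+-cong a≈0 b≈0) (+-identityˡ 0#)

      cancel₁ : c * - s + s * c ≈ 0#
      cancel₁ = trans (solve 2 (λ c s → c :* (:- s) :+ s :* c := c :* s :+ (:- (c :* s))) refl c s) (-‿inverseʳ _)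

      cancel₂ : - s * c + c * s ≈ 0#
      cancel₂ = trans (solve 2 (λ c s → (:- s) :* c :+ c :* s := c :* s :+ (:- (c :* s))) refl c s) (-‿inverseʳ _)

      unit′ : - s * - s + c * c ≈ 1#
      unit′ = trans (solve 2 (λ c s → (:- s) :* (:- s) :+ c :* c := c :* c :+ s :* s) refl c s) unit

    plane-orthogonal : ∀ {n} → OrthogonalColumns (plane {n} c s)
    plane-orthogonal {n} zero          zero          = two-terms n unit (λ _ → zeroˡ 0#)
    plane-orthogonal {n} zero          (suc zero)    = two-terms n cancel₁ (λ _ → zeroˡ 0#)
    plane-orthogonal {n} zero          (suc (suc j)) = two-terms n (zeros (zeroʳ _) (zeroʳ _)) (λ _ → zeroˡ _)
    plane-orthogonal {n} (suc zero)    zero          = two-terms n cancel₂ (λ _ → zeroˡ 0#)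
    plane-orthogonal {n} (suc zero)    (suc zero)    = two-terms n unit′ (λ _ → zeroˡ 0#)
    plane-orthogonal {n} (suc zero)    (suc (suc j)) = two-terms n (zeros (zeroʳ _) (zeroʳ _)) (λ _ → zeroˡ _)
    plane-orthogonal {n} (suc (suc i)) zero          = two-terms n (zeros (zeroˡ _) (zeroˡ _)) (λ _ → zeroʳ _)
    plane-orthogonal {n} (suc (suc i)) (suc zero)    = two-terms n (zeros (zeroˡ _) (zeroˡ _)) (λ _ → zeroʳ _)
    plane-orthogonal {n} (suc (suc i)) (suc (suc j)) = trans 0*0+ (trans 0*0+ (δ-orthogonal i j))

    rotation-orthogonal : ∀ {n} (i : Fin n) → OrthogonalColumns (rotation i c s)
    rotation-orthogonal zero    = plane-orthogonal
    rotation-orthogonal (suc i) = block-orthogonal (rotation-orthogonal i)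

    determinant-plane : ∀ n → determinant (plane {n} c s) ≈ 1#
    determinant-plane n = trans
      (+-cong (*-cong (*-identityˡ c) (minor (λ i k → plane {n} c s (suc i) (suc k)) (λ _ → refl) (determinant-δ n)))
        (trans (+-cong (*-cong sign (minor (λ i k → plane {n} c s (suc i) (Fin.punchIn (suc zero) k)) (λ _ → refl) (determinant-δ n)))
                       (sum-zero n {rest} (λ j → trans (*-congʳ (zeroʳ ((- 1#) ^ toℕ (suc (suc j))))) (zeroˡ (M j)))))
               (+-identityʳ (s * s))))
      unit
      where
      M : Fin n → Carrier
      M j = determinant (λ i k → plane {n} c s (suc i) (Fin.punchIn (suc (suc j)) k))
      rest : Fin n → Carrier
      rest j = (- 1#) ^ toℕ (suc (suc j)) * 0# * M j
      sign : - 1# * 1# * - s ≈ s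
      sign = trans (*-congʳ (*-identityʳ (- 1#))) (trans (sym (-‿distribˡ-* 1# (- s)))
        (trans (-‿cong (*-identityˡ (- s))) (solve 1 (λ s → :- (:- s) := s) refl s)))
      minor : ∀ (A : Square (suc n)) → (∀ j → A zero (suc j) ≈ 0#) → determinant (λ i j → A (suc i) (suc j)) ≈ 1# → determinant A ≈ A zero zero
      minor A A₀ d = trans (determinant-expand A A₀) (trans (*-congˡ d) (*-identityʳ (A zero zero)))

    rotation-determinant : ∀ {n} (i : Fin n) → determinant (rotation i c s) ≈ 1#
    rotation-determinant {suc n} zero    = determinant-plane n
    rotation-determinant (suc i) = trans (trans (determinant-expand (block (rotation i c s)) (λ _ → refl)) (*-identityˡ _)) (rotation-determinant i)

  rotate-pole : ∀ {n} (i : Fin n) c s j → rotate (inject₁ i) c s (δ (fromℕ (suc n))) j ≈ δ (fromℕ (suc n)) j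
  rotate-pole {suc n} zero    c s zero          = trans (+-cong (zeroʳ c) (-‿cong (zeroʳ s))) (-‿inverseʳ 0#)
  rotate-pole {suc n} zero    c s (suc zero)    = trans (+-cong (zeroʳ s) (zeroʳ c)) (+-identityʳ 0#)
  rotate-pole {suc n} zero    c s (suc (suc j)) = refl
  rotate-pole {suc n} (suc i) c s zero          = refl
  rotate-pole {suc n} (suc i) c s (suc j)       = rotate-pole i c s j

  reflection : Square 2
  reflection zero       zero       = - 1#
  reflection zero       (suc zero) = 0#
  reflection (suc zero) zero       = 0#
  reflection (suc zero) (suc zero) = 1#

  reflection-orthogonal : OrthogonalColumns reflection
  reflection-orthogonal zero       zero       = trans (+-cong (trans (sym (-‿distribˡ-* 1# (- 1#))) (trans (-‿cong (*-identityˡ (- 1#)))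
    (solve 1 (λ x → :- (:- x) := x) refl 1#))) 0*0+) (+-identityʳ 1#)
  reflection-orthogonal zero       (suc zero) = trans (+-cong (zeroʳ _) (trans (+-identityʳ _) (zeroˡ 1#))) (+-identityʳ 0#)
  reflection-orthogonal (suc zero) zero       = trans (+-cong (zeroˡ _) (trans (+-identityʳ _) (zeroʳ 1#))) (+-identityʳ 0#)
  reflection-orthogonal (suc zero) (suc zero) = trans 0*0+ (trans (+-identityʳ _) (*-identityˡ 1#))

  reflection-zero : ∀ (x : Fin 2 → Carrier) → sum (λ k → reflection zero k * x k) ≈ - x zero
  reflection-zero x = trans (+-cong (trans (sym (-‿distribˡ-* 1# (x zero))) (-‿cong (*-identityˡ (x zero))))
    (trans (+-identityʳ _) (zeroˡ (x (suc zero))))) (+-identityʳ _)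

  reflection-one : ∀ (x : Fin 2 → Carrier) → sum (λ k → reflection (suc zero) k * x k) ≈ x (suc zero)
  reflection-one x = trans (+-cong (zeroˡ (x zero)) (trans (+-identityʳ _) (*-identityˡ _))) (+-identityˡ _)

  reflection-pole : ∀ j → sum (λ k → reflection j k * δ (suc zero) k) ≈ δ (suc zero) j
  reflection-pole zero       = trans (reflection-zero (δ (suc zero))) (trans (sym (+-identityˡ _)) (-‿inverseʳ 0#))
  reflection-pole (suc zero) = reflection-one (δ (suc zero))

-- Evaluation of forms

module FormEvaluation (R : CommutativeRing 0ℓ 0ℓ)
                      (ι : ℚ.+-*-rawRing -Raw-AlmostCommutative⟶ fromCommutativeRing R) where

  open CommutativeRing R hiding (zero)
  open Algebra.Definitions.RawSemiring (Semiring.rawSemiring semiring) using (_^_; product)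
  open Relation.Binary.Reasoning.Setoid setoid
  open ℚAlgebra R ι
  open PlaneRotation R ι
  open BoxPolynomial R ι
  open Solver using (solve; _:=_; _:+_; _:*_)

  power-product : ∀ {n} → Vec ℕ n → (Fin n → Carrier) → Carrier
  power-product α x = product (λ i → x i ^ Vec.lookup α i)

  list-sum : ∀ {A : Set} → (A → Carrier) → List A → Carrier
  list-sum h = List.foldr (λ a s → h a + s) 0#

  form-value : ∀ {n} → ℕ → Coefficients n → (Fin n → Carrier) → Carrier
  form-value {n} d g x = list-sum (λ α → g α * power-product α x) (exponents n d)

  list-sum-++ : ∀ {A : Set} (h : A → Carrier) xs ys → list-sum h (xs List.++ ys) ≈ list-sum h xs + list-sum h ys
  list-sum-++ h []       ys = sym (+-identityˡ _)
  list-sum-++ h (x ∷ xs) ys = trans (+-congˡ (list-sum-++ h xs ys)) (sym (+-assoc _ _ _))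

  list-sum-concatMap : ∀ {A C : Set} (h : A → Carrier) (φ : C → List A) xs →
    list-sum h (List.concatMap φ xs) ≈ list-sum (λ c → list-sum h (φ c)) xs
  list-sum-concatMap h φ []       = refl
  list-sum-concatMap h φ (x ∷ xs) = trans (list-sum-++ h (φ x) (List.concatMap φ xs)) (+-congˡ (list-sum-concatMap h φ xs))

  list-sum-map : ∀ {A C : Set} (h : A → Carrier) (f : C → A) c {k} → (∀ a → h (f a) ≈ c * k a) →
    ∀ xs → list-sum h (List.map f xs) ≈ c * list-sum k xs
  list-sum-map h f c eq []       = sym (zeroʳ c)
  list-sum-map h f c eq (x ∷ xs) = trans (+-cong (eq x) (list-sum-map h f c eq xs)) (sym (distribˡ c _ _))

  list-sum-applyUpTo : ∀ {A : Set} N (h : A → Carrier) (φ : ℕ → A) (H : ℕ → Carrier) c x →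
    (∀ i → i ℕ.< N → h (φ i) ≈ c * (x ^ i * H i)) → list-sum h (List.applyUpTo φ N) ≈ c * series N H x
  list-sum-applyUpTo zero    h φ H c x eq = sym (zeroʳ c)
  list-sum-applyUpTo (suc N) h φ H c x eq = begin
    h (φ 0) + list-sum h (List.applyUpTo (φ ∘ suc) N)
      ≈⟨ +-cong (eq 0 (ℕ.s≤s ℕ.z≤n)) (list-sum-applyUpTo N h (φ ∘ suc) (H ∘ suc) (c * x) x (λ i i<N → trans (eq (suc i) (ℕ.s≤s i<N))
           (solve 4 (λ c x y h → c :* (x :* y :* h) := c :* x :* (y :* h)) refl c x (x ^ i) (H (suc i))))) ⟩
    c * (1# * H 0) + c * x * series N (H ∘ suc) x
      ≈⟨ +-congʳ (*-congˡ (*-identityˡ (H 0))) ⟩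
    c * H 0 + c * x * series N (H ∘ suc) x
      ≈⟨ solve 4 (λ c x h s → c :* h :+ c :* x :* s := c :* (h :+ x :* s)) refl c x (H 0) (series N (H ∘ suc) x) ⟩
    c * (H 0 + x * series N (H ∘ suc) x) ∎

  series-extend : ∀ N o H x → (∀ i → N ℕ.≤ i → H i ≈ 0#) → series (o ℕ.+ N) H x ≈ series N H x
  series-extend N zero    H x H₀ = refl
  series-extend N (suc o) H x H₀ = trans (series-grow (o ℕ.+ N) H x (H₀ (o ℕ.+ N) (ℕ.m≤n+m N o))) (series-extend N o H x H₀)

  form-value-box : ∀ {n} d o (g : Coefficients n) → (∀ α → Vec.sum α ≢ d → g α ≈ 0#) → ∀ x →
    form-value d g x ≈ box (o ℕ.+ suc d) g x
  form-value-box {zero} zero    o g g₀ x = trans (+-identityʳ _) (*-identityʳ _)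
  form-value-box {zero} (suc d) o g g₀ x = sym (g₀ [] λ ())
  form-value-box {suc n} d o g g₀ x = begin
    form-value d g x
      ≈⟨ list-sum-concatMap (λ α → g α * power-product α x) (λ i → List.map (i ∷_) (exponents n (d ℕ.∸ i))) (List.upTo (suc d)) ⟩
    list-sum (λ i → list-sum (λ α → g α * power-product α x) (List.map (i ∷_) (exponents n (d ℕ.∸ i)))) (List.upTo (suc d))
      ≈⟨ list-sum-applyUpTo (suc d) _ id K 1# (x zero) (λ i i≤d → trans (inner i i≤d) (sym (*-identityˡ _))) ⟩
    1# * series (suc d) K (x zero)
      ≈⟨ *-identityˡ _ ⟩
    series (suc d) K (x zero)
      ≈⟨ series-extend (suc d) o K (x zero) (λ i d<i → box-zero B (x ∘ suc) (λ β → g₀ (i ∷ β)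
           (λ eq → ℕ.<-irrefl ≡.refl (ℕ.≤-trans d<i (ℕ.≤-trans (ℕ.m≤m+n i (Vec.sum β)) (ℕ.≤-reflexive eq)))))) ⟨
    box B g x ∎
    where
    B = o ℕ.+ suc d
    K : ℕ → Carrier
    K i = box B (λ β → g (i ∷ β)) (x ∘ suc)
    inner : ∀ i → i ℕ.< suc d → list-sum (λ α → g α * power-product α x) (List.map (i ∷_) (exponents n (d ℕ.∸ i))) ≈ x zero ^ i * K i
    inner i (ℕ.s≤s i≤d) = begin
      list-sum (λ α → g α * power-product α x) (List.map (i ∷_) (exponents n (d ℕ.∸ i)))
        ≈⟨ list-sum-map (λ α → g α * power-product α x) (i ∷_) (x zero ^ i) {λ β → g (i ∷ β) * power-product β (x ∘ suc)}
             (λ β → solve 3 (λ g y p → g :* (y :* p) := y :* (g :* p)) refl (g (i ∷ β)) (x zero ^ i) (power-product β (x ∘ suc)))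
             (exponents n (d ℕ.∸ i)) ⟩
      x zero ^ i * form-value (d ℕ.∸ i) (λ β → g (i ∷ β)) (x ∘ suc)
        ≈⟨ *-congˡ (form-value-box (d ℕ.∸ i) (o ℕ.+ i) (λ β → g (i ∷ β)) (λ β sum≢ → g₀ (i ∷ β)
             (λ eq → sum≢ (≡.trans (≡.sym (ℕ.m+n∸m≡n i (Vec.sum β))) (≡.cong (ℕ._∸ i) eq)))) (x ∘ suc)) ⟩
      x zero ^ i * box (o ℕ.+ i ℕ.+ suc (d ℕ.∸ i)) (λ β → g (i ∷ β)) (x ∘ suc)
        ≈⟨ *-congˡ (reflexive (≡.cong (λ z → box z (λ β → g (i ∷ β)) (x ∘ suc)) bound)) ⟩
      x zero ^ i * K i ∎
      where
      bound : o ℕ.+ i ℕ.+ suc (d ℕ.∸ i) ≡ B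
      bound = ≡.trans (ℕ.+-assoc o i (suc (d ℕ.∸ i))) (≡.cong (o ℕ.+_)
        (≡.trans (ℕ.+-suc i (d ℕ.∸ i)) (≡.cong suc (ℕ.m+[n∸m]≡n i≤d))))

-- Second moments along a coordinate plane

module Moment (T R : CommutativeRing 0ℓ 0ℓ)
              (ιT : ℚ.+-*-rawRing -Raw-AlmostCommutative⟶ fromCommutativeRing T)
              (ιR : ℚ.+-*-rawRing -Raw-AlmostCommutative⟶ fromCommutativeRing R) where

  private
    module R where
      open CommutativeRing R public
      open ℚAlgebra R ιR public
      open ListPolynomial R ιR public
      open Algebra.Properties.Semiring.Exp semiring public using (_^_)
      open _-Raw-AlmostCommutative⟶_ ιR public using (0-homo; 1-homo)

  open CommutativeRing T hiding (zero)
  open Algebra.Properties.Semiring.Exp semiring using (_^_)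
  open Algebra.Properties.CommutativeSemiring.Exp commutativeSemiring using (^-distrib-*)
  open _-Raw-AlmostCommutative⟶_ ιT using (0-homo; 1-homo)
  open ℚAlgebra T ιT
  open ListPolynomial T ιT
  open PlaneRotation T ιT
  open Solver using (solve; _:=_; _:+_; _:*_; _:-_; :-_)

  module _ (a b : Carrier) where

    u v : List Carrier
    u = a ∷ [ 2 ] * b ∷ - a ∷ []
    v = b ∷ - ([ 2 ] * a) ∷ - b ∷ []

    rotated : ℕ → ℕ → Carrier
    rotated K t = (cosine t * a + sine t * b) ^ K * (cosine t * b - sine t * a)

    module _ (t : ℕ) where

      private
        M = [ 1 ] + [ t ] * [ t ]

        quadratic : ∀ x y z → eval (x ∷ y ∷ z ∷ []) [ t ] ≈ x + [ t ] * (y + [ t ] * z)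
        quadratic x y z = +-congˡ (*-congˡ (+-congˡ (*-congˡ (eval-singleton z [ t ]))))

        rescale : ∀ x → ⅟ (N t) * (M * x) ≈ x
        rescale = ⅟N t

      eval-u : eval u [ t ] ≈ M * (cosine t * a + sine t * b)
      eval-u = trans (quadratic a ([ 2 ] * b) (- a)) (trans (sym (rescale _))
        (solve 5 (λ i m t a b → i :* (m :* (a :+ t :* (num 2 :* b :+ t :* (:- a))))
                    := m :* (i :* (num 1 :- t :* t) :* a :+ i :* (num 2 :* t) :* b)) refl (⅟ (N t)) M [ t ] a b))

      eval-v : eval v [ t ] ≈ M * (cosine t * b - sine t * a)
      eval-v = trans (quadratic b (- ([ 2 ] * a)) (- b)) (trans (sym (rescale _))
        (solve 5 (λ i m t a b → i :* (m :* (b :+ t :* ((:- (num 2 :* a)) :+ t :* (:- b))))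
                    := m :* (i :* (num 1 :- t :* t) :* b :- i :* (num 2 :* t) :* a)) refl (⅟ (N t)) M [ t ] a b))

      eval-rotated : ∀ K → eval (power u K ⊗ v) [ t ] ≈ M ^ suc K * rotated K t
      eval-rotated K = trans (eval-⊗ (power u K) v [ t ]) (trans
        (*-cong (trans (eval-power u K [ t ]) (trans (power-cong K eval-u) (^-distrib-* M (cosine t * a + sine t * b) K))) eval-v)
        (solve 4 (λ x y m z → x :* y :* (m :* z) := m :* x :* (y :* z)) refl
          (M ^ K) ((cosine t * a + sine t * b) ^ K) M (cosine t * b - sine t * a)))
        where
        power-cong : ∀ K {x y} → x ≈ y → x ^ K ≈ y ^ K
        power-cong zero    x≈y = refl
        power-cong (suc K) x≈y = *-cong x≈y (power-cong K x≈y)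

    coeff₁-rotated : ∀ K → coeff (power u (suc K) ⊗ v) 1 + [ 2 ] * a ^ (2 ℕ.+ K) ≈ [ 2 ] * ([ suc K ] * (a ^ K * (b * b)))
    coeff₁-rotated K = trans (+-congʳ (trans (coeff₁-⊗ (power u (suc K)) v)
        (+-cong (*-congʳ (coeff₀-power u (suc K))) (*-congʳ (coeff₁-power u K)))))
      (solve 4 (λ a b x k → a :* x :* (:- (num 2 :* a)) :+ k :* (x :* (num 2 :* b)) :* b :+ num 2 :* (a :* (a :* x))
                  := num 2 :* (k :* (x :* (b :* b)))) refl a b (a ^ K) [ suc K ])

  module _ (E : Carrier → R.Carrier) (E-cong : ∀ {f g} → f ≈ g → E f R.≈ E g)
           (E-+ : ∀ f g → E (f + g) R.≈ E f R.+ E g) (E-[] : ∀ n f → E ([ n ] * f) R.≈ R.[ n ] R.* E f) where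

    open Relation.Binary.Reasoning.Setoid R.setoid

    E-zero : E 0# R.≈ R.0#
    E-zero = R.trans (E-cong (trans (sym (zeroˡ 0#)) (*-congʳ (sym 0-homo)))) (R.trans (E-[] 0 0#) (R.trans (R.*-congʳ R.0-homo) (R.zeroˡ _)))

    E-eval : ∀ p t → E (eval p [ t ]) R.≈ R.eval (List.map E p) R.[ t ]
    E-eval []      t = E-zero
    E-eval (c ∷ p) t = R.trans (E-+ c ([ t ] * eval p [ t ])) (R.+-congˡ (R.trans (E-[] t (eval p [ t ])) (R.*-congˡ (E-eval p t))))

    E-coeff : ∀ p i → R.coeff (List.map E p) i R.≈ E (coeff p i)
    E-coeff []      i       = R.sym E-zero
    E-coeff (c ∷ p) zero    = R.refl
    E-coeff (c ∷ p) (suc i) = E-coeff p i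

    circle : List R.Carrier
    circle = R.1# ∷ R.0# ∷ R.1# ∷ []

    eval-circle : ∀ t → R.eval circle R.[ t ] R.≈ R.[ 1 ] R.+ R.[ t ] R.* R.[ t ]
    eval-circle t = R.+-cong (R.sym R.1-homo) (R.*-congˡ (R.trans (R.+-identityˡ _)
      (R.trans (R.*-congˡ (R.trans (R.+-congˡ (R.zeroʳ _)) (R.+-identityʳ _))) (R.*-identityʳ _))))

    E-circle : ∀ t K f → E (([ 1 ] + [ t ] * [ t ]) ^ K * f) R.≈ R.eval (R.power circle K) R.[ t ] R.* E f
    E-circle t zero    f = R.trans (E-cong (*-identityˡ f)) (R.trans (R.sym (R.*-identityˡ _))
      (R.*-congʳ (R.sym (R.trans (R.+-congˡ (R.zeroʳ _)) (R.+-identityʳ _)))))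
    E-circle t (suc K) f = begin
      E (([ 1 ] + [ t ] * [ t ]) * y * f)
        ≈⟨ E-cong (solve 3 (λ t y f → (num 1 :+ t :* t) :* y :* f := num 1 :* (y :* f) :+ t :* (t :* (y :* f))) refl [ t ] y f) ⟩
      E ([ 1 ] * (y * f) + [ t ] * ([ t ] * (y * f)))
        ≈⟨ R.trans (E-+ _ _) (R.+-cong (E-[] 1 (y * f)) (R.trans (E-[] t ([ t ] * (y * f))) (R.*-congˡ (E-[] t (y * f))))) ⟩
      R.[ 1 ] R.* E (y * f) R.+ R.[ t ] R.* (R.[ t ] R.* E (y * f))
        ≈⟨ R.trans (R.+-congˡ (R.sym (R.*-assoc _ _ _))) (R.sym (R.distribʳ _ _ _)) ⟩
      (R.[ 1 ] R.+ R.[ t ] R.* R.[ t ]) R.* E (y * f)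
        ≈⟨ R.*-cong (R.sym (eval-circle t)) (E-circle t K f) ⟩
      R.eval circle R.[ t ] R.* (R.eval (R.power circle K) R.[ t ] R.* E f)
        ≈⟨ R.trans (R.sym (R.*-assoc _ _ _)) (R.*-congʳ (R.sym (R.eval-⊗ circle (R.power circle K) R.[ t ]))) ⟩
      R.eval (R.power circle (suc K)) R.[ t ] R.* E f ∎
      where
      y = ([ 1 ] + [ t ] * [ t ]) ^ K

    moment : ∀ a b K → (∀ t → E (rotated a b (suc K) t) R.≈ E (a ^ suc K * b)) →
      R.[ suc K ] R.* E (a ^ K * (b * b)) R.≈ E (a ^ (2 ℕ.+ K))
    moment a b K invariant = R.[]-cancel 2 (begin
      R.[ 2 ] R.* (R.[ suc K ] R.* E (a ^ K * (b * b)))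
        ≈⟨ R.trans (E-[] 2 _) (R.*-congˡ (E-[] (suc K) _)) ⟨
      E ([ 2 ] * ([ suc K ] * (a ^ K * (b * b))))
        ≈⟨ E-cong (coeff₁-rotated a b K) ⟨
      E (coeff p 1 + [ 2 ] * a ^ (2 ℕ.+ K))
        ≈⟨ R.trans (E-+ _ _) (R.+-cong vanishes (E-[] 2 _)) ⟩
      R.0# R.+ R.[ 2 ] R.* E (a ^ (2 ℕ.+ K))
        ≈⟨ R.+-identityˡ _ ⟩
      R.[ 2 ] R.* E (a ^ (2 ℕ.+ K)) ∎)
      where
      p = power (u a b) (suc K) ⊗ v a b
      F = E (a ^ suc K * b)
      q = List.map (F R.*_) (R.power circle (2 ℕ.+ K))
      vanishes : E (coeff p 1) R.≈ R.0#
      vanishes = begin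
        E (coeff p 1)  ≈⟨ E-coeff p 1 ⟨
        R.coeff (List.map E p) 1  ≈⟨ R.coeff-unique (List.map E p) q (λ t → begin
          R.eval (List.map E p) R.[ t ]  ≈⟨ E-eval p t ⟨
          E (eval p [ t ])  ≈⟨ E-cong (eval-rotated a b t (suc K)) ⟩
          E (([ 1 ] + [ t ] * [ t ]) ^ (2 ℕ.+ K) * rotated a b (suc K) t)
                                                          ≈⟨ E-circle t (2 ℕ.+ K) (rotated a b (suc K) t) ⟩
          R.eval (R.power circle (2 ℕ.+ K)) R.[ t ] R.* E (rotated a b (suc K) t)
                                                          ≈⟨ R.trans (R.*-congˡ (invariant t)) (R.*-comm _ _) ⟩
          F R.* R.eval (R.power circle (2 ℕ.+ K)) R.[ t ] ≈⟨ R.eval-scale F (R.power circle (2 ℕ.+ K)) R.[ t ] ⟨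
          R.eval q R.[ t ] ∎) 1 ⟩
        R.coeff q 1  ≈⟨ R.coeff-scale F (R.power circle (2 ℕ.+ K)) 1 ⟩
        F R.* R.coeff (R.power circle (2 ℕ.+ K)) 1  ≈⟨ R.*-congˡ (R.trans (R.coeff₁-power circle (suc K)) (R.trans (R.*-congˡ (R.zeroʳ _)) (R.zeroʳ _))) ⟩
        F R.* R.0#  ≈⟨ R.zeroʳ F ⟩
        R.0#  ∎


-- Symmetric harmonic polynomials

module SymmetricHarmonic (R : CommutativeRing 0ℓ 0ℓ)
                         (ι : ℚ.+-*-rawRing -Raw-AlmostCommutative⟶ fromCommutativeRing R) (m : ℕ) where

  open CommutativeRing R hiding (zero)
  open Algebra.Properties.Semiring.Exp semiring using (_^_)
  open Algebra.Properties.Semiring.Sum semiring using (sum; sum-cong-≋; *-distribʳ-sum)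
  open Relation.Binary.Reasoning.Setoid setoid
  open _-Raw-AlmostCommutative⟶_ ι using (0-homo; 1-homo)
  open ℚAlgebra R ι
  open ListPolynomial R ι
  open PlaneRotation R ι
  open BoxPolynomial R ι
  open ZonalExpansion R ι m
  open Solver using (solve; _:=_; _:+_; _:*_; _:-_; :-_)

  laplacian : ∀ {n} → Coefficients n → Coefficients n
  laplacian f β = sum (λ j → [ (Vec.lookup β j ℕ.+ 2) ℕ.* (Vec.lookup β j ℕ.+ 1) ] * f (raise j β))

  multiply : ∀ {n} → Fin n → Coefficients n → Coefficients n
  multiply zero    h (zero ∷ β)        = 0#
  multiply zero    h (suc zero ∷ β)    = 0#
  multiply zero    h (suc (suc p) ∷ β) = h (p ∷ β)
  multiply (suc j) h (p ∷ β)           = multiply j (λ β → h (p ∷ β)) β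

  box-multiply : ∀ {n B} (j : Fin n) {h : Coefficients n} → Bounded B h → ∀ x →
    box (2 ℕ.+ B) (multiply j h) x ≈ x j * x j * box (2 ℕ.+ B) h x
  box-multiply {suc n} {B} zero {h} h₀ x = begin
    box (2 ℕ.+ B) (λ _ → 0#) x′ + x₀ * (box (2 ℕ.+ B) (λ _ → 0#) x′ + x₀ * series B K x₀)
      ≈⟨ +-cong null (*-congˡ (trans (+-congʳ null) (+-identityˡ _))) ⟩
    0# + x₀ * (x₀ * series B K x₀)
      ≈⟨ trans (+-identityˡ _) (sym (*-assoc _ _ _)) ⟩
    x₀ * x₀ * series B K x₀
      ≈⟨ *-congˡ (trans (series-grow (suc B) K x₀ (K₀ (suc B) (ℕ.n≤1+n B))) (series-grow B K x₀ (K₀ B ℕ.≤-refl))) ⟨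
    x₀ * x₀ * series (2 ℕ.+ B) K x₀ ∎
    where
    x₀ = x zero
    x′ = x ∘ suc
    K : ℕ → Carrier
    K p = box (2 ℕ.+ B) (λ β → h (p ∷ β)) x′
    K₀ : ∀ p → B ℕ.≤ p → K p ≈ 0#
    K₀ p B≤p = box-zero (2 ℕ.+ B) x′ (section-vanishes h₀ p B≤p)
    null : box (2 ℕ.+ B) (λ _ → 0#) x′ ≈ 0#
    null = box-zero (2 ℕ.+ B) x′ (λ _ → refl)
  box-multiply {suc n} {B} (suc j) {h} h₀ x = trans
    (series-cong (2 ℕ.+ B) (λ p _ → box-multiply j (section-bounded h₀ p) (x ∘ suc)) refl)
    (series-* (2 ℕ.+ B) (x (suc j) * x (suc j)) (λ p → box (2 ℕ.+ B) (λ β → h (p ∷ β)) (x ∘ suc)) (x zero))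

  multiply-raise : ∀ {n} (j : Fin n) (h : Coefficients n) γ → multiply j h (raise j γ) ≈ h γ
  multiply-raise zero    h (p ∷ β) rewrite ℕ.+-comm p 2 = refl
  multiply-raise (suc j) h (p ∷ β) = multiply-raise j (λ β → h (p ∷ β)) β

  lookup-raise : ∀ {n} (j : Fin n) γ → Vec.lookup (raise j γ) j ≡ Vec.lookup γ j ℕ.+ 2
  lookup-raise zero    (p ∷ β) = ≡.refl
  lookup-raise (suc j) (p ∷ β) = lookup-raise j β

  sum-raise : ∀ {n} (j : Fin n) γ → Vec.sum (raise j γ) ≡ 2 ℕ.+ Vec.sum γ
  sum-raise zero    (p ∷ β) = ≡.cong (ℕ._+ Vec.sum β) (ℕ.+-comm p 2)
  sum-raise (suc j) (p ∷ β) = ≡.trans (≡.cong (p ℕ.+_) (sum-raise j β)) (≡.trans (ℕ.+-suc p _) (≡.cong suc (ℕ.+-suc p _)))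

  data RaiseView {n} (j : Fin n) (γ : Vec ℕ n) : Set where
    none   : (∀ h → multiply j h γ ≈ 0#) → Vec.lookup γ j ≡ 0 → RaiseView j γ
    one    : (∀ h → multiply j h γ ≈ 0#) → Vec.lookup γ j ≡ 1 → RaiseView j γ
    above : ∀ δ → raise j δ ≡ γ → RaiseView j γ

  raiseView : ∀ {n} (j : Fin n) γ → RaiseView j γ
  raiseView zero    (zero ∷ β)        = none (λ _ → refl) ≡.refl
  raiseView zero    (suc zero ∷ β)    = one (λ _ → refl) ≡.refl
  raiseView zero    (suc (suc p) ∷ β) = above (p ∷ β) (≡.cong (_∷ β) (ℕ.+-comm p 2))
  raiseView (suc j) (p ∷ β) with raiseView j β
  ... | none z eq    = none (λ h → z (λ β → h (p ∷ β))) eq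
  ... | one z eq     = one (λ h → z (λ β → h (p ∷ β))) eq
  ... | above δ eq  = above (p ∷ δ) (≡.cong (p ∷_) eq)

  sum-lookup : ∀ {n} (γ : Vec ℕ n) → sum (λ j → [ Vec.lookup γ j ]) ≈ [ Vec.sum γ ]
  sum-lookup []      = sym 0-homo
  sum-lookup (p ∷ β) = trans (+-congˡ (sum-lookup β)) (sym ([]-+ p (Vec.sum β)))

  sum-lookup+1 : ∀ {n} (γ : Vec ℕ n) → sum (λ j → [ Vec.lookup γ j ℕ.+ 1 ]) ≈ [ Vec.sum γ ] + [ n ]
  sum-lookup+1 [] = trans (sym 0-homo) (trans (sym (+-identityʳ _)) (+-congˡ (sym 0-homo)))
  sum-lookup+1 {suc n} (p ∷ β) = begin
    [ p ℕ.+ 1 ] + sum (λ j → [ Vec.lookup β j ℕ.+ 1 ])  ≈⟨ +-cong ([]-+ p 1) (sum-lookup+1 β) ⟩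
    [ p ] + [ 1 ] + ([ Vec.sum β ] + [ n ])
      ≈⟨ solve 4 (λ p i s n → p :+ i :+ (s :+ n) := p :+ s :+ (i :+ n)) refl [ p ] [ 1 ] [ Vec.sum β ] [ n ] ⟩
    [ p ] + [ Vec.sum β ] + ([ 1 ] + [ n ])  ≈⟨ +-cong ([]-+ p (Vec.sum β)) ([]-+ 1 n) ⟨
    [ p ℕ.+ Vec.sum β ] + [ suc n ]  ∎

  -- On rotation-invariant polynomials the Laplacian times the squared norm
  -- acts on each homogeneous component as a scalar (the Casimir operator).
  module Casimir {f : Coefficients (suc m)} (symmetric : Symmetric f) where
    open Symmetric symmetric

    laplacian-symmetric : ∀ j γ → laplacian f γ ≈ ([ Vec.sum γ ] + [ suc m ]) * ([ Vec.lookup γ j ℕ.+ 2 ] * f (raise j γ))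
    laplacian-symmetric j γ = begin
      sum (λ i → [ (Vec.lookup γ i ℕ.+ 2) ℕ.* (Vec.lookup γ i ℕ.+ 1) ] * f (raise i γ))
        ≈⟨ sum-cong-≋ (λ i → begin
             [ (Vec.lookup γ i ℕ.+ 2) ℕ.* (Vec.lookup γ i ℕ.+ 1) ] * f (raise i γ)
               ≈⟨ *-congʳ ([]-* (Vec.lookup γ i ℕ.+ 2) (Vec.lookup γ i ℕ.+ 1)) ⟩
             [ Vec.lookup γ i ℕ.+ 2 ] * [ Vec.lookup γ i ℕ.+ 1 ] * f (raise i γ)
               ≈⟨ solve 3 (λ a b c → a :* b :* c := b :* (a :* c)) refl [ Vec.lookup γ i ℕ.+ 2 ] [ Vec.lookup γ i ℕ.+ 1 ] (f (raise i γ)) ⟩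
             [ Vec.lookup γ i ℕ.+ 1 ] * ([ Vec.lookup γ i ℕ.+ 2 ] * f (raise i γ))
               ≈⟨ *-congˡ (trans (exchange i γ) (sym (exchange j γ))) ⟩
             [ Vec.lookup γ i ℕ.+ 1 ] * Y ∎) ⟩
      sum (λ i → [ Vec.lookup γ i ℕ.+ 1 ] * Y)
        ≈⟨ *-distribʳ-sum Y (λ i → [ Vec.lookup γ i ℕ.+ 1 ]) ⟨
      sum (λ i → [ Vec.lookup γ i ℕ.+ 1 ]) * Y
        ≈⟨ *-congʳ (sum-lookup+1 γ) ⟩
      ([ Vec.sum γ ] + [ suc m ]) * Y ∎
      where
      Y = [ Vec.lookup γ j ℕ.+ 2 ] * f (raise j γ)

    eigenvalue : ℕ → Carrier
    eigenvalue D = [ D ] + [ m ] - [ 1 ]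

    multiply-laplacian : ∀ γ j → multiply j (laplacian f) γ ≈ [ Vec.lookup γ j ] * (eigenvalue (Vec.sum γ) * f γ)
    multiply-laplacian γ j with raiseView j γ
    ... | none z eq = trans (z (laplacian f)) (sym (trans (*-congʳ (trans ([]-cong eq) 0-homo)) (zeroˡ _)))
    ... | one z eq  = trans (z (laplacian f)) (sym (trans
      (*-congˡ (trans (*-congˡ (even j γ (≡.subst Odd (≡.sym eq) tt))) (zeroʳ _))) (zeroʳ _)))
    ... | above δ ≡.refl = begin
      multiply j (laplacian f) (raise j δ)
        ≈⟨ multiply-raise j (laplacian f) δ ⟩
      laplacian f δ
        ≈⟨ laplacian-symmetric j δ ⟩
      ([ Vec.sum δ ] + [ suc m ]) * ([ Vec.lookup δ j ℕ.+ 2 ] * f (raise j δ))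
        ≈⟨ *-cong (+-congˡ ([]-+ 1 m)) (*-congʳ ([]-cong (≡.sym (lookup-raise j δ)))) ⟩
      ([ Vec.sum δ ] + ([ 1 ] + [ m ])) * ([ Vec.lookup (raise j δ) j ] * f (raise j δ))
        ≈⟨ solve 4 (λ s m l y → (s :+ (num 1 :+ m)) :* (l :* y) := l :* ((num 2 :+ s :+ m :- num 1) :* y)) refl
             [ Vec.sum δ ] [ m ] [ Vec.lookup (raise j δ) j ] (f (raise j δ)) ⟩
      [ Vec.lookup (raise j δ) j ] * (([ 2 ] + [ Vec.sum δ ] + [ m ] - [ 1 ]) * f (raise j δ))
        ≈⟨ *-congˡ (*-congʳ (+-congʳ (+-congʳ (trans ([]-cong (sum-raise j δ)) ([]-+ 2 (Vec.sum δ)))))) ⟨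
      [ Vec.lookup (raise j δ) j ] * (eigenvalue (Vec.sum (raise j δ)) * f (raise j δ)) ∎

    multiply-laplacian-sum : ∀ γ → sum (λ j → multiply j (laplacian f) γ) ≈ [ Vec.sum γ ] * (eigenvalue (Vec.sum γ) * f γ)
    multiply-laplacian-sum γ = begin
      sum (λ j → multiply j (laplacian f) γ)  ≈⟨ sum-cong-≋ (multiply-laplacian γ) ⟩
      sum (λ j → [ Vec.lookup γ j ] * (eigenvalue (Vec.sum γ) * f γ)) ≈⟨ *-distribʳ-sum (eigenvalue (Vec.sum γ) * f γ) (λ j → [ Vec.lookup γ j ]) ⟨
      sum (λ j → [ Vec.lookup γ j ]) * (eigenvalue (Vec.sum γ) * f γ) ≈⟨ *-congʳ (sum-lookup γ) ⟩
      [ Vec.sum γ ] * (eigenvalue (Vec.sum γ) * f γ)  ∎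

    casimir : ∀ {B} D → (∀ γ → Vec.sum γ ≢ D → f γ ≈ 0#) → Bounded B (laplacian f) → ∀ x →
      [ D ] * eigenvalue D * box (2 ℕ.+ B) f x ≈ sum (λ j → x j * x j) * box (2 ℕ.+ B) (laplacian f) x
    casimir {B} D homogeneous bounded x = begin
      [ D ] * eigenvalue D * box (2 ℕ.+ B) f x
        ≈⟨ box-* (2 ℕ.+ B) ([ D ] * eigenvalue D) f x ⟨
      box (2 ℕ.+ B) (λ γ → [ D ] * eigenvalue D * f γ) x
        ≈⟨ box-cong (2 ℕ.+ B) {x = x} {y = x} scalar (λ _ → refl) ⟩
      box (2 ℕ.+ B) (λ γ → sum (λ j → multiply j (laplacian f) γ)) x
        ≈⟨ box-sum (2 ℕ.+ B) (λ j → multiply j (laplacian f)) x ⟩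
      sum (λ j → box (2 ℕ.+ B) (multiply j (laplacian f)) x)
        ≈⟨ sum-cong-≋ (λ j → box-multiply j bounded x) ⟩
      sum (λ j → x j * x j * box (2 ℕ.+ B) (laplacian f) x)
        ≈⟨ *-distribʳ-sum (box (2 ℕ.+ B) (laplacian f) x) (λ j → x j * x j) ⟨
      sum (λ j → x j * x j) * box (2 ℕ.+ B) (laplacian f) x ∎
      where
      scalar : ∀ γ → [ D ] * eigenvalue D * f γ ≈ sum (λ j → multiply j (laplacian f) γ)
      scalar γ with Vec.sum γ ℕ.≟ D
      ... | yes ≡.refl = trans (*-assoc _ _ _) (sym (multiply-laplacian-sum γ))
      ... | no  sum≢D  = trans (trans (*-congˡ (homogeneous γ sum≢D)) (zeroʳ _))
        (sym (trans (multiply-laplacian-sum γ) (trans (*-congˡ (trans (*-congˡ (homogeneous γ sum≢D)) (zeroʳ _))) (zeroʳ _))))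

  series-comm : ∀ A B (H : ℕ → ℕ → Carrier) x y →
    series A (λ p → series B (H p) y) x ≈ series B (λ k → series A (λ p → H p k) x) y
  series-comm zero    B H x y = sym (series-zero B y (λ _ → refl))
  series-comm (suc A) B H x y = begin
    series B (H 0) y + x * series A (λ p → series B (H (suc p)) y) x
      ≈⟨ +-congˡ (trans (*-congˡ (series-comm A B (H ∘ suc) x y)) (sym (series-* B x (λ k → series A (λ p → H (suc p) k) x) y))) ⟩
    series B (H 0) y + series B (λ k → x * series A (λ p → H (suc p) k) x) y
      ≈⟨ series-+ B (H 0) (λ k → x * series A (λ p → H (suc p) k) x) y ⟨
    series B (λ k → H 0 k + x * series A (λ p → H (suc p) k) x) y ∎

  box-last : ∀ {n} B (g : Coefficients (suc n)) x →
    box B g x ≈ series B (λ k → box B (λ β → g (β Vec.∷ʳ k)) (x ∘ inject₁)) (x (fromℕ n))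
  box-last {zero}  B g x = refl
  box-last {suc n} B g x = trans
    (series-cong B (λ p _ → box-last B (λ β → g (p ∷ β)) (x ∘ suc)) refl)
    (series-comm B B (λ p k → box B (λ β → g (p ∷ (β Vec.∷ʳ k))) (x ∘ suc ∘ inject₁)) (x zero) (x (suc (fromℕ n))))

  sum-∷ʳ : ∀ {n} (β : Vec ℕ n) k → Vec.sum (β Vec.∷ʳ k) ≡ Vec.sum β ℕ.+ k
  sum-∷ʳ []      k = ℕ.+-identityʳ k
  sum-∷ʳ (p ∷ β) k = ≡.trans (≡.cong (p ℕ.+_) (sum-∷ʳ β k)) (≡.sym (ℕ.+-assoc p (Vec.sum β) k))

  series-snoc : ∀ B H x → series (suc B) H x ≈ series B H x + H B * x ^ B
  series-snoc zero    H x = trans (+-cong (sym (*-identityʳ _)) (zeroʳ x)) (+-comm _ _)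
  series-snoc (suc B) H x = trans (+-congˡ (*-congˡ (series-snoc B (H ∘ suc) x)))
    (solve 5 (λ a x s h y → a :+ x :* (s :+ h :* y) := a :+ x :* s :+ h :* (x :* y)) refl
       (H 0) x (series B (H ∘ suc) x) (H (suc B)) (x ^ B))

  series-parts : ∀ d H x → (∀ k D → k ℕ.+ D ≡ d → Odd D → H k ≈ 0#) → series (suc d) H x ≈ parts d (λ k s → H k * x ^ k)
  series-parts zero          H x odd = trans (series-snoc 0 H x) (+-identityˡ _)
  series-parts (suc zero)    H x odd = trans (series-snoc 1 H x)
    (trans (+-congʳ (trans (+-cong (odd 0 1 ≡.refl tt) (zeroʳ x)) (+-identityʳ 0#))) (+-identityˡ _))
  series-parts (suc (suc d)) H x odd = begin
    series (3 ℕ.+ d) H x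
      ≈⟨ trans (series-snoc (2 ℕ.+ d) H x) (+-congʳ (series-grow (suc d) H x (odd (suc d) 1 (ℕ.+-comm (suc d) 1) tt))) ⟩
    series (suc d) H x + H (2 ℕ.+ d) * x ^ (2 ℕ.+ d)
      ≈⟨ +-congʳ (series-parts d H x (λ k D eq o → odd k (2 ℕ.+ D)
           (≡.trans (ℕ.+-suc k (suc D)) (≡.cong suc (≡.trans (ℕ.+-suc k D) (≡.cong suc eq)))) o)) ⟩
    parts d (λ k s → H k * x ^ k) + H (2 ℕ.+ d) * x ^ (2 ℕ.+ d)
      ≈⟨ +-comm _ _ ⟩
    H (2 ℕ.+ d) * x ^ (2 ℕ.+ d) + parts d (λ k s → H k * x ^ k) ∎

  box-constant : ∀ {n} B (h : Coefficients n) → (∀ β → Vec.sum β ≢ 0 → h β ≈ 0#) → ∀ x → box (suc B) h x ≈ h (Vec.replicate n 0)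
  box-constant {zero}  B h h₀ x = refl
  box-constant {suc n} B h h₀ x = begin
    box (suc B) (λ β → h (0 ∷ β)) (x ∘ suc) + x zero * series B (λ p → box (suc B) (λ β → h (suc p ∷ β)) (x ∘ suc)) (x zero)
      ≈⟨ +-cong (box-constant B (λ β → h (0 ∷ β)) (λ β → h₀ (0 ∷ β)) (x ∘ suc))
                (trans (*-congˡ (series-zero B (x zero) (λ p → box-zero (suc B) (x ∘ suc) (λ β → h₀ (suc p ∷ β) λ ())))) (zeroʳ _)) ⟩
    h (0 ∷ Vec.replicate n 0) + 0#
      ≈⟨ +-identityʳ _ ⟩
    h (0 ∷ Vec.replicate n 0) ∎

  module ZonalForm (d : ℕ) (g : Coefficients (2 ℕ.+ m)) (homogeneous : ∀ α → Vec.sum α ≢ d → g α ≈ 0#)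
                   (symmetric : ∀ k → Symmetric (λ β → g (β Vec.∷ʳ k)))
                   (harmonic : ∀ k β → laplacian (λ β → g (β Vec.∷ʳ k)) β + [ (k ℕ.+ 2) ℕ.* (k ℕ.+ 1) ] * g (β Vec.∷ʳ (k ℕ.+ 2)) ≈ 0#)
                   where

    f : ℕ → Coefficients (suc m)
    f k β = g (β Vec.∷ʳ k)

    f-vanishes : ∀ k β → Vec.sum β ℕ.+ k ≢ d → f k β ≈ 0#
    f-vanishes k β sum≢d = homogeneous (β Vec.∷ʳ k) (λ eq → sum≢d (≡.trans (≡.sym (sum-∷ʳ β k)) eq))

    c₀ : Carrier
    c₀ = f d (Vec.replicate (suc m) 0)

    B : ℕ
    B = 3 ℕ.+ d

    laplacian-bounded : ∀ k → Bounded (suc d) (laplacian (f k))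
    laplacian-bounded k β d< = begin
      sum (λ j → [ (Vec.lookup β j ℕ.+ 2) ℕ.* (Vec.lookup β j ℕ.+ 1) ] * f k (raise j β))
        ≈⟨ sum-cong-≋ vanishes ⟩
      sum {suc m} (λ j → 0# * 0#)
        ≈⟨ *-distribʳ-sum {suc m} 0# (λ _ → 0#) ⟨
      sum {suc m} (λ _ → 0#) * 0#
        ≈⟨ zeroʳ _ ⟩
      0# ∎
      where
      vanishes : ∀ j → [ (Vec.lookup β j ℕ.+ 2) ℕ.* (Vec.lookup β j ℕ.+ 1) ] * f k (raise j β) ≈ 0# * 0#
      large : ∀ j → Vec.sum (raise j β) ℕ.+ k ≢ d
      large j eq = ℕ.<-irrefl ≡.refl (ℕ.≤-trans d< (ℕ.≤-trans (ℕ.m≤n+m (Vec.sum β) 2)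
        (ℕ.≤-trans (ℕ.≤-reflexive (≡.sym (sum-raise j β))) (ℕ.≤-trans (ℕ.m≤m+n _ k) (ℕ.≤-reflexive eq)))))
      vanishes j = trans (*-congˡ (f-vanishes k (raise j β) (large j))) (trans (zeroʳ _) (sym (zeroˡ 0#)))

    module _ (x : Fin (2 ℕ.+ m) → Carrier) where

      private
        x′ : Fin (suc m) → Carrier
        x′ = x ∘ inject₁

        u v : Carrier
        u = x (fromℕ (suc m))
        v = sum (λ j → x′ j * x′ j)

      F : ℕ → Carrier
      F k = box B (f k) x′

      F-odd : ∀ k D → k ℕ.+ D ≡ d → Odd D → F k ≈ 0#
      F-odd k D k+D≡d odd-D = box-zero B x′ λ β → cases β (Vec.sum β ℕ.≟ D)
        where
        cases : ∀ β → Dec (Vec.sum β ≡ D) → f k β ≈ 0#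
        cases β (yes ≡.refl) = let j , odd-j = Odd-sum β odd-D in Symmetric.even (symmetric k) j β odd-j
        cases β (no  sum≢D)  = f-vanishes k β (λ eq → sum≢D
          (ℕ.+-cancelˡ-≡ k _ _ (≡.trans (ℕ.+-comm k (Vec.sum β)) (≡.trans eq (≡.sym k+D≡d)))))

      F-step : ∀ k D → k ℕ.+ D ≡ d → [ D ] * ([ D ] + [ m ] - [ 1 ]) * F k ≈ - ([ k ℕ.+ 2 ] * [ k ℕ.+ 1 ] * (v * F (k ℕ.+ 2)))
      F-step k D k+D≡d = begin
        [ D ] * ([ D ] + [ m ] - [ 1 ]) * F k
          ≈⟨ Casimir.casimir (symmetric k) {suc d} D
               (λ β sum≢D → f-vanishes k β (λ eq → sum≢D (ℕ.+-cancelˡ-≡ k _ _ (≡.trans (ℕ.+-comm k (Vec.sum β)) (≡.trans eq (≡.sym k+D≡d))))))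
               (laplacian-bounded k) x′ ⟩
        v * box B (laplacian (f k)) x′
          ≈⟨ *-congˡ (box-cong B {x = x′} {y = x′} (λ β → begin
               laplacian (f k) β
                 ≈⟨ solve 2 (λ l y → l := l :+ y :+ (:- num 1) :* y) refl (laplacian (f k) β) (K * f (k ℕ.+ 2) β) ⟩
               laplacian (f k) β + K * f (k ℕ.+ 2) β + - [ 1 ] * (K * f (k ℕ.+ 2) β)
                 ≈⟨ trans (+-congʳ (harmonic k β)) (+-identityˡ _) ⟩
               - [ 1 ] * (K * f (k ℕ.+ 2) β)
                 ≈⟨ *-assoc _ _ _ ⟨
               - [ 1 ] * K * f (k ℕ.+ 2) β ∎) (λ _ → refl)) ⟩
        v * box B (λ β → - [ 1 ] * K * f (k ℕ.+ 2) β) x′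
          ≈⟨ *-congˡ (trans (box-* B (- [ 1 ] * K) (f (k ℕ.+ 2)) x′) (*-congʳ (*-congˡ ([]-* (k ℕ.+ 2) (k ℕ.+ 1))))) ⟩
        v * (- [ 1 ] * ([ k ℕ.+ 2 ] * [ k ℕ.+ 1 ]) * F (k ℕ.+ 2))
          ≈⟨ solve 3 (λ v k y → v :* ((:- num 1) :* k :* y) := :- (k :* (v :* y))) refl v ([ k ℕ.+ 2 ] * [ k ℕ.+ 1 ]) (F (k ℕ.+ 2)) ⟩
        - ([ k ℕ.+ 2 ] * [ k ℕ.+ 1 ] * (v * F (k ℕ.+ 2))) ∎
        where
        K = [ (k ℕ.+ 2) ℕ.* (k ℕ.+ 1) ]

      F-even : ∀ s k → k ℕ.+ 2 ℕ.* s ≡ d → F k ≈ c₀ * (zonal d s * v ^ s)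
      F-even zero k eq = begin
        F k  ≈⟨ reflexive (≡.cong F k≡d) ⟩
        F d  ≈⟨ box-constant (2 ℕ.+ d) (f d) (λ β sum≢0 → f-vanishes d β (λ eq → sum≢0 (ℕ.+-cancelʳ-≡ d _ 0 eq))) x′ ⟩
        c₀  ≈⟨ *-identityʳ c₀ ⟨
        c₀ * 1#  ≈⟨ *-congˡ (trans (*-identityʳ _) (trans (*-identityˡ _) 1-homo)) ⟨
        c₀ * (1# * [ 1 ] * 1#)  ∎
        where
        k≡d : k ≡ d
        k≡d = ≡.trans (≡.sym (ℕ.+-identityʳ k)) eq
      F-even (suc s) k eq = []-cancel (suc (suc (2 ℕ.* s)) ℕ.* suc (2 ℕ.* s ℕ.+ m)) (begin
        [ suc (suc (2 ℕ.* s)) ℕ.* suc (2 ℕ.* s ℕ.+ m) ] * F k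
          ≈⟨ *-congʳ (trans ([]-* (suc (suc (2 ℕ.* s))) (suc (2 ℕ.* s ℕ.+ m))) (*-cong ([]-cong (≡.sym (2*suc s))) third)) ⟩
        [ D ] * ([ D ] + [ m ] - [ 1 ]) * F k
          ≈⟨ F-step k D eq ⟩
        - ([ k ℕ.+ 2 ] * [ k ℕ.+ 1 ] * (v * F (k ℕ.+ 2)))
          ≈⟨ -‿cong (*-congˡ (*-congˡ (F-even s (k ℕ.+ 2) index))) ⟩
        - ([ k ℕ.+ 2 ] * [ k ℕ.+ 1 ] * (v * (c₀ * (zonal d s * v ^ s))))
          ≈⟨ solve 6 (λ a b v c z y → :- (a :* b :* (v :* (c :* (z :* y)))) := c :* ((:- (a :* b :* z)) :* (v :* y))) refl
               [ k ℕ.+ 2 ] [ k ℕ.+ 1 ] v c₀ (zonal d s) (v ^ s) ⟩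
        c₀ * (- ([ k ℕ.+ 2 ] * [ k ℕ.+ 1 ] * zonal d s) * (v * v ^ s))
          ≈⟨ *-congˡ (*-congʳ (-‿cong (*-congʳ (*-cong k+2 k+1)))) ⟩
        c₀ * (- (([ d ] - [ 2 ℕ.* s ]) * ([ d ] - [ 2 ℕ.* s ] - [ 1 ]) * zonal d s) * (v * v ^ s))
          ≈⟨ *-congˡ (*-congʳ (zonal-suc d s)) ⟨
        c₀ * (([ 2 ] * [ s ] + [ 2 ]) * ([ 2 ] * [ s ] + [ m ] + [ 1 ]) * zonal d (suc s) * (v * v ^ s))
          ≈⟨ solve 4 (λ c a z y → c :* (a :* z :* y) := a :* (c :* (z :* y))) refl
               c₀ (([ 2 ] * [ s ] + [ 2 ]) * ([ 2 ] * [ s ] + [ m ] + [ 1 ])) (zonal d (suc s)) (v * v ^ s) ⟩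
        ([ 2 ] * [ s ] + [ 2 ]) * ([ 2 ] * [ s ] + [ m ] + [ 1 ]) * (c₀ * (zonal d (suc s) * (v * v ^ s)))
          ≈⟨ *-congʳ denominator ⟨
        [ suc (suc (2 ℕ.* s)) ℕ.* suc (2 ℕ.* s ℕ.+ m) ] * (c₀ * (zonal d (suc s) * (v * v ^ s))) ∎)
        where
        D = 2 ℕ.* suc s
        [1+2s+m] : [ suc (2 ℕ.* s ℕ.+ m) ] ≈ [ 2 ] * [ s ] + [ m ] + [ 1 ]
        [1+2s+m] = trans ([]-+ 1 (2 ℕ.* s ℕ.+ m)) (trans (+-comm _ _) (+-congʳ (trans ([]-+ (2 ℕ.* s) m) (+-congʳ ([]-* 2 s)))))
        denominator : [ suc (suc (2 ℕ.* s)) ℕ.* suc (2 ℕ.* s ℕ.+ m) ] ≈ ([ 2 ] * [ s ] + [ 2 ]) * ([ 2 ] * [ s ] + [ m ] + [ 1 ])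
        denominator = trans ([]-* (suc (suc (2 ℕ.* s))) (suc (2 ℕ.* s ℕ.+ m)))
          (*-cong (trans ([]-+ 2 (2 ℕ.* s)) (trans (+-comm _ _) (+-congʳ ([]-* 2 s)))) [1+2s+m])
        third : [ suc (2 ℕ.* s ℕ.+ m) ] ≈ [ D ] + [ m ] - [ 1 ]
        third = begin
          [ suc (2 ℕ.* s ℕ.+ m) ]  ≈⟨ [1+2s+m] ⟩
          [ 2 ] * [ s ] + [ m ] + [ 1 ]  ≈⟨ solve 2 (λ s m → num 2 :* s :+ m :+ num 1 := num 2 :* (num 1 :+ s) :+ m :- num 1) refl [ s ] [ m ] ⟩
          [ 2 ] * ([ 1 ] + [ s ]) + [ m ] - [ 1 ]  ≈⟨ +-congʳ (+-congʳ (trans ([]-* 2 (suc s)) (*-congˡ ([]-+ 1 s)))) ⟨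
          [ D ] + [ m ] - [ 1 ]  ∎
        index : k ℕ.+ 2 ℕ.+ 2 ℕ.* s ≡ d
        index = ≡.trans (ℕ.+-assoc k 2 (2 ℕ.* s)) (≡.trans (≡.cong (k ℕ.+_) (≡.sym (2*suc s))) eq)
        k+2 : [ k ℕ.+ 2 ] ≈ [ d ] - [ 2 ℕ.* s ]
        k+2 = begin
          [ k ℕ.+ 2 ]  ≈⟨ solve 2 (λ a b → a := a :+ b :- b) refl [ k ℕ.+ 2 ] [ 2 ℕ.* s ] ⟩
          [ k ℕ.+ 2 ] + [ 2 ℕ.* s ] - [ 2 ℕ.* s ]  ≈⟨ +-congʳ (trans (sym ([]-+ (k ℕ.+ 2) (2 ℕ.* s))) ([]-cong index)) ⟩
          [ d ] - [ 2 ℕ.* s ]  ∎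
        k+1 : [ k ℕ.+ 1 ] ≈ [ d ] - [ 2 ℕ.* s ] - [ 1 ]
        k+1 = begin
          [ k ℕ.+ 1 ]  ≈⟨ solve 1 (λ a → a := num 1 :+ a :- num 1) refl [ k ℕ.+ 1 ] ⟩
          [ 1 ] + [ k ℕ.+ 1 ] - [ 1 ]  ≈⟨ +-congʳ (trans (sym ([]-+ 1 (k ℕ.+ 1))) ([]-cong (≡.sym (ℕ.+-suc k 1)))) ⟩
          [ k ℕ.+ 2 ] - [ 1 ]  ≈⟨ +-congʳ k+2 ⟩
          [ d ] - [ 2 ℕ.* s ] - [ 1 ]  ∎

      zonal-form : box B g x ≈ c₀ * Z u v d
      zonal-form = begin
        box B g x
          ≈⟨ box-last B g x ⟩
        series (3 ℕ.+ d) F u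
          ≈⟨ trans (series-grow (2 ℕ.+ d) F u (beyond (2 ℕ.+ d) (ℕ.n≤1+n (suc d)))) (series-grow (suc d) F u (beyond (suc d) ℕ.≤-refl)) ⟩
        series (suc d) F u
          ≈⟨ series-parts d F u F-odd ⟩
        parts d (λ k s → F k * u ^ k)
          ≈⟨ parts-cong d (λ k s eq → trans (*-congʳ (F-even s k eq))
               (solve 4 (λ c z y x → c :* (z :* y) :* x := c :* (z :* (x :* y))) refl c₀ (zonal d s) (v ^ s) (u ^ k))) ⟩
        parts d (λ k s → c₀ * (zonal d s * (u ^ k * v ^ s)))
          ≈⟨ parts-* d c₀ (λ k s → zonal d s * (u ^ k * v ^ s)) ⟨
        c₀ * Z u v d ∎
        where
        beyond : ∀ k → d ℕ.< k → F k ≈ 0#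
        beyond k d<k = box-zero B x′ (λ β → f-vanishes k β (λ eq → ℕ.<-irrefl ≡.refl
          (ℕ.≤-trans d<k (ℕ.≤-trans (ℕ.m≤n+m k (Vec.sum β)) (ℕ.≤-reflexive eq)))))

  laplacian-∷ʳ : ∀ {n} (g : Coefficients (suc n)) β k →
    laplacian g (β Vec.∷ʳ k) ≈ laplacian (λ β → g (β Vec.∷ʳ k)) β + [ (k ℕ.+ 2) ℕ.* (k ℕ.+ 1) ] * g (β Vec.∷ʳ (k ℕ.+ 2))
  laplacian-∷ʳ g []      k = trans (+-identityʳ _) (sym (+-identityˡ _))
  laplacian-∷ʳ g (p ∷ β) k = trans (+-congˡ (laplacian-∷ʳ (λ γ → g (p ∷ γ)) β k)) (sym (+-assoc _ _ _))

  snoc : ∀ {n} → (Fin n → Carrier) → Carrier → Fin (suc n) → Carrier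
  snoc {zero}  x z zero    = z
  snoc {suc n} x z zero    = x zero
  snoc {suc n} x z (suc j) = snoc (x ∘ suc) z j

  snoc-inject₁ : ∀ {n} (x : Fin n → Carrier) z j → snoc x z (inject₁ j) ≈ x j
  snoc-inject₁ x z zero    = refl
  snoc-inject₁ x z (suc j) = snoc-inject₁ (x ∘ suc) z j

  snoc-last : ∀ {n} (x : Fin n → Carrier) z → snoc x z (fromℕ n) ≈ z
  snoc-last {zero}  x z = refl
  snoc-last {suc n} x z = snoc-last (x ∘ suc) z

  rotate-cong : ∀ {n} (i : Fin n) c s {x y} → (∀ j → x j ≈ y j) → ∀ j → rotate i c s x j ≈ rotate i c s y j
  rotate-cong zero    c s x≈y zero          = +-cong (*-congˡ (x≈y zero)) (-‿cong (*-congˡ (x≈y (suc zero))))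
  rotate-cong zero    c s x≈y (suc zero)    = +-cong (*-congˡ (x≈y zero)) (*-congˡ (x≈y (suc zero)))
  rotate-cong zero    c s x≈y (suc (suc j)) = x≈y (suc (suc j))
  rotate-cong (suc i) c s x≈y zero          = x≈y zero
  rotate-cong (suc i) c s x≈y (suc j)       = rotate-cong i c s (x≈y ∘ suc) j

  rotate-inject₁ : ∀ {n} (i : Fin n) c s x j → rotate (inject₁ i) c s x (inject₁ j) ≈ rotate i c s (x ∘ inject₁) j
  rotate-inject₁ zero    c s x zero          = refl
  rotate-inject₁ zero    c s x (suc zero)    = refl
  rotate-inject₁ zero    c s x (suc (suc j)) = refl
  rotate-inject₁ (suc i) c s x zero          = refl
  rotate-inject₁ (suc i) c s x (suc j)       = rotate-inject₁ i c s (x ∘ suc) j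

  rotate-last : ∀ {n} (i : Fin n) c s x → rotate (inject₁ i) c s x (fromℕ (suc n)) ≈ x (fromℕ (suc n))
  rotate-last zero    c s x = refl
  rotate-last (suc i) c s x = rotate-last i c s (x ∘ suc)

  module _ {n B} {g : Coefficients (suc n)} (g₀ : Bounded B g) where

    ∷ʳ-bounded : ∀ k → Bounded B (λ β → g (β Vec.∷ʳ k))
    ∷ʳ-bounded k β B≤ = g₀ (β Vec.∷ʳ k) (ℕ.≤-trans B≤ (ℕ.≤-trans (ℕ.m≤m+n _ k) (ℕ.≤-reflexive (≡.sym (sum-∷ʳ β k)))))

    ∷ʳ-vanishes : ∀ k → B ℕ.≤ k → ∀ β → g (β Vec.∷ʳ k) ≈ 0#
    ∷ʳ-vanishes k B≤k β = g₀ (β Vec.∷ʳ k) (ℕ.≤-trans B≤k (ℕ.≤-trans (ℕ.m≤n+m k _) (ℕ.≤-reflexive (≡.sym (sum-∷ʳ β k)))))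

    box-snoc : ∀ x z → box B g (snoc x z) ≈ series B (λ k → box B (λ β → g (β Vec.∷ʳ k)) x) z
    box-snoc x z = trans (box-last B g (snoc x z))
      (series-cong B (λ k _ → box-cong B (λ _ → refl) (snoc-inject₁ x z)) (snoc-last x z))

    ∷ʳ-unique : ∀ {x y} → (∀ z → box B g (snoc x z) ≈ box B g (snoc y z)) →
      ∀ k → box B (λ β → g (β Vec.∷ʳ k)) x ≈ box B (λ β → g (β Vec.∷ʳ k)) y
    ∷ʳ-unique {x} {y} eq = series-unique B (λ k → box B (λ β → g (β Vec.∷ʳ k)) x) (λ k → box B (λ β → g (β Vec.∷ʳ k)) y)
      (λ k B≤k → box-zero B x (∷ʳ-vanishes k B≤k)) (λ k B≤k → box-zero B y (∷ʳ-vanishes k B≤k))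
      (λ z → trans (sym (box-snoc x z)) (trans (eq z) (box-snoc y z)))

  snoc-ext : ∀ {n} (x : Fin n → Carrier) z {y : Fin (suc n) → Carrier} → (∀ j → y (inject₁ j) ≈ x j) → y (fromℕ n) ≈ z → ∀ j → snoc x z j ≈ y j
  snoc-ext {zero}  x z init last zero    = sym last
  snoc-ext {suc n} x z init last zero    = sym (init zero)
  snoc-ext {suc n} x z init last (suc j) = snoc-ext (x ∘ suc) z (init ∘ suc) last j

  ∷ʳ-invariant : ∀ {n B} {g : Coefficients (2 ℕ.+ n)} → Bounded B g →
    (∀ (i : Fin n) c s → c * c + s * s ≈ 1# → ∀ x → box B g (rotate (inject₁ i) c s x) ≈ box B g x) →
    ∀ k → Invariant B (λ β → g (β Vec.∷ʳ k))
  ∷ʳ-invariant {B = B} {g} g₀ inv k i c s eq x = ∷ʳ-unique {g = g} g₀ {rotate i c s x} {x} (λ z → begin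
    box B g (snoc (rotate i c s x) z)
      ≈⟨ box-cong B {g} {g} (λ _ → refl) (snoc-ext (rotate i c s x) z {rotate (inject₁ i) c s (snoc x z)}
           (λ j → trans (rotate-inject₁ i c s (snoc x z) j) (rotate-cong i c s (snoc-inject₁ x z) j))
           (trans (rotate-last i c s (snoc x z)) (snoc-last x z))) ⟩
    box B g (rotate (inject₁ i) c s (snoc x z))
      ≈⟨ inv i c s eq (snoc x z) ⟩
    box B g (snoc x z) ∎) k

  parts-first : ∀ d F → (∀ i j → F i (suc j) ≈ 0#) → parts d F ≈ F d 0
  parts-first zero          F F₀ = refl
  parts-first (suc zero)    F F₀ = refl
  parts-first (suc (suc d)) F F₀ = trans (+-congˡ (trans (parts-first d (λ i j → F i (suc j)) (λ i j → F₀ i (suc j))) (F₀ d 0))) (+-identityʳ _)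

  Z-pole : ∀ {u v} → u ≈ 1# → v ≈ 0# → ∀ d → Z u v d ≈ 1#
  Z-pole {u} {v} u≈1 v≈0 d = trans
    (parts-first d (λ k s → zonal d s * (u ^ k * v ^ s))
      (λ k s → trans (*-congˡ (trans (*-congˡ (trans (*-congʳ v≈0) (zeroˡ _))) (zeroʳ _))) (zeroʳ _)))
    (trans (*-cong (trans (*-identityˡ _) 1-homo) (trans (*-identityʳ _) (one^ d))) (*-identityˡ 1#))
    where
    one^ : ∀ d → u ^ d ≈ 1#
    one^ zero    = refl
    one^ (suc d) = trans (*-cong u≈1 (one^ d)) (*-identityˡ 1#)

  sum-constant : ∀ k {Q : Fin k → Carrier} {q} → (∀ j → Q j ≈ q) → sum Q ≈ [ k ] * q
  sum-constant zero    {Q} {q} Q≈q = sym (trans (*-congʳ 0-homo) (zeroˡ q))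
  sum-constant (suc k) {Q} {q} Q≈q = trans (+-cong (Q≈q zero) (sum-constant k (Q≈q ∘ suc)))
    (trans (solve 2 (λ k q → q :+ k :* q := (num 1 :+ k) :* q) refl [ k ] q) (*-congʳ (sym ([]-+ 1 k))))

  moment-recurrence : ∀ K {Q : Fin (suc m) → Carrier} {q e e′} → (∀ j → Q j ≈ q) → e ≈ sum Q + e′ → [ suc K ] * q ≈ e′ →
    [ suc K ] * e ≈ ([ 2 ] + [ m ] + [ K ]) * e′
  moment-recurrence K {Q} {q} {e} {e′} Q≈q e≈ q≈ = begin
    [ suc K ] * e  ≈⟨ *-congˡ (trans e≈ (+-congʳ (sum-constant (suc m) Q≈q))) ⟩
    [ suc K ] * ([ suc m ] * q + e′)  ≈⟨ solve 4 (λ k m q e → k :* (m :* q :+ e) := m :* (k :* q) :+ k :* e) refl [ suc K ] [ suc m ] q e′ ⟩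
    [ suc m ] * ([ suc K ] * q) + [ suc K ] * e′  ≈⟨ +-cong (*-cong ([]-+ 1 m) q≈) (*-congʳ ([]-+ 1 K)) ⟩
    ([ 1 ] + [ m ]) * e′ + ([ 1 ] + [ K ]) * e′
      ≈⟨ solve 3 (λ m k e → (num 1 :+ m) :* e :+ (num 1 :+ k) :* e := (num 2 :+ m :+ k) :* e) refl [ m ] [ K ] e′ ⟩
    ([ 2 ] + [ m ] + [ K ]) * e′  ∎

  β-moment : ∀ k → [ suc (2 ℕ.* k) ] * β 0 k ≈ ([ 2 ] + [ m ] + [ 2 ℕ.* k ]) * β 0 (suc k)
  β-moment k = begin
    [ suc (2 ℕ.* k) ] * ([ (2 ℕ.* k) ! ] * (χ k * π k))
      ≈⟨ *-assoc _ _ _ ⟨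
    [ suc (2 ℕ.* k) ] * [ (2 ℕ.* k) ! ] * (χ k * π k)
      ≈⟨ *-cong ([]-! (2 ℕ.* k)) (*-cong (χ-suc k) (trans (*-congʳ (+-congˡ ([]-* 2 k))) (π-suc k))) ⟨
    F * ([ 2 ] * [ suc k ] * χ (suc k) * (M * π (suc k)))
      ≈⟨ solve 5 (λ f j x n p → f :* (j :* x :* (n :* p)) := n :* (j :* f :* (x :* p))) refl F ([ 2 ] * [ suc k ]) (χ (suc k)) M (π (suc k)) ⟩
    M * ([ 2 ] * [ suc k ] * F * (χ (suc k) * π (suc k)))
      ≈⟨ *-congˡ (*-congʳ (*-congʳ (trans (sym ([]-* 2 (suc k))) ([]-cong (2*suc k))))) ⟩
    M * ([ 2 ℕ.+ 2 ℕ.* k ] * F * (χ (suc k) * π (suc k)))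
      ≈⟨ *-congˡ (*-congʳ (trans ([]-cong (≡.cong _! (2*suc k))) ([]-! (suc (2 ℕ.* k))))) ⟨
    M * ([ (2 ℕ.* suc k) ! ] * (χ (suc k) * π (suc k))) ∎
    where
    F = [ suc (2 ℕ.* k) ! ]
    M = [ 2 ] + [ m ] + [ 2 ℕ.* k ]

  β-step-unique : ∀ k {e e′} → e ≈ β 0 k → [ suc (2 ℕ.* k) ] * e ≈ ([ 2 ] + [ m ] + [ 2 ℕ.* k ]) * e′ → e′ ≈ β 0 (suc k)
  β-step-unique k {e} {e′} e≈ step = []-cancel (2 ℕ.+ m ℕ.+ 2 ℕ.* k) (begin
    [ 2 ℕ.+ m ℕ.+ 2 ℕ.* k ] * e′  ≈⟨ *-congʳ cast ⟩
    ([ 2 ] + [ m ] + [ 2 ℕ.* k ]) * e′  ≈⟨ step ⟨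
    [ suc (2 ℕ.* k) ] * e  ≈⟨ *-congˡ e≈ ⟩
    [ suc (2 ℕ.* k) ] * β 0 k  ≈⟨ β-moment k ⟩
    ([ 2 ] + [ m ] + [ 2 ℕ.* k ]) * β 0 (suc k)  ≈⟨ *-congʳ cast ⟨
    [ 2 ℕ.+ m ℕ.+ 2 ℕ.* k ] * β 0 (suc k)  ∎)
    where
    cast : [ 2 ℕ.+ m ℕ.+ 2 ℕ.* k ] ≈ [ 2 ] + [ m ] + [ 2 ℕ.* k ]
    cast = trans ([]-+ (2 ℕ.+ m) (2 ℕ.* k)) (+-congʳ ([]-+ 2 m))

  β₀₀ : β 0 0 ≈ 1#
  β₀₀ = trans (*-cong 1-homo (*-identityʳ 1#)) (*-identityˡ 1#)

-- The constants of the expansion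

module Constants (R : CommutativeRing 0ℓ 0ℓ)
                 (ι : ℚ.+-*-rawRing -Raw-AlmostCommutative⟶ fromCommutativeRing R) (m : ℕ) where

  open CommutativeRing R hiding (zero)
  open Algebra.Properties.Semiring.Sum semiring using (sum; sum-cong-≋; sum-init-last)
  open Relation.Binary.Reasoning.Setoid setoid
  open _-Raw-AlmostCommutative⟶_ ι using (⟦_⟧; *-homo; 1-homo)
  open ℚAlgebra R ι
  open ZonalExpansion R ι m
  open Solver using (solve; _:=_; _:+_; _:*_; con)

  parts-even : ∀ k F → parts (2 ℕ.* k) F ≈ sum {suc k} (λ l → F (2 ℕ.* toℕ l) (k ℕ.∸ toℕ l))
  parts-even zero    F = sym (+-identityʳ _)
  parts-even (suc k) F = begin
    parts (2 ℕ.* suc k) F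
      ≈⟨ reflexive (≡.cong (λ d → parts d F) (2*suc k)) ⟩
    F (2 ℕ.+ 2 ℕ.* k) 0 + parts (2 ℕ.* k) (λ i j → F i (suc j))
      ≈⟨ +-comm _ _ ⟩
    parts (2 ℕ.* k) (λ i j → F i (suc j)) + F (2 ℕ.+ 2 ℕ.* k) 0
      ≈⟨ +-cong (parts-even k (λ i j → F i (suc j))) (reflexive (≡.cong₂ F index (≡.sym (≡.trans (≡.cong (suc k ℕ.∸_) (Fin.toℕ-fromℕ (suc k))) (ℕ.n∸n≡0 (suc k)))))) ⟩
    sum {suc k} (λ l → F (2 ℕ.* toℕ l) (suc (k ℕ.∸ toℕ l))) + G (fromℕ (suc k))
      ≈⟨ +-congʳ (sum-cong-≋ (λ l → reflexive (≡.cong₂ F (≡.cong (2 ℕ.*_) (≡.sym (Fin.toℕ-inject₁ l)))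
           (≡.sym (≡.trans (≡.cong (suc k ℕ.∸_) (Fin.toℕ-inject₁ l)) (ℕ.+-∸-assoc 1 (ℕ.≤-pred (Fin.toℕ<n l)))))))) ⟩
    sum {suc k} (λ l → G (inject₁ l)) + G (fromℕ (suc k))
      ≈⟨ sum-init-last G ⟨
    sum G ∎
    where
    G : Fin (2 ℕ.+ k) → Carrier
    G l = F (2 ℕ.* toℕ l) (suc k ℕ.∸ toℕ l)
    index : 2 ℕ.+ 2 ℕ.* k ≡ 2 ℕ.* toℕ (fromℕ (suc k))
    index = ≡.trans (≡.sym (2*suc k)) (≡.cong (2 ℕ.*_) (≡.sym (Fin.toℕ-fromℕ (suc k))))

  μ-factorial : ∀ e → μ e * ([ e ! ] * [ m ! ]) ≈ [ (e ℕ.+ m) ! ]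
  μ-factorial zero    = trans (*-identityˡ _) (trans (*-congʳ 1-homo) (*-identityˡ _))
  μ-factorial (suc e) = begin
    μ (suc e) * ([ suc e ! ] * [ m ! ])  ≈⟨ *-congˡ (*-congʳ ([]-! e)) ⟩
    μ (suc e) * ([ suc e ] * [ e ! ] * [ m ! ])
      ≈⟨ solve 4 (λ x a b c → x :* (a :* b :* c) := a :* x :* (b :* c)) refl (μ (suc e)) [ suc e ] [ e ! ] [ m ! ] ⟩
    [ suc e ] * μ (suc e) * ([ e ! ] * [ m ! ])  ≈⟨ *-congʳ (trans (μ-suc e) (*-congʳ (sym ([]-+ (suc e) m)))) ⟩
    [ suc e ℕ.+ m ] * μ e * ([ e ! ] * [ m ! ])  ≈⟨ *-assoc _ _ _ ⟩
    [ suc e ℕ.+ m ] * (μ e * ([ e ! ] * [ m ! ]))  ≈⟨ *-congˡ (μ-factorial e) ⟩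
    [ suc e ℕ.+ m ] * [ (e ℕ.+ m) ! ]  ≈⟨ []-! (e ℕ.+ m) ⟨
    [ suc (e ℕ.+ m) ! ]  ∎

  dim-factorial : ∀ e → dim (suc e) * [ suc e ! ℕ.* m ! ] ≈ [ (2 ℕ.* suc e ℕ.+ m) ℕ.* (e ℕ.+ m) ! ]
  dim-factorial e = begin
    (μ (suc e) + μ e) * [ suc e ! ℕ.* m ! ]
      ≈⟨ trans (*-congˡ ([]-* (suc e !) (m !))) (distribʳ _ _ _) ⟩
    μ (suc e) * ([ suc e ! ] * [ m ! ]) + μ e * ([ suc e ! ] * [ m ! ])
      ≈⟨ +-cong (trans (μ-factorial (suc e)) (trans ([]-! (e ℕ.+ m)) (*-congʳ ([]-+ (suc e) m)))) (*-congˡ (*-congʳ ([]-! e))) ⟩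
    ([ suc e ] + [ m ]) * [ (e ℕ.+ m) ! ] + μ e * ([ suc e ] * [ e ! ] * [ m ! ])
      ≈⟨ +-congˡ (solve 4 (λ x a b c → x :* (a :* b :* c) := a :* (x :* (b :* c))) refl (μ e) [ suc e ] [ e ! ] [ m ! ]) ⟩
    ([ suc e ] + [ m ]) * [ (e ℕ.+ m) ! ] + [ suc e ] * (μ e * ([ e ! ] * [ m ! ]))
      ≈⟨ +-congˡ (*-congˡ (μ-factorial e)) ⟩
    ([ suc e ] + [ m ]) * [ (e ℕ.+ m) ! ] + [ suc e ] * [ (e ℕ.+ m) ! ]
      ≈⟨ solve 3 (λ e m f → (e :+ m) :* f :+ e :* f := (num 2 :* e :+ m) :* f) refl [ suc e ] [ m ] [ (e ℕ.+ m) ! ] ⟩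
    ([ 2 ] * [ suc e ] + [ m ]) * [ (e ℕ.+ m) ! ]
      ≈⟨ *-congʳ (trans ([]-+ (2 ℕ.* suc e) m) (+-congʳ ([]-* 2 (suc e)))) ⟨
    [ 2 ℕ.* suc e ℕ.+ m ] * [ (e ℕ.+ m) ! ]
      ≈⟨ []-* (2 ℕ.* suc e ℕ.+ m) ((e ℕ.+ m) !) ⟨
    [ (2 ℕ.* suc e ℕ.+ m) ℕ.* (e ℕ.+ m) ! ] ∎

  fraction : ∀ a b .{{_ : ℕ.NonZero b}} {x} → x * [ b ] ≈ [ a ] → ⟦ + a ℚ./ b ⟧ ≈ x
  fraction a b {x} eq = []-cancel b (trans (*-comm _ _) (trans
    (trans (sym (*-homo _ _)) (reflexive (≡.cong ⟦_⟧ (/-*-cancel a b)))) (trans (sym eq) (*-comm _ _))))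

  module Ratio (γ : ℕ → Carrier) (γ-suc : ∀ i → [ 2 ] * γ (suc i) ≈ [ 2 ℕ.+ m ℕ.+ 2 ℕ.* i ] * γ i) where

    private
      H G : ℕ → Carrier
      H j = χ j * [ j ! ]
      G i = π i * γ i

      H-suc : ∀ j → [ 2 ] * H (suc j) ≈ H j
      H-suc j = begin
        [ 2 ] * (χ (suc j) * [ suc j ! ])  ≈⟨ *-congˡ (*-congˡ ([]-! j)) ⟩
        [ 2 ] * (χ (suc j) * ([ suc j ] * [ j ! ]))
          ≈⟨ solve 4 (λ t x a b → t :* (x :* (a :* b)) := t :* a :* x :* b) refl [ 2 ] (χ (suc j)) [ suc j ] [ j ! ] ⟩
        [ 2 ] * [ suc j ] * χ (suc j) * [ j ! ]  ≈⟨ *-congʳ (χ-suc j) ⟩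
        χ j * [ j ! ]  ∎

      G-suc : ∀ i → [ 2 ] * G (suc i) ≈ G i
      G-suc i = begin
        [ 2 ] * (π (suc i) * γ (suc i))
          ≈⟨ solve 3 (λ t p g → t :* (p :* g) := p :* (t :* g)) refl [ 2 ] (π (suc i)) (γ (suc i)) ⟩
        π (suc i) * ([ 2 ] * γ (suc i))  ≈⟨ *-congˡ (γ-suc i) ⟩
        π (suc i) * ([ 2 ℕ.+ m ℕ.+ 2 ℕ.* i ] * γ i)
          ≈⟨ solve 3 (λ p a g → p :* (a :* g) := a :* p :* g) refl (π (suc i)) [ 2 ℕ.+ m ℕ.+ 2 ℕ.* i ] (γ i) ⟩
        [ 2 ℕ.+ m ℕ.+ 2 ℕ.* i ] * π (suc i) * γ i
          ≈⟨ *-congʳ (trans (*-congʳ (trans ([]-+ (2 ℕ.+ m) (2 ℕ.* i)) (+-cong ([]-+ 2 m) ([]-* 2 i)))) (π-suc i)) ⟩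
        π i * γ i  ∎

      transfer : ∀ l j i → H j * G (i ℕ.+ l) ≈ H (j ℕ.+ l) * G i
      transfer zero    j i = reflexive (≡.cong₂ (λ a b → H b * G a) (ℕ.+-identityʳ i) (≡.sym (ℕ.+-identityʳ j)))
      transfer (suc l) j i = []-cancel 2 (begin
        [ 2 ] * (H j * G (i ℕ.+ suc l))  ≈⟨ *-congˡ (*-congˡ (reflexive (≡.cong G (ℕ.+-suc i l)))) ⟩
        [ 2 ] * (H j * G (suc (i ℕ.+ l)))  ≈⟨ solve 3 (λ t h g → t :* (h :* g) := h :* (t :* g)) refl [ 2 ] (H j) (G (suc (i ℕ.+ l))) ⟩
        H j * ([ 2 ] * G (suc (i ℕ.+ l)))  ≈⟨ *-congˡ (G-suc (i ℕ.+ l)) ⟩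
        H j * G (i ℕ.+ l)  ≈⟨ transfer l j i ⟩
        H (j ℕ.+ l) * G i  ≈⟨ *-congʳ (H-suc (j ℕ.+ l)) ⟨
        [ 2 ] * H (suc (j ℕ.+ l)) * G i  ≈⟨ *-assoc _ _ _ ⟩
        [ 2 ] * (H (suc (j ℕ.+ l)) * G i)  ≈⟨ *-congˡ (*-congʳ (reflexive (≡.cong H (ℕ.+-suc j l)))) ⟨
        [ 2 ] * (H (j ℕ.+ suc l) * G i)  ∎)

    β-ratio : ∀ j l → β (2 ℕ.* l) j * ([ j ! ] * γ (j ℕ.+ l ℕ.+ l)) ≈ [ (j ℕ.+ l) ! ] * γ (j ℕ.+ l) * β 0 (j ℕ.+ l)
    β-ratio j l = begin
      [ (2 ℕ.* l ℕ.+ 2 ℕ.* j) ! ] * (χ j * π (2 ℕ.* l ℕ.+ j)) * ([ j ! ] * γ (j ℕ.+ l ℕ.+ l))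
        ≈⟨ *-congʳ (*-cong ([]-cong (≡.cong _! index₁)) (*-congˡ (reflexive (≡.cong π index₂)))) ⟩
      [ (2 ℕ.* (j ℕ.+ l)) ! ] * (χ j * π (j ℕ.+ l ℕ.+ l)) * ([ j ! ] * γ (j ℕ.+ l ℕ.+ l))
        ≈⟨ solve 5 (λ f x p j g → f :* (x :* p) :* (j :* g) := f :* (x :* j :* (p :* g))) refl
             [ (2 ℕ.* (j ℕ.+ l)) ! ] (χ j) (π (j ℕ.+ l ℕ.+ l)) [ j ! ] (γ (j ℕ.+ l ℕ.+ l)) ⟩
      [ (2 ℕ.* (j ℕ.+ l)) ! ] * (H j * G (j ℕ.+ l ℕ.+ l))
        ≈⟨ *-congˡ (transfer l j (j ℕ.+ l)) ⟩
      [ (2 ℕ.* (j ℕ.+ l)) ! ] * (H (j ℕ.+ l) * G (j ℕ.+ l))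
        ≈⟨ solve 5 (λ f x j p g → f :* (x :* j :* (p :* g)) := j :* g :* (f :* (x :* p))) refl
             [ (2 ℕ.* (j ℕ.+ l)) ! ] (χ (j ℕ.+ l)) [ (j ℕ.+ l) ! ] (π (j ℕ.+ l)) (γ (j ℕ.+ l)) ⟩
      [ (j ℕ.+ l) ! ] * γ (j ℕ.+ l) * β 0 (j ℕ.+ l) ∎
      where
      open ℕS using () renaming (solve to ℕsolve; _:=_ to _⟨=⟩_; _:+_ to _⟨+⟩_; _:*_ to _⟨*⟩_; con to ℕcon)
      index₁ : 2 ℕ.* l ℕ.+ 2 ℕ.* j ≡ 2 ℕ.* (j ℕ.+ l)
      index₁ = ℕsolve 2 (λ l j → (ℕcon 2 ⟨*⟩ l) ⟨+⟩ (ℕcon 2 ⟨*⟩ j) ⟨=⟩ (ℕcon 2 ⟨*⟩ (j ⟨+⟩ l))) ≡.refl l j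
      index₂ : 2 ℕ.* l ℕ.+ j ≡ j ℕ.+ l ℕ.+ l
      index₂ = ℕsolve 2 (λ l j → (ℕcon 2 ⟨*⟩ l) ⟨+⟩ j ⟨=⟩ (j ⟨+⟩ l) ⟨+⟩ l) ≡.refl l j

  normalise-term : ∀ {I I⁻¹ den den⁻¹ b c w w′ d d′ z z′} → I⁻¹ * I ≈ 1# → den * den⁻¹ ≈ 1# → b * den ≈ c * I →
    w ≈ w′ → d ≈ d′ → z ≈ z′ → I⁻¹ * (b * (w * (d * z))) ≈ c * den⁻¹ * d′ * w′ * z′
  normalise-term {I} {I⁻¹} {den} {den⁻¹} {b} {c} {w} {w′} {d} {d′} {z} {z′} I-inv den-inv ratio w≈ d≈ z≈ = begin
    I⁻¹ * (b * (w * (d * z)))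
      ≈⟨ *-identityˡ _ ⟨
    1# * (I⁻¹ * (b * (w * (d * z))))
      ≈⟨ *-congʳ den-inv ⟨
    den * den⁻¹ * (I⁻¹ * (b * (w * (d * z))))
      ≈⟨ solve 7 (λ x y i b w d z → x :* y :* (i :* (b :* (w :* (d :* z)))) := i :* (b :* x) :* y :* d :* w :* z) refl den den⁻¹ I⁻¹ b w d z ⟩
    I⁻¹ * (b * den) * den⁻¹ * d * w * z
      ≈⟨ *-cong (*-cong (*-cong (*-congʳ inner) d≈) w≈) z≈ ⟩
    c * den⁻¹ * d′ * w′ * z′ ∎
    where
    inner : I⁻¹ * (b * den) ≈ c
    inner = trans (*-congˡ ratio) (trans (solve 3 (λ i c j → i :* (c :* j) := i :* j :* c) refl I⁻¹ c I) (trans (*-congʳ I-inv) (*-identityˡ c)))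

private
  dimH-numerator : ℕ → ℕ → ℕ
  dimH-numerator m e = (2 ℕ.* suc e ℕ.+ (2 ℕ.+ m) ℕ.∸ 2) ℕ.* (suc e ℕ.+ (2 ℕ.+ m) ℕ.∸ 3) !

  numerator : ∀ m e → dimH-numerator m e ≡ (2 ℕ.* suc e ℕ.+ m) ℕ.* (e ℕ.+ m) !
  numerator m e = ≡.cong₂ (λ a b → a ℕ.* b !)
    (≡.cong (ℕ._∸ 2) (shift (2 ℕ.* suc e) m)) (≡.cong (ℕ._∸ 2) (shift e m))
    where
    shift : ∀ a m → a ℕ.+ (2 ℕ.+ m) ≡ 2 ℕ.+ (a ℕ.+ m)
    shift = ℕS.solve 2 (λ a m → a ℕS.:+ (ℕS.con 2 ℕS.:+ m) ℕS.:= ℕS.con 2 ℕS.:+ (a ℕS.:+ m)) ≡.refl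

dimH-dim : (R : CommutativeRing 0ℓ 0ℓ) (ι : ℚ.+-*-rawRing -Raw-AlmostCommutative⟶ fromCommutativeRing R) (m e : ℕ) →
  CommutativeRing._≈_ R (_-Raw-AlmostCommutative⟶_.⟦_⟧ ι (dimH (2 ℕ.+ m) e)) (ZonalExpansion.dim R ι m e)
dimH-dim R ι zero    zero    = _-Raw-AlmostCommutative⟶_.1-homo ι
dimH-dim R ι (suc m) zero    = fraction (suc m ℕ.* m !) (1 ℕ.* suc m !) {{ℕ.m*n≢0 1 (suc m !) {{_}} {{suc m ℕ.!≢0}}}}
  (trans (*-identityˡ _) ([]-cong (ℕ.*-identityˡ (suc m !))))
  where
  open CommutativeRing R using (trans; *-identityˡ)
  open ℚAlgebra R ι
  open Constants R ι (suc m)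
dimH-dim R ι zero    (suc e) = fraction (dimH-numerator 0 e) (suc e ! ℕ.* 0 !) {{suc e ℕ.!* 0 !≢0}} (trans (dim-factorial e) ([]-cong (≡.sym (numerator 0 e))))
  where
  open CommutativeRing R using (trans)
  open ℚAlgebra R ι
  open Constants R ι 0
dimH-dim R ι (suc m) (suc e) = fraction (dimH-numerator (suc m) e) (suc e ! ℕ.* suc m !) {{suc e ℕ.!* suc m !≢0}} (trans (dim-factorial e) ([]-cong (≡.sym (numerator (suc m) e))))
  where
  open CommutativeRing R using (trans)
  open ℚAlgebra R ι
  open Constants R ι (suc m)

open import Defs

-- The ring of real numbers

module ℚS = Data.Rational.Solver.+-*-Solver

Eventually : (ℕ → Set) → Set
Eventually P = Σ[ N ∈ ℕ ] (∀ n → N ℕ.≤ n → P n)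

eventually₂ : ∀ {P Q S : ℕ → Set} → (∀ n → P n → Q n → S n) → Eventually P → Eventually Q → Eventually S
eventually₂ f (M , p) (N , q) = M ℕ.⊔ N , λ n h → f n (p n (ℕ.m⊔n≤o⇒m≤o M N h)) (q n (ℕ.m⊔n≤o⇒n≤o M N h))

halve : ∀ {ε} → 0ℚ ℚ.< ε → 0ℚ ℚ.< ½ ℚ.* ε
halve {ε} 0<ε = ℚ.positive⁻¹ (½ ℚ.* ε) {{ℚ.pos*pos⇒pos ½ ε {{ℚ.positive 0<ε}}}}

halves : ∀ ε → ½ ℚ.* ε ℚ.+ ½ ℚ.* ε ≡ ε
halves = solve 1 (λ e → con ½ :* e :+ con ½ :* e := e) ≡.refl
  where open ℚS

≤-halves : ∀ {a b ε} → a ℚ.≤ ½ ℚ.* ε → b ℚ.≤ ½ ℚ.* ε → a ℚ.+ b ℚ.≤ ε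
≤-halves {ε = ε} a≤ b≤ = ≡.subst (_ ℚ.≤_) (halves ε) (ℚ.+-mono-≤ a≤ b≤)

triangle : ∀ p q r → ℚ.∣ p ℚ.- r ∣ ℚ.≤ ℚ.∣ p ℚ.- q ∣ ℚ.+ ℚ.∣ q ℚ.- r ∣
triangle p q r = ≡.subst (λ z → ℚ.∣ z ∣ ℚ.≤ ℚ.∣ p ℚ.- q ∣ ℚ.+ ℚ.∣ q ℚ.- r ∣)
  (solve 3 (λ p q r → (p :- q) :+ (q :- r) := p :- r) ≡.refl p q r) (ℚ.∣p+q∣≤∣p∣+∣q∣ (p ℚ.- q) (q ℚ.- r))
  where open ℚS

∣-∣-swap : ∀ p q → ℚ.∣ p ℚ.- q ∣ ≡ ℚ.∣ q ℚ.- p ∣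
∣-∣-swap p q = ≡.trans (≡.sym (ℚ.∣-p∣≡∣p∣ (p ℚ.- q))) (≡.cong ℚ.∣_∣ (solve 2 (λ p q → :- (p :- q) := q :- p) ≡.refl p q))
  where open ℚS

∣-∣≤∣-∣+ : ∀ p q → ℚ.∣ p ∣ ℚ.≤ ℚ.∣ p ℚ.- q ∣ ℚ.+ ℚ.∣ q ∣
∣-∣≤∣-∣+ p q = ≡.subst (λ z → ℚ.∣ z ∣ ℚ.≤ ℚ.∣ p ℚ.- q ∣ ℚ.+ ℚ.∣ q ∣)
  (solve 2 (λ p q → (p :- q) :+ q := p) ≡.refl p q) (ℚ.∣p+q∣≤∣p∣+∣q∣ (p ℚ.- q) q)
  where open ℚS

*-mono-≤-nonNeg : ∀ {a b c d : ℚ} → 0ℚ ℚ.≤ a → a ℚ.≤ b → 0ℚ ℚ.≤ c → c ℚ.≤ d → a ℚ.* c ℚ.≤ b ℚ.* d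
*-mono-≤-nonNeg {a} {b} {c} {d} 0≤a a≤b 0≤c c≤d = ℚ.≤-trans
  (ℚ.*-monoʳ-≤-nonNeg c {{ℚ.nonNegative 0≤c}} a≤b)
  (ℚ.*-monoˡ-≤-nonNeg b {{ℚ.nonNegative (ℚ.≤-trans 0≤a a≤b)}} c≤d)

divide : ∀ K ε → 0ℚ ℚ.< K → 0ℚ ℚ.< ε → Σ[ δ ∈ ℚ ] 0ℚ ℚ.< δ × K ℚ.* δ ≡ ε
divide K ε 0<K 0<ε = ℚ.1/ K ℚ.* ε , ℚ.positive⁻¹ _ {{ℚ.pos*pos⇒pos (ℚ.1/ K) {{ℚ.1/pos⇒pos K}} ε}} ,
  ≡.trans (≡.sym (ℚ.*-assoc K (ℚ.1/ K) ε)) (≡.trans (≡.cong (ℚ._* ε) (ℚ.*-inverseʳ K)) (ℚ.*-identityˡ ε))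
  where
  instance
    _ = ℚ.positive 0<K
    _ = ℚ.positive 0<ε
    _ = ℚ.pos⇒nonZero K

∣*-*∣≤ : ∀ {K α β} a b c d → ℚ.∣ a ∣ ℚ.≤ K → ℚ.∣ d ∣ ℚ.≤ K → ℚ.∣ b ℚ.- d ∣ ℚ.≤ α → ℚ.∣ a ℚ.- c ∣ ℚ.≤ β →
  ℚ.∣ a ℚ.* b ℚ.- c ℚ.* d ∣ ℚ.≤ K ℚ.* α ℚ.+ K ℚ.* β
∣*-*∣≤ {K} {α} {β} a b c d a≤K d≤K b-d a-c = begin
  ℚ.∣ a ℚ.* b ℚ.- c ℚ.* d ∣
    ≡⟨ ≡.cong ℚ.∣_∣ (solve 4 (λ a b c d → a :* b :- c :* d := a :* (b :- d) :+ d :* (a :- c)) ≡.refl a b c d) ⟩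
  ℚ.∣ a ℚ.* (b ℚ.- d) ℚ.+ d ℚ.* (a ℚ.- c) ∣
    ≤⟨ ℚ.∣p+q∣≤∣p∣+∣q∣ (a ℚ.* (b ℚ.- d)) (d ℚ.* (a ℚ.- c)) ⟩
  ℚ.∣ a ℚ.* (b ℚ.- d) ∣ ℚ.+ ℚ.∣ d ℚ.* (a ℚ.- c) ∣
    ≡⟨ ≡.cong₂ ℚ._+_ (ℚ.∣p*q∣≡∣p∣*∣q∣ a (b ℚ.- d)) (ℚ.∣p*q∣≡∣p∣*∣q∣ d (a ℚ.- c)) ⟩
  ℚ.∣ a ∣ ℚ.* ℚ.∣ b ℚ.- d ∣ ℚ.+ ℚ.∣ d ∣ ℚ.* ℚ.∣ a ℚ.- c ∣
    ≤⟨ ℚ.+-mono-≤ (*-mono-≤-nonNeg (ℚ.0≤∣p∣ a) a≤K (ℚ.0≤∣p∣ (b ℚ.- d)) b-d)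
                  (*-mono-≤-nonNeg (ℚ.0≤∣p∣ d) d≤K (ℚ.0≤∣p∣ (a ℚ.- c)) a-c) ⟩
  K ℚ.* α ℚ.+ K ℚ.* β ∎
  where
  open ℚS
  open ℚ.≤-Reasoning

eventually-bounded : ∀ x → Σ[ K ∈ ℚ ] 0ℚ ℚ.< K × Eventually (λ n → ℚ.∣ seq x n ∣ ℚ.≤ K)
eventually-bounded x = let N , close = cauchy x 1ℚ (ℚ.positive⁻¹ 1ℚ) in
  1ℚ ℚ.+ ℚ.∣ seq x N ∣ , ℚ.+-mono-<-≤ (ℚ.positive⁻¹ 1ℚ) (ℚ.0≤∣p∣ (seq x N)) , N ,
  λ n N≤n → ℚ.≤-trans (∣-∣≤∣-∣+ (seq x n) (seq x N)) (ℚ.+-monoˡ-≤ ℚ.∣ seq x N ∣ (close n N N≤n ℕ.≤-refl))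

≡⇒≈ : ∀ {x y} → (∀ n → seq x n ≡ seq y n) → x ≈ y
≡⇒≈ {x} {y} eq = mk≈ λ ε 0<ε → 0 , λ n _ →
  ≡.subst (ℚ._≤ ε) (≡.sym (≡.trans (≡.cong (λ z → ℚ.∣ z ℚ.- seq y n ∣) (eq n)) (≡.cong ℚ.∣_∣ (ℚ.+-inverseʳ (seq y n))))) (ℚ.<⇒≤ 0<ε)

≈-refl : ∀ {x} → x ≈ x
≈-refl = ≡⇒≈ λ _ → ≡.refl

≈-sym : ∀ {x y} → x ≈ y → y ≈ x
≈-sym {x} {y} x≈y = mk≈ λ ε 0<ε → let N , close = eventually-close x≈y ε 0<ε in
  N , λ n N≤n → ≡.subst (ℚ._≤ ε) (∣-∣-swap (seq x n) (seq y n)) (close n N≤n)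

≈-trans : ∀ {x y z} → x ≈ y → y ≈ z → x ≈ z
≈-trans {x} {y} {z} x≈y y≈z = mk≈ λ ε 0<ε → eventually₂
  (λ n p q → ℚ.≤-trans (triangle (seq x n) (seq y n) (seq z n)) (≤-halves p q))
  (eventually-close x≈y _ (halve 0<ε)) (eventually-close y≈z _ (halve 0<ε))

+-cong : ∀ {x y z w} → x ≈ y → z ≈ w → x + z ≈ y + w
+-cong {x} {y} {z} {w} x≈y z≈w = mk≈ λ ε 0<ε → eventually₂
  (λ n p q → ℚ.≤-trans
    (≡.subst (λ r → ℚ.∣ r ∣ ℚ.≤ ℚ.∣ seq x n ℚ.- seq y n ∣ ℚ.+ ℚ.∣ seq z n ℚ.- seq w n ∣)
      (solve 4 (λ x y z w → (x :- y) :+ (z :- w) := (x :+ z) :- (y :+ w)) ≡.refl (seq x n) (seq y n) (seq z n) (seq w n))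
      (ℚ.∣p+q∣≤∣p∣+∣q∣ (seq x n ℚ.- seq y n) (seq z n ℚ.- seq w n)))
    (≤-halves p q))
  (eventually-close x≈y _ (halve 0<ε)) (eventually-close z≈w _ (halve 0<ε))
  where open ℚS

-‿cong : ∀ {x y} → x ≈ y → - x ≈ - y
-‿cong {x} {y} x≈y = mk≈ λ ε 0<ε → let N , close = eventually-close x≈y ε 0<ε in
  N , λ n N≤n → ≡.subst (ℚ._≤ ε) (≡.trans (∣-∣-swap (seq x n) (seq y n)) (≡.cong ℚ.∣_∣
    (solve 2 (λ x y → y :- x := (:- x) :- (:- y)) ≡.refl (seq x n) (seq y n)))) (close n N≤n)
  where open ℚS

*-cong : ∀ {x y z w} → x ≈ y → z ≈ w → x * z ≈ y * w
*-cong {x} {y} {z} {w} x≈y z≈w = mk≈ λ ε 0<ε →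
  let K , 0<K , x≤K = eventually-bounded x
      L , 0<L , w≤L = eventually-bounded w
      δ , 0<δ , eq = divide (K ℚ.+ L) (½ ℚ.* ε) (ℚ.+-mono-< 0<K 0<L) (halve 0<ε)
  in eventually₂ (λ { n (x≤ , w≤) (p , q) → ℚ.≤-trans
       (∣*-*∣≤ {K ℚ.+ L} {δ} {δ} (seq x n) (seq z n) (seq y n) (seq w n)
         (ℚ.≤-trans x≤ (≡.subst (ℚ._≤ K ℚ.+ L) (ℚ.+-identityʳ K) (ℚ.+-monoʳ-≤ K (ℚ.<⇒≤ 0<L))))
         (ℚ.≤-trans w≤ (≡.subst (ℚ._≤ K ℚ.+ L) (ℚ.+-identityˡ L) (ℚ.+-monoˡ-≤ L (ℚ.<⇒≤ 0<K)))) p q)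
       (≤-halves (ℚ.≤-reflexive eq) (ℚ.≤-reflexive eq)) })
     (eventually₂ (λ n → _,_) x≤K w≤L)
     (eventually₂ (λ n → _,_) (eventually-close z≈w δ 0<δ) (eventually-close x≈y δ 0<δ))

ℝ-isCommutativeRing : IsCommutativeRing _≈_ _+_ _*_ -_ 0ℝ 1ℝ
ℝ-isCommutativeRing = record
  { isRing = record
    { +-isAbelianGroup = record
      { isGroup = record
        { isMonoid = record
          { isSemigroup = record
            { isMagma = record
              { isEquivalence = record { refl = ≈-refl ; sym = ≈-sym ; trans = ≈-trans }
              ; ∙-cong = +-cong }
            ; assoc = λ x y z → ≡⇒≈ λ n → ℚ.+-assoc (seq x n) (seq y n) (seq z n) }
          ; identity = (λ x → ≡⇒≈ λ n → ℚ.+-identityˡ (seq x n)) , (λ x → ≡⇒≈ λ n → ℚ.+-identityʳ (seq x n)) }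
        ; inverse = (λ x → ≡⇒≈ λ n → ℚ.+-inverseˡ (seq x n)) , (λ x → ≡⇒≈ λ n → ℚ.+-inverseʳ (seq x n))
        ; ⁻¹-cong = -‿cong }
      ; comm = λ x y → ≡⇒≈ λ n → ℚ.+-comm (seq x n) (seq y n) }
    ; *-cong = *-cong
    ; *-assoc = λ x y z → ≡⇒≈ λ n → ℚ.*-assoc (seq x n) (seq y n) (seq z n)
    ; *-identity = (λ x → ≡⇒≈ λ n → ℚ.*-identityˡ (seq x n)) , (λ x → ≡⇒≈ λ n → ℚ.*-identityʳ (seq x n))
    ; distrib = (λ x y z → ≡⇒≈ λ n → ℚ.*-distribˡ-+ (seq x n) (seq y n) (seq z n))
              , (λ x y z → ≡⇒≈ λ n → ℚ.*-distribʳ-+ (seq x n) (seq y n) (seq z n)) }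
  ; *-comm = λ x y → ≡⇒≈ λ n → ℚ.*-comm (seq x n) (seq y n) }

ℝ-commutativeRing : CommutativeRing 0ℓ 0ℓ
ℝ-commutativeRing = record { isCommutativeRing = ℝ-isCommutativeRing }

fromℚ-homo : ℚ.+-*-rawRing -Raw-AlmostCommutative⟶ fromCommutativeRing ℝ-commutativeRing
fromℚ-homo = record
  { ⟦_⟧ = fromℚ
  ; +-homo = λ p q → ≡⇒≈ λ _ → ≡.refl
  ; *-homo = λ p q → ≡⇒≈ λ _ → ≡.refl
  ; -‿homo = λ p → ≡⇒≈ λ _ → ≡.refl
  ; 0-homo = ≈-refl
  ; 1-homo = ≈-refl }

positive⇒invertible : ∀ x c → 0ℚ ℚ.< c → Eventually (λ n → c ℚ.≤ seq x n) → Invertible x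
positive⇒invertible x c 0<c (N , c≤x) = y , left , ≈-trans (CommutativeRing.*-comm ℝ-commutativeRing x y) left
  where
  z : ℕ → ℚ
  z n = seq x n ℚ.⊔ c
  c≤z : ∀ n → c ℚ.≤ z n
  c≤z n = ℚ.p≤q⊔p (seq x n) c
  0<z : ∀ n → 0ℚ ℚ.< z n
  0<z n = ℚ.<-≤-trans 0<c (c≤z n)
  instance
    c-positive = ℚ.positive 0<c
    c-nonZero = ℚ.pos⇒nonZero c
    z-positive : ∀ {n} → ℚ.Positive (z n)
    z-positive {n} = ℚ.positive (0<z n)
    z-nonZero : ∀ {n} → ℚ.NonZero (z n)
    z-nonZero {n} = ℚ.pos⇒nonZero (z n)
  c⁻¹ : ℚ
  c⁻¹ = ℚ.1/ c
  z⁻¹ : ℕ → ℚ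
  z⁻¹ n = ℚ.1/ z n
  z≡x : ∀ n → N ℕ.≤ n → z n ≡ seq x n
  z≡x n N≤n = ℚ.p≥q⇒p⊔q≡p (c≤x n N≤n)
  0≤z⁻¹ : ∀ n → 0ℚ ℚ.≤ z⁻¹ n
  0≤z⁻¹ n = ℚ.<⇒≤ (ℚ.positive⁻¹ (z⁻¹ n) {{ℚ.1/pos⇒pos (z n)}})
  z⁻¹≤c⁻¹ : ∀ n → z⁻¹ n ℚ.≤ c⁻¹
  z⁻¹≤c⁻¹ n = begin
    z⁻¹ n  ≡⟨ ℚ.*-identityʳ (z⁻¹ n) ⟨
    z⁻¹ n ℚ.* 1ℚ  ≡⟨ ≡.cong (z⁻¹ n ℚ.*_) (ℚ.*-inverseʳ c) ⟨
    z⁻¹ n ℚ.* (c ℚ.* c⁻¹)  ≤⟨ ℚ.*-monoˡ-≤-nonNeg (z⁻¹ n) {{ℚ.nonNegative (0≤z⁻¹ n)}}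
                                     (ℚ.*-monoʳ-≤-nonNeg c⁻¹ {{ℚ.pos⇒nonNeg c⁻¹ {{ℚ.1/pos⇒pos c}}}} (c≤z n)) ⟩
    z⁻¹ n ℚ.* (z n ℚ.* c⁻¹)  ≡⟨ ℚ.*-assoc (z⁻¹ n) (z n) c⁻¹ ⟨
    z⁻¹ n ℚ.* z n ℚ.* c⁻¹  ≡⟨ ≡.cong (ℚ._* c⁻¹) (ℚ.*-inverseˡ (z n)) ⟩
    1ℚ ℚ.* c⁻¹  ≡⟨ ℚ.*-identityˡ c⁻¹ ⟩
    c⁻¹  ∎
    where open ℚ.≤-Reasoning
  difference : ∀ m n → z⁻¹ m ℚ.- z⁻¹ n ≡ z⁻¹ m ℚ.* z⁻¹ n ℚ.* (z n ℚ.- z m)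
  difference m n = begin
    z⁻¹ m ℚ.- z⁻¹ n  ≡⟨ ≡.cong₂ ℚ._-_ (ℚ.*-identityʳ (z⁻¹ m)) (ℚ.*-identityʳ (z⁻¹ n)) ⟨
    z⁻¹ m ℚ.* 1ℚ ℚ.- z⁻¹ n ℚ.* 1ℚ  ≡⟨ ≡.cong₂ (λ p q → z⁻¹ m ℚ.* p ℚ.- z⁻¹ n ℚ.* q) (ℚ.*-inverseˡ (z n)) (ℚ.*-inverseˡ (z m)) ⟨
    z⁻¹ m ℚ.* (z⁻¹ n ℚ.* z n) ℚ.- z⁻¹ n ℚ.* (z⁻¹ m ℚ.* z m)
      ≡⟨ solve 4 (λ a b x y → a :* (b :* y) :- b :* (a :* x) := a :* b :* (y :- x)) ≡.refl (z⁻¹ m) (z⁻¹ n) (z m) (z n) ⟩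
    z⁻¹ m ℚ.* z⁻¹ n ℚ.* (z n ℚ.- z m)  ∎
    where
    open ℚS
    open ≡.≡-Reasoning
  z⁻¹-cauchy : Cauchy z⁻¹
  z⁻¹-cauchy ε 0<ε =
    let δ , 0<δ , eq = divide (c⁻¹ ℚ.* c⁻¹) ε (ℚ.positive⁻¹ _ {{ℚ.pos*pos⇒pos c⁻¹ {{ℚ.1/pos⇒pos c}} c⁻¹ {{ℚ.1/pos⇒pos c}}}}) 0<ε
        M , close = cauchy x δ 0<δ
    in M ℕ.⊔ N , λ m n hm hn → begin
      ℚ.∣ z⁻¹ m ℚ.- z⁻¹ n ∣
        ≡⟨ ≡.cong ℚ.∣_∣ (difference m n) ⟩
      ℚ.∣ z⁻¹ m ℚ.* z⁻¹ n ℚ.* (z n ℚ.- z m) ∣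
        ≡⟨ ℚ.∣p*q∣≡∣p∣*∣q∣ (z⁻¹ m ℚ.* z⁻¹ n) (z n ℚ.- z m) ⟩
      ℚ.∣ z⁻¹ m ℚ.* z⁻¹ n ∣ ℚ.* ℚ.∣ z n ℚ.- z m ∣
        ≡⟨ ≡.cong (ℚ._* ℚ.∣ z n ℚ.- z m ∣) (ℚ.0≤p⇒∣p∣≡p
             (ℚ.≤-trans (ℚ.≤-reflexive (≡.sym (ℚ.*-zeroˡ (z⁻¹ n)))) (ℚ.*-monoʳ-≤-nonNeg (z⁻¹ n) {{ℚ.nonNegative (0≤z⁻¹ n)}} (0≤z⁻¹ m)))) ⟩
      z⁻¹ m ℚ.* z⁻¹ n ℚ.* ℚ.∣ z n ℚ.- z m ∣
        ≡⟨ ≡.cong₂ (λ p q → z⁻¹ m ℚ.* z⁻¹ n ℚ.* ℚ.∣ p ℚ.- q ∣) (z≡x n (ℕ.m⊔n≤o⇒n≤o M N hn)) (z≡x m (ℕ.m⊔n≤o⇒n≤o M N hm)) ⟩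
      z⁻¹ m ℚ.* z⁻¹ n ℚ.* ℚ.∣ seq x n ℚ.- seq x m ∣
        ≤⟨ *-mono-≤-nonNeg
             (ℚ.≤-trans (ℚ.≤-reflexive (≡.sym (ℚ.*-zeroˡ (z⁻¹ n)))) (ℚ.*-monoʳ-≤-nonNeg (z⁻¹ n) {{ℚ.nonNegative (0≤z⁻¹ n)}} (0≤z⁻¹ m)))
             (*-mono-≤-nonNeg (0≤z⁻¹ m) (z⁻¹≤c⁻¹ m) (0≤z⁻¹ n) (z⁻¹≤c⁻¹ n))
             (ℚ.0≤∣p∣ _) (close n m (ℕ.m⊔n≤o⇒m≤o M N hn) (ℕ.m⊔n≤o⇒m≤o M N hm)) ⟩
      c⁻¹ ℚ.* c⁻¹ ℚ.* δ
        ≡⟨ eq ⟩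
      ε ∎
    where open ℚ.≤-Reasoning
  y : ℝ
  y = mkℝ z⁻¹ z⁻¹-cauchy
  left : y * x ≈ 1ℝ
  left = mk≈ λ ε 0<ε → N , λ n N≤n → ≡.subst (ℚ._≤ ε)
    (≡.sym (≡.cong (λ q → ℚ.∣ q ℚ.- 1ℚ ∣) (≡.trans (≡.cong (z⁻¹ n ℚ.*_) (≡.sym (z≡x n N≤n))) (ℚ.*-inverseˡ (z n))))) (ℚ.<⇒≤ 0<ε)

-- The Gamma function at half-integers

module ℝA = ℚAlgebra ℝ-commutativeRing fromℚ-homo

open CommutativeRing ℝ-commutativeRing using (+-congˡ; *-congˡ; *-congʳ; *-assoc; *-comm; *-identityˡ; *-identityʳ; +-identityˡ; +-identityʳ; zeroˡ; distribˡ; reflexive)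

invertible-cong : ∀ {x y} → x ≈ y → Invertible x → Invertible y
invertible-cong x≈y (z , l , r) = z , ≈-trans (*-congˡ (≈-sym x≈y)) l , ≈-trans (*-congʳ (≈-sym x≈y)) r

invertible-* : ∀ {x y} → Invertible x → Invertible y → Invertible (x * y)
invertible-* {x} {y} (a , la , ra) (b , lb , rb) = a * b , ≈-trans (≡⇒≈ λ n → swap (seq a n) (seq b n) (seq x n) (seq y n)) one
  , ≈-trans (≡⇒≈ λ n → swap′ (seq a n) (seq b n) (seq x n) (seq y n)) one
  where
  open ℚS
  swap : ∀ a b x y → a ℚ.* b ℚ.* (x ℚ.* y) ≡ a ℚ.* x ℚ.* (b ℚ.* y)
  swap = solve 4 (λ a b x y → a :* b :* (x :* y) := a :* x :* (b :* y)) ≡.refl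
  swap′ : ∀ a b x y → x ℚ.* y ℚ.* (a ℚ.* b) ≡ a ℚ.* x ℚ.* (b ℚ.* y)
  swap′ = solve 4 (λ a b x y → x :* y :* (a :* b) := a :* x :* (b :* y)) ≡.refl
  one : a * x * (b * y) ≈ 1ℝ
  one = ≈-trans (*-cong la lb) (*-identityˡ 1ℝ)

[]-invertible : ∀ n .{{_ : ℕ.NonZero n}} → Invertible (fromℕ′ n)
[]-invertible n = ℝA.⅟ n , ℝA.⅟-inverse n , ≈-trans (*-comm _ _) (ℝA.⅟-inverse n)

⅟-invertible : ∀ n .{{_ : ℕ.NonZero n}} → Invertible (ℝA.⅟ n)
⅟-invertible n = fromℕ′ n , ≈-trans (*-comm (fromℕ′ n) (ℝA.⅟ n)) (ℝA.⅟-inverse n) , ℝA.⅟-inverse n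

limit : ∀ {u x} → (fromℚ ∘ u) ⟶ x → Σ[ c ∈ Cauchy u ] x ≈ mkℝ u c
limit {u} {x} u⟶x = u-cauchy , mk≈ λ ε 0<ε →
  let N , close = u-cauchy (½ ℚ.* ε) (halve 0<ε)
      M , near = u⟶x (½ ℚ.* (½ ℚ.* ε)) (halve (halve 0<ε))
      K , nearer = eventually-below (near (M ℕ.⊔ N) (ℕ.m≤m⊔n M N)) (½ ℚ.* (½ ℚ.* ε)) (halve (halve 0<ε))
  in K ℕ.⊔ N , λ k h → ℚ.≤-trans (triangle (seq x k) (u (M ℕ.⊔ N)) (u k))
    (≤-halves
      (≡.subst (ℚ._≤ ½ ℚ.* ε) (∣-∣-swap (u (M ℕ.⊔ N)) (seq x k))
        (ℚ.≤-trans (nearer k (ℕ.m⊔n≤o⇒m≤o K N h)) (ℚ.≤-reflexive (halves (½ ℚ.* ε)))))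
      (close (M ℕ.⊔ N) k (ℕ.m≤n⊔m M N) (ℕ.m⊔n≤o⇒n≤o K N h)))
  where
  u-cauchy : Cauchy u
  u-cauchy ε 0<ε =
    let q = ½ ℚ.* (½ ℚ.* ε)
        0<q = halve (halve 0<ε)
        N , near = u⟶x q 0<q
    in N , λ m n N≤m N≤n →
      let K , near-m = eventually-below (near m N≤m) q 0<q
          L , near-n = eventually-below (near n N≤n) q 0<q
          k = K ℕ.⊔ L
      in ℚ.≤-trans (triangle (u m) (seq x k) (u n)) (≤-halves
           (ℚ.≤-trans (near-m k (ℕ.m≤m⊔n K L)) (ℚ.≤-reflexive (halves (½ ℚ.* ε))))
           (≡.subst (ℚ._≤ ½ ℚ.* ε) (∣-∣-swap (u n) (seq x k))
             (ℚ.≤-trans (near-n k (ℕ.m≤n⊔m K L)) (ℚ.≤-reflexive (halves (½ ℚ.* ε))))))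

/1-mono : ∀ {m n} → m ℕ.≤ n → + m ℚ./ 1 ℚ.≤ + n ℚ./ 1
/1-mono {m} {n} m≤n = ℚ.toℚᵘ-cancel-≤ (ℚᵘ.≤-respʳ-≃ (ℚᵘ.≃-sym (toℚᵘ-/ (+ n) 0)) (ℚᵘ.≤-respˡ-≃ (ℚᵘ.≃-sym (toℚᵘ-/ (+ m) 0))
  (ℚᵘ.*≤* (ℤ.*-monoʳ-≤-nonNeg (+ 1) (ℤ.+≤+ m≤n)))))

0≤/1 : ∀ n → 0ℚ ℚ.≤ + n ℚ./ 1
0≤/1 n = /1-mono {0} {n} ℕ.z≤n

archimedean : ∀ p → Σ[ n ∈ ℕ ] p ℚ.≤ + n ℚ./ 1
archimedean p@(ℚ.mkℚ (+ n) d _) = n , ℚ.toℚᵘ-cancel-≤ (ℚᵘ.≤-respʳ-≃ (ℚᵘ.≃-sym (toℚᵘ-/ (+ n) 0)) (ℚᵘ.*≤*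
  (ℤ.*-monoˡ-≤-nonNeg (+ n) (ℤ.+≤+ (ℕ.s≤s ℕ.z≤n)))))
archimedean p@(ℚ.mkℚ (ℤ.-[1+ n ]) d _) = 0 , ℚ.<⇒≤ (ℚ.negative⁻¹ p)

stepProduct-shift : ∀ q N → stepProduct (2 ℕ.+ q) N ℕ.* suc q ≡ stepProduct q N ℕ.* (3 ℕ.+ q ℕ.+ 2 ℕ.* N)
stepProduct-shift q zero = solve 1 (λ q → (con 3 :+ q) :* (con 1 :+ q) := (con 1 :+ q) :* (con 3 :+ q :+ con 0)) ≡.refl q
  where open ℕS
stepProduct-shift q (suc N) = begin
  S′ ℕ.* (3 ℕ.+ q ℕ.+ 2 ℕ.* suc N) ℕ.* suc q
    ≡⟨ solve 3 (λ s a b → s :* a :* b := s :* b :* a) ≡.refl S′ (3 ℕ.+ q ℕ.+ 2 ℕ.* suc N) (suc q) ⟩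
  S′ ℕ.* suc q ℕ.* (3 ℕ.+ q ℕ.+ 2 ℕ.* suc N)
    ≡⟨ ≡.cong (ℕ._* (3 ℕ.+ q ℕ.+ 2 ℕ.* suc N)) (stepProduct-shift q N) ⟩
  S ℕ.* (3 ℕ.+ q ℕ.+ 2 ℕ.* N) ℕ.* (3 ℕ.+ q ℕ.+ 2 ℕ.* suc N)
    ≡⟨ ≡.cong (λ z → S ℕ.* z ℕ.* (3 ℕ.+ q ℕ.+ 2 ℕ.* suc N))
         (solve 2 (λ q n → con 3 :+ q :+ con 2 :* n := con 1 :+ q :+ con 2 :* (con 1 :+ n)) ≡.refl q N) ⟩
  S ℕ.* (suc q ℕ.+ 2 ℕ.* suc N) ℕ.* (3 ℕ.+ q ℕ.+ 2 ℕ.* suc N) ∎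
  where
  open ℕS
  open ≡.≡-Reasoning
  S = stepProduct q N
  S′ = stepProduct (2 ℕ.+ q) N

gaussNumerator : ℕ → ℕ → ℕ
gaussNumerator q M = 2 ℕ.^ suc (M ℕ.* M) ℕ.* (M ℕ.* M) ! ℕ.* M ℕ.^ suc q

gaussTerm-cancel : ∀ q M → gaussTerm q M ℚ.* (+ stepProduct q (M ℕ.* M) ℚ./ 1) ≡ + gaussNumerator q M ℚ./ 1
gaussTerm-cancel q M = /-*-cancel (gaussNumerator q M) (stepProduct q (M ℕ.* M)) {{stepProduct≢0 q (M ℕ.* M)}}

/1-cancelʳ : ∀ n .{{_ : ℕ.NonZero n}} {p q} → p ℚ.* (+ n ℚ./ 1) ≡ q ℚ.* (+ n ℚ./ 1) → p ≡ q
/1-cancelʳ n {p} {q} eq = ≡.trans (≡.sym (undo p)) (≡.trans (≡.cong (ℚ._* (+ 1 ℚ./ n)) eq) (undo q))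
  where
  undo : ∀ p → p ℚ.* (+ n ℚ./ 1) ℚ.* (+ 1 ℚ./ n) ≡ p
  undo p = ≡.trans (ℚ.*-assoc p _ _) (≡.trans
    (≡.cong (p ℚ.*_) (≡.trans (ℚ.*-comm (+ n ℚ./ 1) (+ 1 ℚ./ n)) (/-*-cancel 1 n))) (ℚ.*-identityʳ p))

gaussTerm-shift : ∀ q M → gaussTerm (2 ℕ.+ q) M ℚ.* (+ (3 ℕ.+ q ℕ.+ 2 ℕ.* (M ℕ.* M)) ℚ./ 1)
                        ≡ gaussTerm q M ℚ.* (+ (M ℕ.* M ℕ.* suc q) ℚ./ 1)
gaussTerm-shift q M = /1-cancelʳ S {{stepProduct≢0 q (M ℕ.* M)}} (begin
  b ℚ.* r T ℚ.* r S  ≡⟨ solve 3 (λ b t s → b :* t :* s := b :* (s :* t)) ≡.refl b (r T) (r S) ⟩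
  b ℚ.* (r S ℚ.* r T)  ≡⟨ ≡.cong (b ℚ.*_) (/1-* S T) ⟨
  b ℚ.* r (S ℕ.* T)  ≡⟨ ≡.cong (λ z → b ℚ.* r z) (stepProduct-shift q (M ℕ.* M)) ⟨
  b ℚ.* r (S′ ℕ.* suc q)  ≡⟨ ≡.cong (b ℚ.*_) (/1-* S′ (suc q)) ⟩
  b ℚ.* (r S′ ℚ.* r (suc q))  ≡⟨ ℚ.*-assoc b (r S′) (r (suc q)) ⟨
  b ℚ.* r S′ ℚ.* r (suc q)  ≡⟨ ≡.cong (ℚ._* r (suc q)) (gaussTerm-cancel (2 ℕ.+ q) M) ⟩
  r (gaussNumerator (2 ℕ.+ q) M) ℚ.* r (suc q)
    ≡⟨ /1-* (gaussNumerator (2 ℕ.+ q) M) (suc q) ⟨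
  r (gaussNumerator (2 ℕ.+ q) M ℕ.* suc q)
    ≡⟨ ≡.cong r (ℕS.solve 4 (λ x m p q → x ℕS.:* (m ℕS.:* (m ℕS.:* p)) ℕS.:* q ℕS.:= x ℕS.:* p ℕS.:* (m ℕS.:* m ℕS.:* q)) ≡.refl
         (2 ℕ.^ suc (M ℕ.* M) ℕ.* (M ℕ.* M) !) M (M ℕ.^ suc q) (suc q)) ⟩
  r (gaussNumerator q M ℕ.* (M ℕ.* M ℕ.* suc q))
    ≡⟨ /1-* (gaussNumerator q M) (M ℕ.* M ℕ.* suc q) ⟩
  r (gaussNumerator q M) ℚ.* r (M ℕ.* M ℕ.* suc q)
    ≡⟨ ≡.cong (ℚ._* r (M ℕ.* M ℕ.* suc q)) (gaussTerm-cancel q M) ⟨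
  a ℚ.* r S ℚ.* r (M ℕ.* M ℕ.* suc q)  ≡⟨ solve 3 (λ b t s → b :* t :* s := b :* s :* t) ≡.refl a (r S) (r (M ℕ.* M ℕ.* suc q)) ⟩
  a ℚ.* r (M ℕ.* M ℕ.* suc q) ℚ.* r S  ∎)
  where
  open ℚS
  open ≡.≡-Reasoning
  r : ℕ → ℚ
  r n = + n ℚ./ 1
  a = gaussTerm q M
  b = gaussTerm (2 ℕ.+ q) M
  S = stepProduct q (M ℕ.* M)
  S′ = stepProduct (2 ℕ.+ q) (M ℕ.* M)
  T = 3 ℕ.+ q ℕ.+ 2 ℕ.* (M ℕ.* M)

module _ (q : ℕ) where

  private
    r : ℕ → ℚ
    r n = + n ℚ./ 1

    a b : ℕ → ℚ
    a = gaussTerm q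
    b = gaussTerm (2 ℕ.+ q)

    N : ℕ → ℕ
    N M = M ℕ.* M

    defect : ℕ → ℚ
    defect M = r 2 ℚ.* b M ℚ.- r (suc q) ℚ.* a M

    defect-scaled : ∀ M → r (N M) ℚ.* defect M ≡ ℚ.- (r (3 ℕ.+ q) ℚ.* b M)
    defect-scaled M = begin
      r (N M) ℚ.* defect M
        ≡⟨ solve 5 (λ n b p a t → n :* (con (r 2) :* b :- p :* a) := (b :* (t :+ con (r 2) :* n) :- a :* (n :* p)) :+ (:- (t :* b)))
             ≡.refl (r (N M)) (b M) (r (suc q)) (a M) (r (3 ℕ.+ q)) ⟩
      (b M ℚ.* (r (3 ℕ.+ q) ℚ.+ r 2 ℚ.* r (N M)) ℚ.- a M ℚ.* (r (N M) ℚ.* r (suc q))) ℚ.+ rest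
        ≡⟨ ≡.cong₂ (λ x y → (b M ℚ.* x ℚ.- a M ℚ.* y) ℚ.+ rest)
             (≡.trans (/1-+ (3 ℕ.+ q) (2 ℕ.* N M)) (≡.cong (r (3 ℕ.+ q) ℚ.+_) (/1-* 2 (N M)))) (/1-* (N M) (suc q)) ⟨
      (b M ℚ.* r (3 ℕ.+ q ℕ.+ 2 ℕ.* N M) ℚ.- a M ℚ.* r (N M ℕ.* suc q)) ℚ.+ rest
        ≡⟨ ≡.cong (λ x → (x ℚ.- a M ℚ.* r (N M ℕ.* suc q)) ℚ.+ rest) (gaussTerm-shift q M) ⟩
      (a M ℚ.* r (N M ℕ.* suc q) ℚ.- a M ℚ.* r (N M ℕ.* suc q)) ℚ.+ rest
        ≡⟨ ≡.cong (ℚ._+ rest) (ℚ.+-inverseʳ (a M ℚ.* r (N M ℕ.* suc q))) ⟩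
      0ℚ ℚ.+ rest
        ≡⟨ ℚ.+-identityˡ rest ⟩
      rest ∎
      where
      open ℚS
      open ≡.≡-Reasoning
      rest = ℚ.- (r (3 ℕ.+ q) ℚ.* b M)

    defect-small : ∀ {K} → 0ℚ ℚ.< K → Eventually (λ M → ℚ.∣ b M ∣ ℚ.≤ K) → ∀ ε → 0ℚ ℚ.< ε → Eventually (λ M → ℚ.∣ defect M ∣ ℚ.≤ ε)
    defect-small {K} 0<K (L , b≤K) ε 0<ε =
      let y , _ , εy = divide ε (r (3 ℕ.+ q) ℚ.* K) 0<ε 0<rK
          n , y≤n = archimedean y
      in L ℕ.⊔ suc n , λ M h →
        let n<M = ℕ.m⊔n≤o⇒n≤o L (suc n) h
            M≤N = ℕ.m≤m*n M M {{ℕ.>-nonZero (ℕ.≤-trans (ℕ.s≤s ℕ.z≤n) n<M)}}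
            0<N = ℕ.≤-trans (ℕ.s≤s ℕ.z≤n) (ℕ.≤-trans n<M M≤N)
            instance
              _ = ℚ.normalize-pos (N M) 1 {{_}} {{ℕ.>-nonZero 0<N}}
              _ = ℚ.pos⇒nonNeg ε {{ℚ.positive 0<ε}}
        in ℚ.*-cancelˡ-≤-pos (r (N M)) (begin
          r (N M) ℚ.* ℚ.∣ defect M ∣  ≡⟨ ≡.cong (ℚ._* ℚ.∣ defect M ∣) (ℚ.0≤p⇒∣p∣≡p (0≤/1 (N M))) ⟨
          ℚ.∣ r (N M) ∣ ℚ.* ℚ.∣ defect M ∣  ≡⟨ ℚ.∣p*q∣≡∣p∣*∣q∣ (r (N M)) (defect M) ⟨
          ℚ.∣ r (N M) ℚ.* defect M ∣  ≡⟨ ≡.cong ℚ.∣_∣ (defect-scaled M) ⟩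
          ℚ.∣ ℚ.- (r (3 ℕ.+ q) ℚ.* b M) ∣  ≡⟨ ℚ.∣-p∣≡∣p∣ (r (3 ℕ.+ q) ℚ.* b M) ⟩
          ℚ.∣ r (3 ℕ.+ q) ℚ.* b M ∣  ≡⟨ ℚ.∣p*q∣≡∣p∣*∣q∣ (r (3 ℕ.+ q)) (b M) ⟩
          ℚ.∣ r (3 ℕ.+ q) ∣ ℚ.* ℚ.∣ b M ∣  ≡⟨ ≡.cong (ℚ._* ℚ.∣ b M ∣) (ℚ.0≤p⇒∣p∣≡p (0≤/1 (3 ℕ.+ q))) ⟩
          r (3 ℕ.+ q) ℚ.* ℚ.∣ b M ∣
            ≤⟨ ℚ.*-monoˡ-≤-nonNeg (r (3 ℕ.+ q)) {{ℚ.nonNegative (0≤/1 (3 ℕ.+ q))}} (b≤K M (ℕ.m⊔n≤o⇒m≤o L (suc n) h)) ⟩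
          r (3 ℕ.+ q) ℚ.* K  ≡⟨ εy ⟨
          ε ℚ.* y  ≤⟨ ℚ.*-monoˡ-≤-nonNeg ε (ℚ.≤-trans y≤n (/1-mono (ℕ.≤-trans (ℕ.n≤1+n n) (ℕ.≤-trans n<M M≤N)))) ⟩
          ε ℚ.* r (N M)  ≡⟨ ℚ.*-comm ε (r (N M)) ⟩
          r (N M) ℚ.* ε  ∎)
      where
      open ℚ.≤-Reasoning
      0<rK : 0ℚ ℚ.< r (3 ℕ.+ q) ℚ.* K
      0<rK = ℚ.positive⁻¹ _ {{ℚ.pos*pos⇒pos (r (3 ℕ.+ q)) {{ℚ.normalize-pos (3 ℕ.+ q) 1}} K {{ℚ.positive 0<K}}}}

  Γ-shift : ∀ Γ½ → IsGammaAtHalves Γ½ → fromℕ′ 2 * Γ½ (3 ℕ.+ q) ≈ fromℕ′ (suc q) * Γ½ (suc q)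
  Γ-shift Γ½ isΓ =
    let ca , Γa = limit (isΓ q)
        cb , Γb = limit (isΓ (2 ℕ.+ q))
        K , 0<K , b≤K = eventually-bounded (mkℝ b cb)
        limits : fromℕ′ 2 * mkℝ b cb ≈ fromℕ′ (suc q) * mkℝ a ca
        limits = mk≈ (defect-small 0<K b≤K)
    in ≈-trans (*-congˡ Γb) (≈-trans limits (*-congˡ (≈-sym Γa)))

stepProduct₀ : ∀ N → stepProduct 0 N ℕ.* stepProduct 0 N
                   ℕ.≤ 2 ℕ.^ N ℕ.* N ! ℕ.* (2 ℕ.^ N ℕ.* N !) ℕ.* (1 ℕ.+ 2 ℕ.* N)
stepProduct₀ zero = ℕ.≤-refl
stepProduct₀ (suc N) = begin
  S ℕ.* T ℕ.* (S ℕ.* T)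
    ≡⟨ solve 2 (λ s t → s :* t :* (s :* t) := s :* s :* (t :* t)) ≡.refl S T ⟩
  S ℕ.* S ℕ.* (T ℕ.* T)
    ≤⟨ ℕ.*-monoˡ-≤ (T ℕ.* T) (stepProduct₀ N) ⟩
  Q ℕ.* Q ℕ.* (1 ℕ.+ 2 ℕ.* N) ℕ.* (T ℕ.* T)
    ≤⟨ ℕ.m≤m+n _ (Q ℕ.* Q ℕ.* T) ⟩
  Q ℕ.* Q ℕ.* (1 ℕ.+ 2 ℕ.* N) ℕ.* (T ℕ.* T) ℕ.+ Q ℕ.* Q ℕ.* T
    ≡⟨ solve 3 (λ p f n → let q = p :* f ; t = con 1 :+ con 2 :* (con 1 :+ n) ; q′ = con 2 :* p :* ((con 1 :+ n) :* f) in
         q :* q :* (con 1 :+ con 2 :* n) :* (t :* t) :+ q :* q :* t := q′ :* q′ :* t) ≡.refl (2 ℕ.^ N) (N !) N ⟩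
  2 ℕ.^ suc N ℕ.* suc N ! ℕ.* (2 ℕ.^ suc N ℕ.* suc N !) ℕ.* T ∎
  where
  open ℕS
  open ℕ.≤-Reasoning
  S = stepProduct 0 N
  T = 1 ℕ.+ 2 ℕ.* suc N
  Q = 2 ℕ.^ N ℕ.* N !

stepProduct₁ : ∀ N → stepProduct 1 N ≡ 2 ℕ.^ suc N ℕ.* N ! ℕ.* suc N
stepProduct₁ zero = ≡.refl
stepProduct₁ (suc N) = ≡.trans (≡.cong (ℕ._* (2 ℕ.+ 2 ℕ.* suc N)) (stepProduct₁ N))
  (solve 3 (λ p f n → p :* f :* (con 1 :+ n) :* (con 2 :+ con 2 :* (con 1 :+ n)) := con 2 :* p :* ((con 1 :+ n) :* f) :* (con 2 :+ n)) ≡.refl (2 ℕ.^ suc N) (N !) N)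
  where open ℕS

square-cancel-≤ : ∀ {m n} → m ℕ.* m ℕ.≤ n ℕ.* n → m ℕ.≤ n
square-cancel-≤ {m} {n} h with ℕ.≤-<-connex m n
... | inj₁ m≤n = m≤n
... | inj₂ n<m = ⊥-elim (ℕ.<⇒≱ (ℕ.*-mono-< n<m n<m) h)

gauss-lower₀ : ∀ M → 1 ℕ.≤ M → stepProduct 0 (M ℕ.* M) ℕ.≤ 2 ℕ.* gaussNumerator 0 M
gauss-lower₀ M 1≤M = square-cancel-≤ (begin
  S ℕ.* S  ≤⟨ stepProduct₀ N ⟩
  Q ℕ.* Q ℕ.* (1 ℕ.+ 2 ℕ.* N)  ≤⟨ ℕ.*-monoʳ-≤ (Q ℕ.* Q) (ℕ.+-monoˡ-≤ (2 ℕ.* N) (ℕ.*-mono-≤ 1≤M 1≤M)) ⟩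
  Q ℕ.* Q ℕ.* (N ℕ.+ 2 ℕ.* N)  ≤⟨ ℕ.m≤m+n _ (13 ℕ.* (Q ℕ.* Q ℕ.* N)) ⟩
  Q ℕ.* Q ℕ.* (N ℕ.+ 2 ℕ.* N) ℕ.+ 13 ℕ.* (Q ℕ.* Q ℕ.* N)
    ≡⟨ solve 3 (λ p f m → let q = p :* f ; n = m :* m ; a = con 2 :* (con 2 :* p :* f :* (m :* con 1)) in
         q :* q :* (n :+ con 2 :* n) :+ con 13 :* (q :* q :* n) := a :* a) ≡.refl (2 ℕ.^ N) (N !) M ⟩
  2 ℕ.* gaussNumerator 0 M ℕ.* (2 ℕ.* gaussNumerator 0 M) ∎)
  where
  open ℕS
  open ℕ.≤-Reasoning
  N = M ℕ.* M
  S = stepProduct 0 N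
  Q = 2 ℕ.^ N ℕ.* N !

gauss-lower₁ : ∀ M → 1 ℕ.≤ M → stepProduct 1 (M ℕ.* M) ℕ.≤ 2 ℕ.* gaussNumerator 1 M
gauss-lower₁ M 1≤M = begin
  stepProduct 1 N  ≡⟨ stepProduct₁ N ⟩
  Q ℕ.* suc N  ≤⟨ ℕ.*-monoʳ-≤ Q (ℕ.+-monoˡ-≤ N (ℕ.*-mono-≤ 1≤M 1≤M)) ⟩
  Q ℕ.* (N ℕ.+ N)  ≡⟨ solve 2 (λ q m → q :* (m :* m :+ m :* m) := con 2 :* (q :* (m :* (m :* con 1)))) ≡.refl Q M ⟩
  2 ℕ.* gaussNumerator 1 M  ∎
  where
  open ℕS
  open ℕ.≤-Reasoning
  N = M ℕ.* M
  Q = 2 ℕ.^ suc N ℕ.* N !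

½≤gaussTerm : ∀ q M → stepProduct q (M ℕ.* M) ℕ.≤ 2 ℕ.* gaussNumerator q M → ½ ℚ.≤ gaussTerm q M
½≤gaussTerm q M S≤2A = ℚ.*-cancelʳ-≤-pos (+ S ℚ./ 1) {{ℚ.normalize-pos S 1 {{_}} {{stepProduct≢0 q (M ℕ.* M)}}}} (begin
  ½ ℚ.* (+ S ℚ./ 1)  ≤⟨ ℚ.*-monoˡ-≤-nonNeg ½ (/1-mono S≤2A) ⟩
  ½ ℚ.* (+ (2 ℕ.* A) ℚ./ 1)  ≡⟨ ≡.cong (½ ℚ.*_) (/1-* 2 A) ⟩
  ½ ℚ.* ((+ 2 ℚ./ 1) ℚ.* (+ A ℚ./ 1))  ≡⟨ solve 1 (λ a → con ½ :* (con (+ 2 ℚ./ 1) :* a) := a) ≡.refl (+ A ℚ./ 1) ⟩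
  + A ℚ./ 1  ≡⟨ gaussTerm-cancel q M ⟨
  gaussTerm q M ℚ.* (+ S ℚ./ 1)  ∎)
  where
  open ℚS
  open ℚ.≤-Reasoning
  S = stepProduct q (M ℕ.* M)
  A = gaussNumerator q M

module _ {Γ½ : ℕ → ℝ} (isΓ : IsGammaAtHalves Γ½) where

  private
    base : ∀ q → (∀ M → 1 ℕ.≤ M → stepProduct q (M ℕ.* M) ℕ.≤ 2 ℕ.* gaussNumerator q M) → Invertible (Γ½ (suc q))
    base q lower = let c , Γ≈ = limit (isΓ q) in invertible-cong (≈-sym Γ≈)
      (positive⇒invertible (mkℝ (gaussTerm q) c) ½ (ℚ.positive⁻¹ ½) (1 , λ M 1≤M → ½≤gaussTerm q M (lower M 1≤M)))

  Γ-invertible : ∀ q → Invertible (Γ½ (suc q))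
  Γ-invertible zero          = base 0 gauss-lower₀
  Γ-invertible (suc zero)    = base 1 gauss-lower₁
  Γ-invertible (suc (suc q)) = invertible-cong eq (invertible-* (⅟-invertible 2) (invertible-* ([]-invertible (suc q)) (Γ-invertible q)))
    where
    eq : ℝA.⅟ 2 * (fromℕ′ (suc q) * Γ½ (suc q)) ≈ Γ½ (3 ℕ.+ q)
    eq = ≈-trans (*-congˡ (≈-sym (Γ-shift q Γ½ isΓ))) (≈-trans (≈-sym (*-assoc (ℝA.⅟ 2) (fromℕ′ 2) (Γ½ (3 ℕ.+ q))))
      (≈-trans (*-congʳ (ℝA.⅟-inverse 2)) (*-identityˡ (Γ½ (3 ℕ.+ q)))))

-- Zonal harmonics

module ℝM = PlaneMatrices ℝ-commutativeRing fromℚ-homo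
module ℝF = FormEvaluation ℝ-commutativeRing fromℚ-homo
module ℝB = BoxPolynomial ℝ-commutativeRing fromℚ-homo

open Algebra.Properties.Semiring.Sum (CommutativeRing.semiring ℝ-commutativeRing) using (sum-cong-≋)

det≈determinant : ∀ {n} (A : Matrix n) → det A ≈ ℝM.determinant A
det≈determinant {zero}  A = ≈-refl
det≈determinant {suc n} A = sum-cong-≋ {suc n}
  {λ j → (- 1ℝ) ^ toℕ j * A zero j * det (λ i k → A (suc i) (Fin.punchIn j k))}
  {λ j → (- 1ℝ) ^ toℕ j * A zero j * ℝM.determinant (λ i k → A (suc i) (Fin.punchIn j k))}
  (λ j → *-congˡ {(- 1ℝ) ^ toℕ j * A zero j} (det≈determinant (λ i k → A (suc i) (Fin.punchIn j k))))

rotation-specialOrthogonal : ∀ {n} (i : Fin n) c s → c * c + s * s ≈ 1ℝ → SpecialOrthogonal (ℝM.rotation i c s)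
rotation-specialOrthogonal i c s unit = ℝM.rotation-orthogonal {c} {s} unit i
  , ≈-trans (det≈determinant (ℝM.rotation i c s)) (ℝM.rotation-determinant {c} {s} unit i)

module ZonalInvariance {m d : ℕ} (L : Form (2 ℕ.+ m) d) (isZonal : IsZonalHarmonic L) where

  open ℝB

  g : Coefficients (2 ℕ.+ m)
  g = coeff L

  B : ℕ
  B = 3 ℕ.+ d

  value : ∀ x → ⟦ L ⟧ x ≈ box B g x
  value x = ℝF.form-value-box d 2 g (homogeneous L) x

  g-bounded : Bounded B g
  g-bounded α B≤ = homogeneous L α (λ eq → ℕ.<-irrefl ≡.refl (ℕ.≤-trans (ℕ.m≤n+m (suc d) 2) (ℕ.≤-trans B≤ (ℕ.≤-reflexive eq))))

  box-invariant : ∀ A → FixesPole A → ∀ x y → (∀ j → (A · x) j ≈ y j) → box B g y ≈ box B g x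
  box-invariant A fixes x y Ax≈y = ≈-trans (box-cong B {g} {g} {y} {A · x} (λ _ → ≈-refl) (λ j → ≈-sym (Ax≈y j)))
    (≈-trans (≈-sym (value (A · x))) (≈-trans (IsZonalHarmonic.invariant isZonal A fixes x) (value x)))

  rotate-invariant : ∀ (i : Fin m) c s → c * c + s * s ≈ 1ℝ → ∀ x → box B g (rotate (inject₁ i) c s x) ≈ box B g x
  rotate-invariant i c s unit x = box-invariant (ℝM.rotation (inject₁ i) c s)
    ( proj₁ special , (λ _ → proj₂ special)
    , λ j → ≈-trans (ℝM.rotation-rotates (inject₁ i) c s (e (fromℕ (suc m))) j) (ℝM.rotate-pole i c s j))
    x (rotate (inject₁ i) c s x) (ℝM.rotation-rotates (inject₁ i) c s x)
    where
    special : SpecialOrthogonal (ℝM.rotation (inject₁ i) c s)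
    special = rotation-specialOrthogonal (inject₁ i) c s unit

zonal-symmetric : ∀ m {d} (L : Form (2 ℕ.+ m) d) → IsZonalHarmonic L → ∀ k → ℝB.Symmetric (λ β → coeff L (β Vec.∷ʳ k))
zonal-symmetric zero {d} L isZonal k = ℝB.reflection⇒symmetric {B} {λ β → g (β Vec.∷ʳ k)} (∷ʳ-bounded {g = g} g-bounded k)
  (λ x → ∷ʳ-unique {g = g} g-bounded { - x ℝB.◂ λ ()} {x ℝB.◂ λ ()} (λ z →
    box-invariant ℝM.reflection (ℝM.reflection-orthogonal , (λ { (ℕ.s≤s (ℕ.s≤s ())) }) , ℝM.reflection-pole)
      (snoc (x ℝB.◂ λ ()) z) (snoc (- x ℝB.◂ λ ()) z) (reflects x z)) k)
  where
  open ZonalInvariance L isZonal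
  open SymmetricHarmonic ℝ-commutativeRing fromℚ-homo 0
  reflects : ∀ x z j → (ℝM.reflection · snoc (x ℝB.◂ λ ()) z) j ≈ snoc (- x ℝB.◂ λ ()) z j
  reflects x z zero       = ℝM.reflection-zero (snoc (x ℝB.◂ λ ()) z)
  reflects x z (suc zero) = ℝM.reflection-one (snoc (x ℝB.◂ λ ()) z)
zonal-symmetric (suc m) L isZonal k = record
  { exchange = ℝB.invariant⇒exchange {g = f} f-bounded f-invariant
  ; even     = ℝB.invariant⇒even {g = f} f-bounded f-invariant }
  where
  open ZonalInvariance L isZonal
  open SymmetricHarmonic ℝ-commutativeRing fromℚ-homo (suc m)
  f : ℝB.Coefficients (2 ℕ.+ m)
  f β = g (β Vec.∷ʳ k)
  f-bounded : ℝB.Bounded B f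
  f-bounded = ∷ʳ-bounded {g = g} g-bounded k
  f-invariant : ℝB.Invariant B f
  f-invariant = ∷ʳ-invariant {g = g} g-bounded rotate-invariant k

module _ {m d : ℕ} (L : Form (2 ℕ.+ m) d) (isZonal : IsZonalHarmonic L) where

  open SymmetricHarmonic ℝ-commutativeRing fromℚ-homo m
  open ZonalExpansion ℝ-commutativeRing fromℚ-homo m using (Z)
  open ZonalInvariance L isZonal

  private
    module F = ZonalForm d g (homogeneous L) (zonal-symmetric m L isZonal)
      (λ k β → ≈-trans (≈-sym (laplacian-∷ʳ g β k)) (IsZonalHarmonic.harmonic isZonal (β Vec.∷ʳ k)))

    pole : Space (2 ℕ.+ m)
    pole = e (fromℕ (suc m))

    last-one : ∀ n → e (fromℕ n) (fromℕ n) ≈ 1ℝ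
    last-one zero    = ≈-refl
    last-one (suc n) = last-one n

    init-zero : ∀ n (j : Fin n) → e (fromℕ n) (inject₁ j) ≈ 0ℝ
    init-zero (suc n) zero    = ≈-refl
    init-zero (suc n) (suc j) = init-zero n j

    c₀≈1 : F.c₀ ≈ 1ℝ
    c₀≈1 = ≈-trans (≈-sym (*-identityʳ F.c₀)) (≈-trans
      (*-congˡ {F.c₀} (≈-sym (Z-pole {pole (fromℕ (suc m))} {∑ (λ j → pole (inject₁ j) * pole (inject₁ j))} (last-one (suc m))
        (ℝM.sum-zero (suc m) {λ j → pole (inject₁ j) * pole (inject₁ j)}
          (λ j → ≈-trans (*-congʳ {pole (inject₁ j)} (init-zero (suc m) j)) (zeroˡ (pole (inject₁ j))))) d)))
      (≈-trans (≈-sym (F.zonal-form pole)) (≈-trans (≈-sym (value pole)) (IsZonalHarmonic.normalised isZonal))))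

  zonal-value : ∀ x → ⟦ L ⟧ x ≈ Z (x (fromℕ (suc m))) (∑ (λ j → x (inject₁ j) * x (inject₁ j))) d
  zonal-value x = ≈-trans (value x) (≈-trans (F.zonal-form x) (≈-trans
    (*-congʳ {Z (x (fromℕ (suc m))) (∑ (λ j → x (inject₁ j) * x (inject₁ j))) d} c₀≈1)
    (*-identityˡ (Z (x (fromℕ (suc m))) (∑ (λ j → x (inject₁ j) * x (inject₁ j))) d))))

-- Bounded uniformly continuous functions on the sphere

Bounded∣_∣ : ∀ {n} → (Sphere n → ℝ) → Set
Bounded∣ f ∣ = Σ[ K ∈ ℚ ] 0ℚ ℚ.< K × (∀ x → Eventually (λ k → ℚ.∣ seq (f x) k ∣ ℚ.≤ K))

record BoundedFunction (n : ℕ) : Set where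
  constructor function
  field
    map        : Sphere n → ℝ
    uniform    : UniformlyContinuous map
    bounded    : Bounded∣ map ∣

open BoundedFunction

≤-weaken : ∀ {p ε η} → 0ℚ ℚ.< η → p ℚ.≤ ε → p ℚ.≤ ε ℚ.+ η
≤-weaken {p} {ε} {η} 0<η p≤ε = ℚ.≤-trans p≤ε (≡.subst (ℚ._≤ ε ℚ.+ η) (ℚ.+-identityʳ ε) (ℚ.+-monoʳ-≤ ε (ℚ.<⇒≤ 0<η)))

≤-fromℚ : ∀ {x p q} → p ℚ.≤ q → x ≤ fromℚ p → x ≤ fromℚ q
≤-fromℚ p≤q x≤p = mk≤ λ ε 0<ε → let N , below = eventually-below x≤p ε 0<ε in
  N , λ n N≤n → ℚ.≤-trans (below n N≤n) (ℚ.+-monoˡ-≤ ε p≤q)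

⊓-positive : ∀ {p q} → 0ℚ ℚ.< p → 0ℚ ℚ.< q → 0ℚ ℚ.< p ℚ.⊓ q
⊓-positive {p} {q} 0<p 0<q with ℚ.⊓-sel p q
... | inj₁ eq = ≡.subst (0ℚ ℚ.<_) (≡.sym eq) 0<p
... | inj₂ eq = ≡.subst (0ℚ ℚ.<_) (≡.sym eq) 0<q

module _ {n : ℕ} where

  uniform₂ : ∀ {f g : Sphere n → ℝ} → UniformlyContinuous f → UniformlyContinuous g → ∀ ε → 0ℚ ℚ.< ε →
    Σ[ δ ∈ ℚ ] 0ℚ ℚ.< δ × (∀ x y → (∀ i → ∣ proj₁ x i - proj₁ y i ∣ ≤ fromℚ δ) → Eventually (λ k →
      ℚ.∣ seq (f x) k ℚ.- seq (f y) k ∣ ℚ.≤ ε × ℚ.∣ seq (g x) k ℚ.- seq (g y) k ∣ ℚ.≤ ε))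
  uniform₂ {f} {g} uf ug ε 0<ε =
    let δ , 0<δ , close-f = uf (½ ℚ.* ε) (halve 0<ε)
        γ , 0<γ , close-g = ug (½ ℚ.* ε) (halve 0<ε)
    in δ ℚ.⊓ γ , ⊓-positive 0<δ 0<γ , λ x y near → eventually₂
      (λ k p q → ℚ.≤-trans p (ℚ.≤-reflexive (halves ε)) , ℚ.≤-trans q (ℚ.≤-reflexive (halves ε)))
      (eventually-below (close-f x y (λ i → ≤-fromℚ (ℚ.p⊓q≤p δ γ) (near i))) (½ ℚ.* ε) (halve 0<ε))
      (eventually-below (close-g x y (λ i → ≤-fromℚ (ℚ.p⊓q≤q δ γ) (near i))) (½ ℚ.* ε) (halve 0<ε))

  eventually⇒≤ : ∀ {x ε} → Eventually (λ k → ℚ.∣ seq x k ∣ ℚ.≤ ε) → ∣ x ∣ ≤ fromℚ ε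
  eventually⇒≤ (N , below) = mk≤ λ η 0<η → N , λ k N≤k → ≤-weaken 0<η (below k N≤k)

  abstract

    constant-uniform : ∀ c → UniformlyContinuous {n} (λ _ → c)
    constant-uniform c ε 0<ε = 1ℚ , ℚ.positive⁻¹ 1ℚ , λ x y _ → eventually⇒≤ {c - c} (0 , λ k _ →
      ≡.subst (ℚ._≤ ε) (≡.sym (≡.cong ℚ.∣_∣ (ℚ.+-inverseʳ (seq c k)))) (ℚ.<⇒≤ 0<ε))

    constant-bounded : ∀ c → Bounded∣_∣ {n} (λ _ → c)
    constant-bounded c = let K , 0<K , c≤K = eventually-bounded c in K , 0<K , λ _ → c≤K

    +-uniform : ∀ f g → UniformlyContinuous {n} f → UniformlyContinuous g → UniformlyContinuous (λ x → f x + g x)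
    +-uniform f g uf ug ε 0<ε = let δ , 0<δ , close = uniform₂ {f} {g} uf ug (½ ℚ.* ε) (halve 0<ε) in δ , 0<δ , λ x y near →
      let N , c = close x y near in eventually⇒≤ {(f x + g x) - (f y + g y)} (N , λ k N≤k → ℚ.≤-trans
        (≡.subst (λ r → ℚ.∣ r ∣ ℚ.≤ ℚ.∣ seq (f x) k ℚ.- seq (f y) k ∣ ℚ.+ ℚ.∣ seq (g x) k ℚ.- seq (g y) k ∣)
          (solve 4 (λ x y z w → (x :- y) :+ (z :- w) := (x :+ z) :- (y :+ w)) ≡.refl
            (seq (f x) k) (seq (f y) k) (seq (g x) k) (seq (g y) k))
          (ℚ.∣p+q∣≤∣p∣+∣q∣ (seq (f x) k ℚ.- seq (f y) k) (seq (g x) k ℚ.- seq (g y) k)))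
        (≤-halves (proj₁ (c k N≤k)) (proj₂ (c k N≤k))))
      where open ℚS

    +-bounded : ∀ f g → Bounded∣_∣ {n} f → Bounded∣ g ∣ → Bounded∣ (λ x → f x + g x) ∣
    +-bounded f g (K , 0<K , f≤) (L , 0<L , g≤) = K ℚ.+ L , ℚ.+-mono-< 0<K 0<L , λ x → eventually₂
      (λ k p q → ℚ.≤-trans (ℚ.∣p+q∣≤∣p∣+∣q∣ (seq (f x) k) (seq (g x) k)) (ℚ.+-mono-≤ p q)) (f≤ x) (g≤ x)

    neg-uniform : ∀ f → UniformlyContinuous {n} f → UniformlyContinuous (λ x → - f x)
    neg-uniform f uf ε 0<ε = let δ , 0<δ , close = uniform₂ {f} {f} uf uf ε 0<ε in δ , 0<δ , λ x y near →
      let N , c = close x y near in eventually⇒≤ {(- f x) - (- f y)} (N , λ k N≤k → ≡.subst (ℚ._≤ ε)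
        (≡.trans (∣-∣-swap (seq (f x) k) (seq (f y) k)) (≡.cong ℚ.∣_∣
          (solve 2 (λ x y → y :- x := (:- x) :- (:- y)) ≡.refl (seq (f x) k) (seq (f y) k)))) (proj₁ (c k N≤k)))
      where open ℚS

    neg-bounded : ∀ f → Bounded∣_∣ {n} f → Bounded∣ (λ x → - f x) ∣
    neg-bounded f (K , 0<K , f≤) = K , 0<K , λ x → let N , p = f≤ x in
      N , λ k N≤k → ≡.subst (ℚ._≤ K) (≡.sym (ℚ.∣-p∣≡∣p∣ (seq (f x) k))) (p k N≤k)

    *-uniform : ∀ f g → Bounded∣_∣ {n} f → Bounded∣ g ∣ → UniformlyContinuous f → UniformlyContinuous g → UniformlyContinuous (λ x → f x * g x)
    *-uniform f g (K , 0<K , f≤) (L , 0<L , g≤) uf ug ε 0<ε =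
      let η , 0<η , eq = divide (K ℚ.+ L) (½ ℚ.* ε) (ℚ.+-mono-< 0<K 0<L) (halve 0<ε)
          δ , 0<δ , close = uniform₂ {g} {f} ug uf η 0<η
      in δ , 0<δ , λ x y near → eventually⇒≤ {f x * g x - f y * g y} (eventually₂
        (λ { k (p , q) (fx≤ , gy≤) → ℚ.≤-trans
          (∣*-*∣≤ {K ℚ.+ L} {η} {η} (seq (f x) k) (seq (g x) k) (seq (f y) k) (seq (g y) k)
            (ℚ.≤-trans fx≤ (≤-weaken 0<L ℚ.≤-refl))
            (ℚ.≤-trans gy≤ (≡.subst (L ℚ.≤_) (ℚ.+-comm L K) (≤-weaken 0<K ℚ.≤-refl))) p q)
          (≤-halves (ℚ.≤-reflexive eq) (ℚ.≤-reflexive eq)) })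
        (close x y near) (eventually₂ (λ _ → _,_) (f≤ x) (g≤ y)))

    *-bounded : ∀ f g → Bounded∣_∣ {n} f → Bounded∣ g ∣ → Bounded∣ (λ x → f x * g x) ∣
    *-bounded f g (K , 0<K , f≤) (L , 0<L , g≤) =
      K ℚ.* L , ℚ.positive⁻¹ _ {{ℚ.pos*pos⇒pos K {{ℚ.positive 0<K}} L {{ℚ.positive 0<L}}}} , λ x → eventually₂
      (λ k p q → ≡.subst (ℚ._≤ K ℚ.* L) (≡.sym (ℚ.∣p*q∣≡∣p∣*∣q∣ (seq (f x) k) (seq (g x) k)))
        (*-mono-≤-nonNeg (ℚ.0≤∣p∣ (seq (f x) k)) p (ℚ.0≤∣p∣ (seq (g x) k)) q)) (f≤ x) (g≤ x)

  infixl 6 _⊞_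
  infixl 7 _⊠_

  constant : ℝ → BoundedFunction n
  constant c = function (λ _ → c) (constant-uniform c) (constant-bounded c)

  _⊞_ _⊠_ : BoundedFunction n → BoundedFunction n → BoundedFunction n
  f ⊞ g = function (λ x → map f x + map g x) (+-uniform (map f) (map g) (uniform f) (uniform g)) (+-bounded (map f) (map g) (bounded f) (bounded g))
  f ⊠ g = function (λ x → map f x * map g x)
    (*-uniform (map f) (map g) (bounded f) (bounded g) (uniform f) (uniform g)) (*-bounded (map f) (map g) (bounded f) (bounded g))

  opposite : BoundedFunction n → BoundedFunction n
  opposite f = function (λ x → - map f x) (neg-uniform (map f) (uniform f)) (neg-bounded (map f) (bounded f))

0≤square : ∀ q → 0ℚ ℚ.≤ q ℚ.* q
0≤square q = ≡.subst (0ℚ ℚ.≤_) (≡.trans (≡.sym (ℚ.∣p*q∣≡∣p∣*∣q∣ q q)) (square q)) (ℚ.≤-trans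
  (ℚ.≤-reflexive (≡.sym (ℚ.*-zeroʳ ℚ.∣ q ∣))) (ℚ.*-monoˡ-≤-nonNeg ℚ.∣ q ∣ {{ℚ.∣-∣-nonNeg q}} (ℚ.0≤∣p∣ q)))
  where
  square : ∀ q → ℚ.∣ q ℚ.* q ∣ ≡ q ℚ.* q
  square q with ℚ.∣p∣≡p∨∣p∣≡-p q
  ... | inj₁ eq = ≡.trans (ℚ.∣p*q∣≡∣p∣*∣q∣ q q) (≡.cong₂ ℚ._*_ eq eq)
  ... | inj₂ eq = ≡.trans (ℚ.∣p*q∣≡∣p∣*∣q∣ q q) (≡.trans (≡.cong₂ ℚ._*_ eq eq)
    (ℚS.solve 1 (λ q → (ℚS.:- q) ℚS.:* (ℚS.:- q) ℚS.:= q ℚS.:* q) ≡.refl q))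

∣q∣≤1+q² : ∀ q → ℚ.∣ q ∣ ℚ.≤ 1ℚ ℚ.+ q ℚ.* q
∣q∣≤1+q² q with ℚ.≤-total ℚ.∣ q ∣ 1ℚ
... | inj₁ ∣q∣≤1 = ℚ.≤-trans ∣q∣≤1 (≡.subst (ℚ._≤ 1ℚ ℚ.+ q ℚ.* q) (ℚ.+-identityʳ 1ℚ) (ℚ.+-monoʳ-≤ 1ℚ (0≤square q)))
... | inj₂ 1≤∣q∣ = begin
  ℚ.∣ q ∣  ≡⟨ ℚ.*-identityˡ ℚ.∣ q ∣ ⟨
  1ℚ ℚ.* ℚ.∣ q ∣  ≤⟨ ℚ.*-monoʳ-≤-nonNeg ℚ.∣ q ∣ {{ℚ.∣-∣-nonNeg q}} 1≤∣q∣ ⟩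
  ℚ.∣ q ∣ ℚ.* ℚ.∣ q ∣  ≡⟨ ℚ.∣p*q∣≡∣p∣*∣q∣ q q ⟨
  ℚ.∣ q ℚ.* q ∣  ≡⟨ ℚ.0≤p⇒∣p∣≡p (0≤square q) ⟩
  q ℚ.* q  ≡⟨ ℚ.+-identityˡ (q ℚ.* q) ⟨
  0ℚ ℚ.+ q ℚ.* q  ≤⟨ ℚ.+-monoˡ-≤ (q ℚ.* q) (ℚ.nonNegative⁻¹ 1ℚ) ⟩
  1ℚ ℚ.+ q ℚ.* q  ∎
  where open ℚ.≤-Reasoning

0≤r² : ∀ {n} (x : Space n) k → 0ℚ ℚ.≤ seq (r² x) k
0≤r² {zero}  x k = ℚ.≤-refl
0≤r² {suc n} x k = ℚ.+-mono-≤ (0≤square (seq (x zero) k)) (0≤r² (x ∘ suc) k)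

square≤r² : ∀ {n} (x : Space n) i k → seq (x i) k ℚ.* seq (x i) k ℚ.≤ seq (r² x) k
square≤r² x zero    k = ≡.subst (ℚ._≤ seq (r² x) k) (ℚ.+-identityʳ _)
  (ℚ.+-monoʳ-≤ (seq (x zero) k ℚ.* seq (x zero) k) (0≤r² (x ∘ suc) k))
square≤r² x (suc i) k = ≡.subst (ℚ._≤ seq (r² x) k) (ℚ.+-identityˡ _)
  (ℚ.+-mono-≤ (0≤square (seq (x zero) k)) (square≤r² (x ∘ suc) i k))

abstract
  coordinate-bounded : ∀ {n} (i : Fin n) → Bounded∣_∣ {n} (λ x → proj₁ x i)
  coordinate-bounded i = 1ℚ ℚ.+ (1ℚ ℚ.+ 1ℚ) , ℚ.positive⁻¹ _ , λ { (x , r²≈1) →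
    let N , close = eventually-close r²≈1 1ℚ (ℚ.positive⁻¹ 1ℚ) in N , λ k N≤k → begin
      ℚ.∣ seq (x i) k ∣  ≤⟨ ∣q∣≤1+q² (seq (x i) k) ⟩
      1ℚ ℚ.+ seq (x i) k ℚ.* seq (x i) k  ≤⟨ ℚ.+-monoʳ-≤ 1ℚ (square≤r² x i k) ⟩
      1ℚ ℚ.+ seq (r² x) k  ≡⟨ ≡.cong (1ℚ ℚ.+_) (ℚ.0≤p⇒∣p∣≡p (0≤r² x k)) ⟨
      1ℚ ℚ.+ ℚ.∣ seq (r² x) k ∣  ≤⟨ ℚ.+-monoʳ-≤ 1ℚ (∣-∣≤∣-∣+ (seq (r² x) k) 1ℚ) ⟩
      1ℚ ℚ.+ (ℚ.∣ seq (r² x) k ℚ.- 1ℚ ∣ ℚ.+ 1ℚ)  ≤⟨ ℚ.+-monoʳ-≤ 1ℚ (ℚ.+-monoˡ-≤ 1ℚ (close k N≤k)) ⟩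
      1ℚ ℚ.+ (1ℚ ℚ.+ 1ℚ)  ∎ }
    where open ℚ.≤-Reasoning

coordinate : ∀ {n} → Fin n → BoundedFunction n
coordinate i = function (λ x → proj₁ x i) (λ ε 0<ε → ε , 0<ε , λ x y near → near i) (coordinate-bounded i)

module _ (n : ℕ) where

  private module R = CommutativeRing ℝ-commutativeRing

  function-ring : CommutativeRing 0ℓ 0ℓ
  function-ring = record
    { Carrier = BoundedFunction n
    ; _≈_ = λ f g → ∀ x → map f x ≈ map g x
    ; _+_ = _⊞_ ; _*_ = _⊠_ ; -_ = opposite ; 0# = constant 0ℝ ; 1# = constant 1ℝ
    ; isCommutativeRing = record
      { isRing = record
        { +-isAbelianGroup = record
          { isGroup = record
            { isMonoid = record
              { isSemigroup = record
                { isMagma = record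
                  { isEquivalence = record
                    { refl = λ _ → ≈-refl ; sym = λ f≈g x → ≈-sym (f≈g x) ; trans = λ f≈g g≈h x → ≈-trans (f≈g x) (g≈h x) }
                  ; ∙-cong = λ f≈g h≈k x → +-cong (f≈g x) (h≈k x) }
                ; assoc = λ f g h x → R.+-assoc (map f x) (map g x) (map h x) }
              ; identity = (λ f x → R.+-identityˡ (map f x)) , (λ f x → R.+-identityʳ (map f x)) }
            ; inverse = (λ f x → R.-‿inverseˡ (map f x)) , (λ f x → R.-‿inverseʳ (map f x))
            ; ⁻¹-cong = λ f≈g x → -‿cong (f≈g x) }
          ; comm = λ f g x → R.+-comm (map f x) (map g x) }
        ; *-cong = λ f≈g h≈k x → *-cong (f≈g x) (h≈k x)
        ; *-assoc = λ f g h x → R.*-assoc (map f x) (map g x) (map h x)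
        ; *-identity = (λ f x → R.*-identityˡ (map f x)) , (λ f x → R.*-identityʳ (map f x))
        ; distrib = (λ f g h x → R.distribˡ (map f x) (map g x) (map h x)) , (λ f g h x → R.distribʳ (map f x) (map g x) (map h x)) }
      ; *-comm = λ f g x → R.*-comm (map f x) (map g x) } }

  constant-homo : ℚ.+-*-rawRing -Raw-AlmostCommutative⟶ fromCommutativeRing function-ring
  constant-homo = record
    { ⟦_⟧ = λ q → constant (fromℚ q)
    ; +-homo = λ p q _ → ≡⇒≈ λ _ → ≡.refl
    ; *-homo = λ p q _ → ≡⇒≈ λ _ → ≡.refl
    ; -‿homo = λ p _ → ≡⇒≈ λ _ → ≡.refl
    ; 0-homo = λ _ → ≈-refl
    ; 1-homo = λ _ → ≈-refl }

-- Moments of the last coordinate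

rotate-at-inject₁ : ∀ {n} (i : Fin n) c s x → ℝB.rotate i c s x (inject₁ i) ≈ c * x (inject₁ i) - s * x (suc i)
rotate-at-inject₁ zero    c s x = ≈-refl
rotate-at-inject₁ (suc i) c s x = rotate-at-inject₁ i c s (x ∘ suc)

rotate-at-suc : ∀ {n} (i : Fin n) c s x → ℝB.rotate i c s x (suc i) ≈ s * x (inject₁ i) + c * x (suc i)
rotate-at-suc zero    c s x = ≈-refl
rotate-at-suc (suc i) c s x = rotate-at-suc i c s (x ∘ suc)

all-equal : ∀ m (Q : Fin (suc m) → ℝ) → (∀ i → Q (suc i) ≈ Q (inject₁ i)) → ∀ j → Q j ≈ Q (fromℕ m)
all-equal zero    Q eq zero    = ≈-refl
all-equal (suc m) Q eq zero    = ≈-trans (≈-sym (eq zero)) (all-equal m (Q ∘ suc) (eq ∘ suc) zero)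
all-equal (suc m) Q eq (suc j) = all-equal m (Q ∘ suc) (eq ∘ suc) j

^-cong : ∀ {x y} k → x ≈ y → x ^ k ≈ y ^ k
^-cong zero    x≈y = ≈-refl
^-cong (suc k) x≈y = *-cong x≈y (^-cong k x≈y)

module _ {m : ℕ} (σ : RotationInvariantProbability (2 ℕ.+ m)) where

  private
    n : ℕ
    n = 2 ℕ.+ m

    module Tr = CommutativeRing (function-ring n)
    module T where
      open Algebra.Properties.Semiring.Exp Tr.semiring public using (_^_)
      open Algebra.Properties.Semiring.Sum Tr.semiring public using (sum)
      open PlaneRotation (function-ring n) (constant-homo n) public using (cosine; sine)
    module Mo = Moment (function-ring n) ℝ-commutativeRing (constant-homo n) fromℚ-homo
    module ℝP = PlaneRotation ℝ-commutativeRing fromℚ-homo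

    E : BoundedFunction n → ℝ
    E f = ∫ σ (mkC (map f) (uniform f))

    module σ = RotationInvariantProbability σ

    E-cong : ∀ {f g} → (∀ x → map f x ≈ map g x) → E f ≈ E g
    E-cong {f} {g} f≈g = ≈-trans (σ.scalable 1ℝ (mkC (map g) (uniform g)) (mkC (map f) (uniform f))
      (λ x → ≈-trans (f≈g x) (≈-sym (*-identityˡ (map g x))))) (*-identityˡ (E g))

    E-+ : ∀ f g → E (f ⊞ g) ≈ E f + E g
    E-+ f g = σ.additive (mkC (map f) (uniform f)) (mkC (map g) (uniform g)) (mkC (map (f ⊞ g)) (uniform (f ⊞ g))) (λ _ → ≈-refl)

    E-[] : ∀ k f → E (constant (fromℕ′ k) ⊠ f) ≈ fromℕ′ k * E f
    E-[] k f = σ.scalable (fromℕ′ k) (mkC (map f) (uniform f)) (mkC (map h) (uniform h)) (λ _ → ≈-refl)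
      where
      h : BoundedFunction n
      h = constant (fromℕ′ k) ⊠ f

    E-rotate : ∀ i c s → c * c + s * s ≈ 1ℝ → ∀ f g →
      (∀ x y → (∀ j → proj₁ y j ≈ ℝB.rotate i c s (proj₁ x) j) → map g x ≈ map f y) → E g ≈ E f
    E-rotate i c s unit f g eq = σ.invariant (ℝM.rotation i c s) (rotation-specialOrthogonal i c s unit)
      (mkC (map f) (uniform f)) (mkC (map g) (uniform g))
      (λ x y y≈ → eq x y (λ j → ≈-trans (y≈ j) (ℝM.rotation-rotates i c s (proj₁ x) j)))

    map-^ : ∀ f k x → map (f T.^ k) x ≈ map f x ^ k
    map-^ f zero    x = ≈-refl
    map-^ f (suc k) x = *-congˡ {map f x} (map-^ f k x)

    map-sum : ∀ {k} (h : Fin k → BoundedFunction n) x → map (T.sum h) x ≈ ∑ (λ i → map (h i) x)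
    map-sum {zero}  h x = ≈-refl
    map-sum {suc k} h x = +-congˡ {map (h zero) x} (map-sum (h ∘ suc) x)

    E-sum : ∀ {k} (h : Fin k → BoundedFunction n) → E (T.sum h) ≈ ∑ (λ i → E (h i))
    E-sum {zero}  h = Mo.E-zero E (λ {f} {g} → E-cong {f} {g}) E-+ E-[]
    E-sum {suc k} h = ≈-trans (E-+ (h zero) (T.sum (h ∘ suc))) (+-congˡ {E (h zero)} (E-sum (h ∘ suc)))

    a b : BoundedFunction n
    a = coordinate (fromℕ (suc m))
    b = coordinate (inject₁ (fromℕ m))

    adjacent : ∀ K → fromℕ′ (suc K) * E ((a T.^ K) ⊠ (b ⊠ b)) ≈ E (a T.^ (2 ℕ.+ K))
    adjacent K = Mo.moment E (λ {f} {g} → E-cong {f} {g}) E-+ E-[] a b K λ t →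
      E-rotate (fromℕ m) (ℝP.cosine t) (ℝP.sine t) (ℝP.cosine²+sine² t) ((a T.^ suc K) ⊠ b) (Mo.rotated a b (suc K) t)
        (λ x y y≈ → *-cong
          (≈-trans (map-^ ((T.cosine t ⊠ a) ⊞ (T.sine t ⊠ b)) (suc K) x) (≈-trans
            (^-cong (suc K) (≈-trans (CommutativeRing.+-comm ℝ-commutativeRing (map (T.cosine t ⊠ a) x) (map (T.sine t ⊠ b) x))
              (≈-sym (≈-trans (y≈ (fromℕ (suc m))) (rotate-at-suc (fromℕ m) (ℝP.cosine t) (ℝP.sine t) (proj₁ x))))))
            (≈-sym (map-^ a (suc K) y))))
          (≈-sym (≈-trans (y≈ (inject₁ (fromℕ m))) (rotate-at-inject₁ (fromℕ m) (ℝP.cosine t) (ℝP.sine t) (proj₁ x)))))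

    square : ℕ → Fin n → BoundedFunction n
    square K i = (a T.^ K) ⊠ (coordinate i ⊠ coordinate i)

    swap : ∀ K (i : Fin m) → E (square K (inject₁ (suc i))) ≈ E (square K (inject₁ (inject₁ i)))
    swap K i = E-rotate (inject₁ i) 0ℝ 1ℝ (≡⇒≈ λ _ → ≡.refl) (square K (inject₁ (inject₁ i))) (square K (inject₁ (suc i)))
      (λ x y y≈ → *-cong
        (≈-trans (map-^ a K x) (≈-trans (^-cong K (≈-sym (≈-trans (y≈ (fromℕ (suc m))) (rotate-last i 0ℝ 1ℝ (proj₁ x))))) (≈-sym (map-^ a K y))))
        (let p = proj₁ x (inject₁ (inject₁ i)) ; q = proj₁ x (suc (inject₁ i)) ; z = proj₁ y (inject₁ (inject₁ i))
             z≈ : z ≈ 0ℝ * p - 1ℝ * q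
             z≈ = ≈-trans (y≈ (inject₁ (inject₁ i))) (rotate-at-inject₁ (inject₁ i) 0ℝ 1ℝ (proj₁ x))
         in ≈-trans (≡⇒≈ {q * q} {(0ℝ * p - 1ℝ * q) * (0ℝ * p - 1ℝ * q)} (λ k → ℚS.solve 2
              (λ p q → q ℚS.:* q ℚS.:= (ℚS.con 0ℚ ℚS.:* p ℚS.:- ℚS.con 1ℚ ℚS.:* q) ℚS.:* (ℚS.con 0ℚ ℚS.:* p ℚS.:- ℚS.con 1ℚ ℚS.:* q))
              ≡.refl (seq p k) (seq q k)))
            (≈-sym (*-cong z≈ z≈))))
      where
      open SymmetricHarmonic ℝ-commutativeRing fromℚ-homo m using (rotate-last)

    squares : ∀ K → E (a T.^ K) ≈ ∑ (λ i → E (square K i))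
    squares K = ≈-trans (E-cong {a T.^ K} {T.sum (square K)} pointwise) (E-sum (square K))
      where
      open Algebra.Properties.Semiring.Sum (CommutativeRing.semiring ℝ-commutativeRing) using (*-distribˡ-sum)
      pointwise : ∀ x → map (a T.^ K) x ≈ map (T.sum (square K)) x
      pointwise x = let y = map (a T.^ K) x in
        ≈-trans (≈-sym (*-identityʳ y)) (≈-trans (*-congˡ {y} (≈-sym (proj₂ x)))
        (≈-trans (*-distribˡ-sum {n} y (λ i → proj₁ x i * proj₁ x i)) (≈-sym (map-sum (square K) x))))

    open SymmetricHarmonic ℝ-commutativeRing fromℚ-homo m using (moment-recurrence; β-step-unique; β₀₀)
    open ZonalExpansion ℝ-commutativeRing fromℚ-homo m using (β; 2*suc)
    open Algebra.Properties.Semiring.Sum (CommutativeRing.semiring ℝ-commutativeRing) using (sum-init-last)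

    step : ∀ K → fromℕ′ (suc K) * E (a T.^ K) ≈ (fromℕ′ 2 + fromℕ′ m + fromℕ′ K) * E (a T.^ (2 ℕ.+ K))
    step K = moment-recurrence K {Q} {Q (fromℕ m)} {E (a T.^ K)} {E (a T.^ (2 ℕ.+ K))}
      (all-equal m Q (swap K))
      (≈-trans (squares K) (≈-trans (sum-init-last {suc m} (λ i → E (square K i)))
        (+-congˡ {∑ Q} (E-cong {square K (fromℕ (suc m))} {a T.^ (2 ℕ.+ K)}
          (λ x → ≡⇒≈ λ k → solve 2 (λ p z → p :* (z :* z) := z :* (z :* p)) ≡.refl (seq (map (a T.^ K) x) k) (seq (map a x) k))))))
      (adjacent K)
      where
      open ℚS
      Q : Fin (suc m) → ℝ
      Q j = E (square K (inject₁ j))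

    even-moment : ∀ k → E (a T.^ (2 ℕ.* k)) ≈ β 0 k
    even-moment zero    = ≈-trans (σ.total (mkC (map (constant 1ℝ)) (uniform (constant 1ℝ))) (λ _ → ≈-refl)) (≈-sym β₀₀)
    even-moment (suc k) = ≈-trans (reflexive (≡.cong (λ z → E (a T.^ z)) (2*suc k)))
      (β-step-unique k {E (a T.^ (2 ℕ.* k))} {E (a T.^ (2 ℕ.+ 2 ℕ.* k))} (even-moment k) (step (2 ℕ.* k)))

  moment-value : ∀ k → ∫ σ (coordinatePower (fromℕ (suc m)) (2 ℕ.* k)) ≈ β 0 k
  moment-value k = ≈-trans
    (≈-trans (σ.scalable 1ℝ (mkC (map (a T.^ (2 ℕ.* k))) (uniform (a T.^ (2 ℕ.* k)))) (coordinatePower (fromℕ (suc m)) (2 ℕ.* k))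
      (λ x → ≈-trans (≈-sym (map-^ a (2 ℕ.* k) x)) (≈-sym (*-identityˡ (map (a T.^ (2 ℕ.* k)) x)))))
    (*-identityˡ (E (a T.^ (2 ℕ.* k))))) (even-moment k)

1-invertible : Invertible 1ℝ
1-invertible = 1ℝ , *-identityˡ 1ℝ , *-identityˡ 1ℝ

module Assembly (m : ℕ) {Γ½ : ℕ → ℝ} (isΓ : IsGammaAtHalves Γ½) where

  open ZonalExpansion ℝ-commutativeRing fromℚ-homo m
  open Constants ℝ-commutativeRing fromℚ-homo m

  χ-invertible : ∀ j → Invertible (χ j)
  χ-invertible zero    = 1-invertible
  χ-invertible (suc j) = invertible-* {ℝA.⅟ (2 ℕ.* suc j)} {χ j} (⅟-invertible (2 ℕ.* suc j)) (χ-invertible j)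

  π-invertible : ∀ i → Invertible (π i)
  π-invertible zero    = 1-invertible
  π-invertible (suc i) = invertible-* {ℝA.⅟ (2 ℕ.+ m ℕ.+ 2 ℕ.* i)} {π i} (⅟-invertible (2 ℕ.+ m ℕ.+ 2 ℕ.* i)) (π-invertible i)

  β₀-invertible : ∀ k → Invertible (β 0 k)
  β₀-invertible k = invertible-* {fromℕ′ ((2 ℕ.* k) !)} {χ k * π k} ([]-invertible ((2 ℕ.* k) !) {{(2 ℕ.* k) ℕ.!≢0}})
    (invertible-* {χ k} {π k} (χ-invertible k) (π-invertible k))

  Γ-invertible-+ : ∀ a → Invertible (Γ½ (a ℕ.+ (2 ℕ.+ m)))
  Γ-invertible-+ a = ≡.subst (Invertible ∘ Γ½) (≡.sym (ℕ.+-suc a (suc m))) (Γ-invertible {Γ½} isΓ (a ℕ.+ suc m))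

  γ : ℕ → ℝ
  γ i = Γ½ (2 ℕ.* i ℕ.+ (2 ℕ.+ m))

  γ-suc : ∀ i → fromℕ′ 2 * γ (suc i) ≈ fromℕ′ (2 ℕ.+ m ℕ.+ 2 ℕ.* i) * γ i
  γ-suc i = ≡.subst₂ (λ a b → fromℕ′ 2 * Γ½ a ≈ fromℕ′ (2 ℕ.+ m ℕ.+ 2 ℕ.* i) * Γ½ b)
    (solve 2 (λ m i → con 4 :+ m :+ con 2 :* i := con 2 :* (con 1 :+ i) :+ (con 2 :+ m)) ≡.refl m i)
    (solve 2 (λ m i → con 2 :+ m :+ con 2 :* i := con 2 :* i :+ (con 2 :+ m)) ≡.refl m i)
    (Γ-shift (1 ℕ.+ m ℕ.+ 2 ℕ.* i) Γ½ isΓ)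
    where open ℕS

  open Ratio γ γ-suc

  ratio : ∀ k l → l ℕ.≤ k → β (2 ℕ.* l) (k ℕ.∸ l) * (fromℕ′ ((k ℕ.∸ l) !) * Γ½ (2 ℕ.* k ℕ.+ 2 ℕ.* l ℕ.+ (2 ℕ.+ m)))
                          ≈ fromℕ′ (k !) * Γ½ (2 ℕ.* k ℕ.+ (2 ℕ.+ m)) * β 0 k
  ratio k l l≤k = ≡.subst₂ (λ a b → β (2 ℕ.* l) (k ℕ.∸ l) * (fromℕ′ ((k ℕ.∸ l) !) * Γ½ a) ≈ fromℕ′ (b !) * γ b * β 0 b)
    (≡.trans (≡.cong (λ z → 2 ℕ.* (z ℕ.+ l) ℕ.+ (2 ℕ.+ m)) (ℕ.m∸n+n≡m l≤k)) (≡.cong (ℕ._+ (2 ℕ.+ m)) (ℕ.*-distribˡ-+ 2 k l)))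
    (ℕ.m∸n+n≡m l≤k)
    (β-ratio (k ℕ.∸ l) l)

theorem7p2 : (m k : ℕ) →
    let n = 2 ℕ.+ m
        last = fromℕ (suc m)
    in
    (σ : RotationInvariantProbability n) →
    (L : (d : ℕ) → Form n d) → (∀ d → IsZonalHarmonic (L d)) →
    (Γ½ : ℕ → ℝ) → IsGammaAtHalves Γ½ →
    let I = ∫ σ (coordinatePower last (2 ℕ.* k))
        den = λ (l : Fin (suc k)) → fromℕ′ ((k ℕ.∸ toℕ l) !) * Γ½ (2 ℕ.* k ℕ.+ 2 ℕ.* toℕ l ℕ.+ n)
    in Σ[ I-inv ∈ Invertible I ] Σ[ den-inv ∈ (∀ l → Invertible (den l)) ]
       (∀ (x : Space n) →
         x last ^ (2 ℕ.* k) / I [ I-inv ]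
           ≈ ∑ (λ (l : Fin (suc k)) →
               (fromℕ′ (k !) * Γ½ (2 ℕ.* k ℕ.+ n)) / den l [ den-inv l ]
                 * fromℚ (dimH n (2 ℕ.* toℕ l))
                 * r² x ^ (k ℕ.∸ toℕ l)
                 * ⟦ L (2 ℕ.* toℕ l) ⟧ x))
theorem7p2 m k σ L isZonal Γ½ isΓ = I-inv , den-inv , expansion
  where
  open ZonalExpansion ℝ-commutativeRing fromℚ-homo m
  open Constants ℝ-commutativeRing fromℚ-homo m
  open Assembly m {Γ½} isΓ
  open Algebra.Properties.Semiring.Sum (CommutativeRing.semiring ℝ-commutativeRing) using (*-distribˡ-sum; sum-init-last)
  I : ℝ
  I = ∫ σ (coordinatePower (fromℕ (suc m)) (2 ℕ.* k))
  I-inv : Invertible I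
  I-inv = invertible-cong (≈-sym (moment-value σ k)) (β₀-invertible k)
  den : Fin (suc k) → ℝ
  den l = fromℕ′ ((k ℕ.∸ toℕ l) !) * Γ½ (2 ℕ.* k ℕ.+ 2 ℕ.* toℕ l ℕ.+ (2 ℕ.+ m))
  den-inv : ∀ l → Invertible (den l)
  den-inv l = invertible-* ([]-invertible ((k ℕ.∸ toℕ l) !) {{(k ℕ.∸ toℕ l) ℕ.!≢0}}) (Γ-invertible-+ (2 ℕ.* k ℕ.+ 2 ℕ.* toℕ l))
  I⁻¹ : ℝ
  I⁻¹ = proj₁ I-inv
  module _ (x : Space (2 ℕ.+ m)) where
    u v w : ℝ
    u = x (fromℕ (suc m))
    v = ∑ (λ j → x (inject₁ j) * x (inject₁ j))
    w = u * u + v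
    w≈r² : w ≈ r² x
    w≈r² = ≈-trans (CommutativeRing.+-comm ℝ-commutativeRing (u * u) v) (≈-sym (sum-init-last {suc m} (λ i → x i * x i)))
    s t : Fin (suc k) → ℝ
    s l = term u v (2 ℕ.* toℕ l) (k ℕ.∸ toℕ l)
    t l = fromℕ′ (k !) * Γ½ (2 ℕ.* k ℕ.+ (2 ℕ.+ m)) * proj₁ (den-inv l) * fromℚ (dimH (2 ℕ.+ m) (2 ℕ.* toℕ l))
            * r² x ^ (k ℕ.∸ toℕ l) * ⟦ L (2 ℕ.* toℕ l) ⟧ x
    terms : ∀ l → I⁻¹ * s l ≈ t l
    terms l = normalise-term {I} {I⁻¹} {den l} {proj₁ (den-inv l)} {β (2 ℕ.* toℕ l) (k ℕ.∸ toℕ l)} {fromℕ′ (k !) * Γ½ (2 ℕ.* k ℕ.+ (2 ℕ.+ m))}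
      {w ^ (k ℕ.∸ toℕ l)} {r² x ^ (k ℕ.∸ toℕ l)} {dim (2 ℕ.* toℕ l)} {fromℚ (dimH (2 ℕ.+ m) (2 ℕ.* toℕ l))}
      {Z u v (2 ℕ.* toℕ l)} {⟦ L (2 ℕ.* toℕ l) ⟧ x}
      (proj₁ (proj₂ I-inv)) (proj₂ (proj₂ (den-inv l)))
      (≈-trans (ratio k (toℕ l) (ℕ.≤-pred (Fin.toℕ<n l)))
        (*-congˡ {fromℕ′ (k !) * Γ½ (2 ℕ.* k ℕ.+ (2 ℕ.+ m))} (≈-sym (moment-value σ k))))
      (^-cong (k ℕ.∸ toℕ l) w≈r²)
      (≈-sym (dimH-dim ℝ-commutativeRing fromℚ-homo m (2 ℕ.* toℕ l)))
      (≈-sym (zonal-value (L (2 ℕ.* toℕ l)) (isZonal (2 ℕ.* toℕ l)) x))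
    expansion : u ^ (2 ℕ.* k) * I⁻¹ ≈ ∑ t
    expansion = ≈-trans (*-comm (u ^ (2 ℕ.* k)) I⁻¹) (≈-trans
      (*-congˡ {I⁻¹} (≈-trans (power-expansion u v (2 ℕ.* k)) (parts-even k (term u v))))
      (≈-trans (*-distribˡ-sum {suc k} I⁻¹ s) (sum-cong-≋ {suc k} {λ l → I⁻¹ * s l} {t} terms)))
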